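{- Let $\mathcal R=(R,<,+,0,\ldots)$ be a definably complete expansion of a densely linearly ordered abelian group. \begin{itemize} \item If $\mathcal R$ satisfies strongly locally uniform finiteness ($\mathrm{SLUF}$), then the open core of $\mathcal R$ is strongly locally o-minimal. \item If $\mathcal R$ satisfies locally uniform finiteness of the first kind ($\mathrm{LUF}_1$), then the open core of $\mathcal R$ is uniformly locally o-minimal of the first kind. \item If $\mathcal R$ satisfies locally uniform finiteness of the second kind ($\mathrm{LUF}_2$), then the open core of $\mathcal R$ is uniformly locally o-minimal of the second kind. \end{itemize}
   Context: Conventions: "definable" means definable in the given structure with parameters. $R$ carries the order topology and $R^n$ the product topology ($R^0$ is a one-point space). An open interval is a set $(c,d)=\{x: c<x<d\}$ and a closed interval a set $[c,d]=\{x:c\le x\le d\}$ with $c,d\in R$; an open (closed) box in $R^n$ is a product of $n$ open (closed) intervals. $\mathrm{int}(A)$ is the interior of $A$. For $X\subset R^{m+n}$ and $x\in R^m$, $X_x=\{y\in R^n: (x,y)\in X\}$. $|S|$ is the cardinality of $S$ ($|S|=\infty$ means $S$ infinite). An expansion of a densely linearly ordered abelian group is a structure $\mathcal R=(R,<,+,0,\ldots)$ where $(R,+,0)$ is an abelian group and $<$ is a dense translation-invariant linear order. Definably complete: every definable subset of $R$ has a supremum and an infimum in $R\cup\{\pm\infty\}$. $\mathrm{LUF}_2$: for all $m$, every definable $X\subset R^{m+1}$, $a\in R$, $b\in R^m$, there exist a positive integer $N$, a closed interval $I$ with $a\in\mathrm{int}(I)$ and an open box $U\subset R^m$ with $b\in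 U$ such that $|X_x\cap J|=\infty$ or $|X_x\cap J|\le N$ for all $x\in U$ and all closed intervals $J$ with $a\in\mathrm{int}(J)\subset I$. $\mathrm{LUF}_1$: $\mathrm{LUF}_2$ holds and one can always take $U=R^m$. $\mathrm{SLUF}$: $\mathrm{LUF}_1$ holds and moreover $I$ can be taken independently of the definable set $X$ (i.e. for every $a\in R$ there is a closed interval $I$ with $a\in \mathrm{int}(I)$ such that for every $m$ and every definable $X\subset R^{m+1}$ there is a positive integer $N$ with $|X_x\cap J|=\infty$ or $|X_x\cap J|\le N$ for all $x\in R^m$ and all closed intervals $J$ with $a\in\mathrm{int}(J)\subset I$). The open core of $\mathcal R$ is the structure with universe $R$ whose primitive relations are all open subsets of $R^n$, $n\ge1$, definable in $\mathcal R$ (it includes the order $<$). A densely linearly ordered structure $\mathcal M=(M,<,\ldots)$ is: strongly locally o-minimal if for every $a\in M$ there is an open interval $I\ni a$ such that for every definable $X\subset M$ the set $X\cap I$ is a finite union of points and open intervals; uniformly locally o-minimal of the second kind if for every positive integer $n$, every definable $X\subset M^{n+1}$, $a\in M$ and $b\in M^n$, there exist an open interval $I\ni a$ and an open box $B\ni b$ in $M^n$ such that $X_y\cap I$ is a finite union of points and open intervals for all $y\in B$; uniformly locally o-minimal of the first kind if in the latter one can always take $B=M^n$. -}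

module Defs where

open import Level using (Level) renaming (suc to lsuc)
open import Algebra.Structures using (IsAbelianGroup)
open import Data.Empty.Polymorphic using (⊥)
open import Data.Fin.Base using (Fin; zero; suc)
open import Data.List.Base using (List; length)
open import Data.List.Relation.Unary.Any using (Any)
import Data.List.Membership.Propositional as List
open import Data.Nat.Base as ℕ using (ℕ; zero; suc; _+_)
open import Data.Product.Base using (Σ-syntax; ∃-syntax; _×_; _,_)
open import Data.Sum.Base using (_⊎_; inj₁; inj₂)
open import Data.Vec.Base using (Vec; []; _∷_; _++_; lookup)
open import Data.Vec.Relation.Binary.Pointwise.Inductive using (Pointwise; []; _∷_)
open import Function.Base using (flip)
open import Relation.Binary.Core using (Rel)
open import Relation.Binary.PropositionalEquality.Core using (_≡_)
open import Relation.Binary.Structures using (IsDenseLinearOrder)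
import Relation.Binary.Construct.StrictToNonStrict as ToNonStrict
import Relation.Binary.Construct.Add.Extrema.Strict as AddExtremaStrict
import Relation.Binary.Construct.Add.Extrema.NonStrict as AddExtremaNonStrict
open import Relation.Nullary.Construct.Add.Extrema using (_±; [_]; ⊥±; ⊤±)
open import Relation.Nullary.Negation.Core using (¬_)
open import Relation.Unary using (Pred; _∈_; _⊆_; _∩_; _≐_)

private
  variable
    ℓ : Level
    m n : ℕ

record Language ℓ : Set (lsuc ℓ) where
  field
    Function : ℕ → Set ℓ
    Relation : ℕ → Set ℓ

module _ (L : Language ℓ) where
  open Language L

  -- Variables are de Bruijn indices; n bounds the free variables.
  data Term (n : ℕ) : Set ℓ where
    var : Fin n → Term n
    fun : ∀ {k} → Function k → Vec (Term n) k → Term n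

  -- The semantics is only used classically, so the remaining connectives
  -- are regarded as abbreviations.
  data Formula (n : ℕ) : Set ℓ where
    rel   : ∀ {k} → Relation k → Vec (Term n) k → Formula n
    _≈ᶠ_  : Term n → Term n → Formula n
    ¬ᶠ_   : Formula n → Formula n
    _∧ᶠ_  : Formula n → Formula n → Formula n
    ∃ᶠ_   : Formula (suc n) → Formula n

  record Structure : Set (lsuc ℓ) where
    field
      Carrier : Set ℓ
      ⟦_⟧ᶠ    : Function n → Vec Carrier n → Carrier
      ⟦_⟧ʳ    : Relation n → Pred (Vec Carrier n) ℓ

module _ {L : Language ℓ} (M : Structure L) where
  open Structure M

  eval  : Term L n → Vec Carrier n → Carrier
  evals : ∀ {k} → Vec (Term L n) k → Vec Carrier n → Vec Carrier k

  eval (var i)    ρ = lookup ρ i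
  eval (fun f ts) ρ = ⟦ f ⟧ᶠ (evals ts ρ)

  evals []       ρ = []
  evals (t ∷ ts) ρ = eval t ρ ∷ evals ts ρ

  sat : Formula L n → Pred (Vec Carrier n) ℓ
  sat (rel r ts) ρ = ⟦ r ⟧ʳ (evals ts ρ)
  sat (s ≈ᶠ t)   ρ = eval s ρ ≡ eval t ρ
  sat (¬ᶠ φ)     ρ = ¬ sat φ ρ
  sat (φ ∧ᶠ ψ)   ρ = sat φ ρ × sat ψ ρ
  sat (∃ᶠ φ)     ρ = ∃[ x ] sat φ (x ∷ ρ)

  -- A subset of Mⁿ definable with parameters, presented by a defining
  -- formula and its parameters.
  record DefinableSet (n : ℕ) : Set ℓ where
    constructor definable
    field
      {#params} : ℕ
      formula : Formula L (n + #params)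
      params  : Vec Carrier #params

    ⟦_⟧ : Pred (Vec Carrier n) ℓ
    ⟦_⟧ x = sat formula (x ++ params)

open DefinableSet public using (⟦_⟧)

record DenselyOrderedStructure ℓ : Set (lsuc ℓ) where
  field
    language  : Language ℓ
    structure : Structure language

  open Language language public
  open Structure structure public

  field
    <-symbol : Relation 2

  infix 4 _<_
  _<_ : Rel Carrier ℓ
  x < y = ⟦ <-symbol ⟧ʳ (x ∷ y ∷ [])

  field
    isDenseLinearOrder : IsDenseLinearOrder _≡_ _<_

module _ (M : DenselyOrderedStructure ℓ) where
  open DenselyOrderedStructure M
  open IsDenseLinearOrder isDenseLinearOrder using (dense)
  open ToNonStrict _≡_ _<_ using (_≤_)
  open AddExtremaStrict _<_ using (_<±_; [_]<⊤±; ⊥±<[_])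
    renaming ([_] to <±[_])
  open AddExtremaNonStrict _≤_ using (_≤±_)

  Definable : ℕ → Set ℓ
  Definable = DefinableSet structure

  subset : Definable 1 → Pred Carrier ℓ
  subset X x = (x ∷ []) ∈ ⟦ X ⟧

  fibre : Definable (m + 1) → Vec Carrier m → Pred Carrier ℓ
  fibre X x y = (x ++ y ∷ []) ∈ ⟦ X ⟧

  -- Suprema and infima are taken in M ± = M ∪ {±∞}.
  IsSupremum IsInfimum : Pred Carrier ℓ → Carrier ± → Set ℓ
  IsSupremum X s =
      (∀ x → x ∈ X → [ x ] ≤± s)
    × (∀ u → (∀ x → x ∈ X → [ x ] ≤± u) → s ≤± u)
  IsInfimum X i =
      (∀ x → x ∈ X → i ≤± [ x ])
    × (∀ l → (∀ x → x ∈ X → l ≤± [ x ]) → l ≤± i)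

  DefinablyComplete : Set ℓ
  DefinablyComplete = (X : Definable 1) →
    (∃[ s ] IsSupremum (subset X) s) × (∃[ i ] IsInfimum (subset X) i)

  Interval : Set ℓ
  Interval = Carrier × Carrier

  Open Closed : Interval → Pred Carrier ℓ
  Open   (c , d) x = c < x × x < d
  Closed (c , d) x = c ≤ x × x ≤ d

  OpenBox : Vec Interval n → Pred (Vec Carrier n) ℓ
  OpenBox U x = Pointwise (flip Open) x U

  -- The order topology and its products: basic open sets have endpoints
  -- in M ∪ {±∞}, so that the definition does not presuppose that M has
  -- no extrema.

  BasicOpen : Carrier ± × Carrier ± → Pred Carrier ℓ
  BasicOpen (l , u) x = l <± [ x ] × [ x ] <± u

  BasicOpenBox : Vec (Carrier ± × Carrier ±) n → Pred (Vec Carrier n) ℓ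
  BasicOpenBox B x = Pointwise (flip BasicOpen) x B

  IsOpen : Pred (Vec Carrier n) ℓ → Set ℓ
  IsOpen X = ∀ x → x ∈ X → ∃[ B ] x ∈ BasicOpenBox B × BasicOpenBox B ⊆ X

  int : Pred Carrier ℓ → Pred Carrier ℓ
  int A x = ∃[ B ] x ∈ BasicOpen B × BasicOpen B ⊆ A

  Card≤ : ℕ → Pred Carrier ℓ → Set ℓ
  Card≤ N S = ∃[ xs ] length xs ℕ.≤ N × S ⊆ (List._∈ xs)

  Infinite : Pred Carrier ℓ → Set ℓ
  Infinite S = ¬ (∃[ N ] Card≤ N S)

  UniformlyFiniteNear : Carrier → Interval → ℕ → Pred Carrier ℓ → Set ℓ
  UniformlyFiniteNear a I N S =
    ∀ J → a ∈ int (Closed J) → int (Closed J) ⊆ Closed I →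
    Infinite (S ∩ Closed J) ⊎ Card≤ N (S ∩ Closed J)

  -- LUF: locally uniform finiteness (of the first or second kind); SLUF is
  -- the strong version.
  LUF₂ : Set ℓ
  LUF₂ = ∀ m (X : Definable (m + 1)) (a : Carrier) (b : Vec Carrier m) →
    ∃[ N ] ∃[ I ] Σ[ U ∈ Vec Interval m ]
      0 ℕ.< N × a ∈ int (Closed I) × b ∈ OpenBox U ×
      (∀ x → x ∈ OpenBox U → UniformlyFiniteNear a I N (fibre X x))

  -- With U = Mᵐ the base point b plays no role.
  LUF₁ : Set ℓ
  LUF₁ = LUF₂ ×
    (∀ m (X : Definable (m + 1)) (a : Carrier) →
      ∃[ N ] ∃[ I ]
        0 ℕ.< N × a ∈ int (Closed I) ×
        (∀ x → UniformlyFiniteNear a I N (fibre X x)))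

  SLUF : Set ℓ
  SLUF = LUF₁ ×
    (∀ a → ∃[ I ] a ∈ int (Closed I) ×
      (∀ m (X : Definable (m + 1)) →
        ∃[ N ] 0 ℕ.< N × (∀ x → UniformlyFiniteNear a I N (fibre X x))))

  PointOrInterval : Carrier ⊎ Interval → Pred Carrier ℓ
  PointOrInterval (inj₁ c) x = x ≡ c
  PointOrInterval (inj₂ I) x = x ∈ Open I

  IsFiniteUnion : Pred Carrier ℓ → Set ℓ
  IsFiniteUnion S =
    Σ[ ps ∈ List (Carrier ⊎ Interval) ] S ≐ λ x → Any (λ p → x ∈ PointOrInterval p) ps

  StronglyLocallyOMinimal : Set ℓ
  StronglyLocallyOMinimal =
    ∀ a → ∃[ I ] a ∈ Open I ×
      ((X : Definable 1) → IsFiniteUnion (subset X ∩ Open I))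

  UniformlyLocallyOMinimal₂ : Set ℓ
  UniformlyLocallyOMinimal₂ =
    ∀ n → 0 ℕ.< n → (X : Definable (n + 1)) (a : Carrier) (b : Vec Carrier n) →
    ∃[ I ] Σ[ B ∈ Vec Interval n ] a ∈ Open I × b ∈ OpenBox B ×
      (∀ y → y ∈ OpenBox B → IsFiniteUnion (fibre X y ∩ Open I))

  UniformlyLocallyOMinimal₁ : Set ℓ
  UniformlyLocallyOMinimal₁ =
    ∀ n → 0 ℕ.< n → (X : Definable (n + 1)) (a : Carrier) →
    ∃[ I ] a ∈ Open I × (∀ y → IsFiniteUnion (fibre X y ∩ Open I))

  openCoreLanguage : Language ℓ
  openCoreLanguage = record
    { Function = λ _ → ⊥
    ; Relation = λ n → 0 ℕ.< n × Σ[ X ∈ Definable n ] IsOpen ⟦ X ⟧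
    }

  openCoreStructure : Structure openCoreLanguage
  openCoreStructure = record
    { Carrier = Carrier
    ; ⟦_⟧ᶠ    = λ ()
    ; ⟦_⟧ʳ    = λ (_ , X , _) → ⟦ X ⟧
    }

  <-definable : Definable 2
  <-definable = definable (rel <-symbol (var zero ∷ var (suc zero) ∷ [])) []

  <-isOpen : IsOpen ⟦ <-definable ⟧
  <-isOpen (x ∷ y ∷ []) x<y with dense x<y
  ... | z , x<z , z<y =
    (⊥± , [ z ]) ∷ ([ z ] , ⊤±) ∷ [] ,
    (⊥±<[ x ] , <±[ x<z ]) ∷ (<±[ z<y ] , [ y ]<⊤±) ∷ [] ,
    λ where ((_ , <±[ x<z ]) ∷ (<±[ z<y ] , _) ∷ []) → <-trans x<z z<y
    where open IsDenseLinearOrder isDenseLinearOrder using () renaming (trans to <-trans)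

  -- The symbol chosen for the order is interpreted as the original order.
  openCore : DenselyOrderedStructure ℓ
  openCore = record
    { language           = openCoreLanguage
    ; structure          = openCoreStructure
    ; <-symbol           = ℕ.s≤s ℕ.z≤n , <-definable , <-isOpen
    ; isDenseLinearOrder = isDenseLinearOrder
    }

record OrderedGroupExpansion ℓ : Set (lsuc ℓ) where
  field
    orderedStructure : DenselyOrderedStructure ℓ

  open DenselyOrderedStructure orderedStructure public

  field
    +-symbol : Function 2
    0-symbol : Function 0

  infixl 6 _⊕_
  _⊕_ : Carrier → Carrier → Carrier
  x ⊕ y = ⟦ +-symbol ⟧ᶠ (x ∷ y ∷ [])

  𝟘 : Carrier
  𝟘 = ⟦ 0-symbol ⟧ᶠ []

  field
    ⊖_             : Carrier → Carrier
    isAbelianGroup : IsAbelianGroup _≡_ _⊕_ 𝟘 ⊖_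
    <-translation  : ∀ {x y} z → x < y → x ⊕ z < y ⊕ z

{-# OPTIONS --safe #-}

-- A set is D_Σ when it is the union of a definable family of compact sets F r s
-- which grow as r grows and as s > 0 shrinks.  Open and closed definable sets
-- are D_Σ, and D_Σ sets are stable under unions, intersections and projections.
--
-- For a D_Σ set A whose fibres over a parameter space have no interior, uniform
-- finiteness is applied to the left end points of the gaps longer than ζ in
-- compact sets approximating the fibres, as ζ → 0.  Since these end points are
-- ζ-separated they are locally finite, so their number is bounded uniformly,
-- and so is the number of points of the fibres.  This gives a Baire property
-- (some F r s has interior if A has) and shows that D_Σ sets without interior
-- are nowhere dense.
--
-- If A has dimension at most d and the points where A is not locally closed
-- project onto a box of some d-dimensional coordinate space, then over a smaller
-- box and near one of these points A is single-valued, hence contained in one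
-- compact F r s and locally closed after all.  So the points where A is not
-- locally closed form a D_Σ set of smaller dimension, and by induction the
-- complement of a D_Σ set is D_Σ.  Therefore all sets definable in the open core
-- are D_Σ.
--
-- The fibrewise boundary of such a set is D_Σ with fibres without interior.  So
-- it is locally uniformly finite, and it cuts the fibres into points and intervals.

module Submission where

open import Defs
open import Level using (Level) renaming (suc to lsuc)
open import Axiom.ExcludedMiddle using (ExcludedMiddle)
open import Algebra.Bundles using (CommutativeMonoid)
import Algebra.Solver.CommutativeMonoid as CMSolver
open import Algebra.Structures using (IsAbelianGroup)
open import Data.Empty using (⊥; ⊥-elim)
open import Data.Fin.Base using (Fin; zero; suc; splitAt; _↑ˡ_; _↑ʳ_)
import Data.Fin.Properties as Finₚ
open import Data.List.Base as List using (List; []; _∷_; length)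
import Data.List.Properties as Listₚ
open import Data.List.Membership.Propositional using () renaming (_∈_ to _∈ˡ_)
import Data.List.Membership.Propositional.Properties as ∈ˡ
open import Data.List.Relation.Unary.Any using (Any; here; there)
import Data.List.Relation.Unary.Any.Properties as Anyₚ
open import Data.Nat.Base as ℕ using (ℕ; zero; suc; _+_)
import Data.Nat.Properties as ℕₚ
open import Data.Product.Base using (Σ-syntax; ∃; _×_; _,_; proj₁; proj₂; map₂)
open import Data.Sum.Base as Sum using (_⊎_; inj₁; inj₂; [_,_]′)
open import Data.Unit.Polymorphic.Base using (⊤; tt)
open import Data.Vec.Base using (Vec; []; _∷_; _++_; lookup; map; head; tail; take; drop; _[_]≔_)
open import Data.Vec.Properties using
  (lookup-splitAt; lookup-++ˡ; lookup-++ʳ; lookup-map; ++-injectiveˡ; ++-injectiveʳ; take++drop≡id;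
   tabulate-cong; tabulate∘lookup; lookup∘update; lookup∘update′; ∷-injectiveˡ; ∷-injectiveʳ)
open import Data.Vec.Relation.Binary.Pointwise.Inductive using ([]; _∷_)
open import Function.Base using (_∘_; id; case_of_)
import Relation.Binary.Construct.Add.Extrema.NonStrict as NonStrict±
import Relation.Binary.Construct.Add.Extrema.Strict as Strict±
import Relation.Binary.Construct.Add.Supremum.NonStrict as NonStrict⁺
import Relation.Binary.Construct.Add.Supremum.Strict as Strict⁺
import Relation.Binary.Construct.StrictToNonStrict as ToNonStrict
open import Relation.Binary.Definitions using (tri<; tri≈; tri>)
open import Relation.Binary.PropositionalEquality
  using (_≡_; refl; sym; trans; cong; cong₂; subst; subst₂)
open import Relation.Binary.Structures using (IsDenseLinearOrder)
open import Relation.Nullary using (¬_; Dec; yes; no)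
open import Relation.Nullary.Construct.Add.Extrema using (_±; ⊥±; ⊤±) renaming ([_] to [_]±)
open import Relation.Unary using () renaming (_∩_ to _∩ᵘ_)

-- Uniform finiteness is a dichotomy: it bounds nothing until the infinite case is excluded, and
-- `LUF₂` speaks only of a box of parameters. Both facts shape the test set `gapSet`. Its points are
-- separated by a positive length, so only finitely many lie in a bounded window. The scales `η`,
-- `s` and `ζ` tend to 0; they enter as coordinates of the parameter space near the origin, and one
-- bound serves all of them. The index `r` may grow without limit and cannot be kept in a box, so it
-- is quantified away in `FibreBound.Core`.
--
-- Points are instead found as cuts of monotone definable predicates (`cut`), and compactness enters
-- only through the fact that projections of closed bounded definable sets are closed.
--
-- The theory of D_Σ sets rests on `LUF₂`, which is contained in all three hypotheses. They differ
-- only in the last application of uniform finiteness, to the test set of the fibrewise boundary.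

private variable
  m n k : ℕ

-- Definable sets and maps

module Definability {ℓ : Level} (em : ∀ {p : Level} → ExcludedMiddle p) (𝓡 : OrderedGroupExpansion ℓ) where

  open OrderedGroupExpansion 𝓡 renaming (Carrier to C) public

  R : DenselyOrderedStructure ℓ
  R = orderedStructure

  lookup-ext : {x y : Vec C n} → (∀ i → lookup x i ≡ lookup y i) → x ≡ y
  lookup-ext {x = x} {y} h =
    trans (sym (tabulate∘lookup x)) (trans (tabulate-cong h) (tabulate∘lookup y))

  dne : ∀ {a} {A : Set a} → ¬ ¬ A → A
  dne {A = A} nn with em {P = A}
  ... | yes a = a
  ... | no ¬a = ⊥-elim (nn ¬a)

  renT  : (Fin m → Fin n) → Term language m → Term language n
  renTs : (Fin m → Fin n) → Vec (Term language m) k → Vec (Term language n) k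
  renT ρ (var i)    = var (ρ i)
  renT ρ (fun f ts) = fun f (renTs ρ ts)
  renTs ρ []       = []
  renTs ρ (t ∷ ts) = renT ρ t ∷ renTs ρ ts

  lift : (Fin m → Fin n) → Fin (suc m) → Fin (suc n)
  lift ρ zero    = zero
  lift ρ (suc i) = suc (ρ i)

  ren : (Fin m → Fin n) → Formula language m → Formula language n
  ren ρ (rel r ts) = rel r (renTs ρ ts)
  ren ρ (s ≈ᶠ t)   = renT ρ s ≈ᶠ renT ρ t
  ren ρ (¬ᶠ φ)     = ¬ᶠ ren ρ φ
  ren ρ (φ ∧ᶠ ψ)   = ren ρ φ ∧ᶠ ren ρ ψ
  ren ρ (∃ᶠ φ)     = ∃ᶠ ren (lift ρ) φ

  Agree : (Fin m → Fin n) → Vec C m → Vec C n → Set ℓ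
  Agree ρ x y = ∀ i → lookup x i ≡ lookup y (ρ i)

  module _ {ρ : Fin m → Fin n} {x : Vec C m} {y : Vec C n} (h : Agree ρ x y) where
    eval-ren  : ∀ t → eval structure t x ≡ eval structure (renT ρ t) y
    evals-ren : (ts : Vec (Term language m) k) → evals structure ts x ≡ evals structure (renTs ρ ts) y
    eval-ren (var i)    = h i
    eval-ren (fun f ts) = cong ⟦ f ⟧ᶠ (evals-ren ts)
    evals-ren []       = refl
    evals-ren (t ∷ ts) = cong₂ _∷_ (eval-ren t) (evals-ren ts)

  lift-agree : {ρ : Fin m → Fin n} {x : Vec C m} {y : Vec C n} → Agree ρ x y →
    ∀ z → Agree (lift ρ) (z ∷ x) (z ∷ y)
  lift-agree h z zero    = refl
  lift-agree h z (suc i) = h i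

  sat-ren  : {ρ : Fin m → Fin n} {x : Vec C m} {y : Vec C n} → Agree ρ x y →
    ∀ φ → sat structure φ x → sat structure (ren ρ φ) y
  sat-ren⁻ : {ρ : Fin m → Fin n} {x : Vec C m} {y : Vec C n} → Agree ρ x y →
    ∀ φ → sat structure (ren ρ φ) y → sat structure φ x
  sat-ren h (rel r ts) p       = subst ⟦ r ⟧ʳ (evals-ren h ts) p
  sat-ren h (s ≈ᶠ t)   p       = trans (sym (eval-ren h s)) (trans p (eval-ren h t))
  sat-ren h (¬ᶠ φ)     p q     = p (sat-ren⁻ h φ q)
  sat-ren h (φ ∧ᶠ ψ)   (p , q) = sat-ren h φ p , sat-ren h ψ q
  sat-ren h (∃ᶠ φ)     (z , p) = z , sat-ren (lift-agree h z) φ p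
  sat-ren⁻ h (rel r ts) p       = subst ⟦ r ⟧ʳ (sym (evals-ren h ts)) p
  sat-ren⁻ h (s ≈ᶠ t)   p       = trans (eval-ren h s) (trans p (sym (eval-ren h t)))
  sat-ren⁻ h (¬ᶠ φ)     p q     = p (sat-ren h φ q)
  sat-ren⁻ h (φ ∧ᶠ ψ)   (p , q) = sat-ren⁻ h φ p , sat-ren⁻ h ψ q
  sat-ren⁻ h (∃ᶠ φ)     (z , p) = z , sat-ren⁻ (lift-agree h z) φ p

  -- Definability is attached to a semantic predicate, up to equivalence, and not to a formula. The
  -- instances below can then read it off from the shape of the predicate, and most definability
  -- proofs become `it`.
  record Dfn {n : ℕ} (P : Vec C n → Set ℓ) : Set ℓ where
    constructor mkDfn
    field
      set  : Definable R n
      to   : ∀ {x} → P x → ⟦ set ⟧ x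
      from : ∀ {x} → ⟦ set ⟧ x → P x

  open Dfn public

  dfn-⟦⟧ : (X : Definable R n) → Dfn ⟦ X ⟧
  dfn-⟦⟧ X = mkDfn X id id

  dfn-≐ : {P Q : Vec C n → Set ℓ} → (∀ {x} → P x → Q x) → (∀ {x} → Q x → P x) → Dfn P → Dfn Q
  dfn-≐ f g d = mkDfn (set d) (λ q → to d (g q)) (λ p → f (from d p))

  dfn-ren : {P : Vec C n → Set ℓ} → Dfn P → (g : Vec C m → Vec C n) (σ : Fin n → Fin m) →
    (∀ x → Agree σ (g x) x) → Dfn (λ x → P (g x))
  dfn-ren {n = n} {m = m} d g σ h with set d | to d | from d
  ... | definable {p} φ c | t | f =
    mkDfn (definable (ren ρ φ) c)
      (λ {x} q → sat-ren (agree x) φ (t q))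
      (λ {x} q → f (sat-ren⁻ (agree x) φ q))
    where
    ρ : Fin (n + p) → Fin (m + p)
    ρ i = [ (λ j → σ j ↑ˡ p) , (m ↑ʳ_) ]′ (splitAt n i)
    agree : ∀ x → Agree ρ (g x ++ c) (x ++ c)
    agree x i with splitAt n i | lookup-splitAt n (g x) c i
    ... | inj₁ j | e = trans e (trans (h x j) (sym (lookup-++ˡ x c (σ j))))
    ... | inj₂ j | e = trans e (sym (lookup-++ʳ x c j))

  -- Opaque copies of head and tail, so that instance search can match on them.
  opaque
    hd : Vec C (suc n) → C
    hd = head

    tl : Vec C (suc n) → Vec C n
    tl = tail

    hd-∷ : (y : C) (x : Vec C n) → hd (y ∷ x) ≡ y
    hd-∷ y x = refl

    tl-∷ : (y : C) (x : Vec C n) → tl (y ∷ x) ≡ x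
    tl-∷ y x = refl

    hd-lookup : (w : Vec C (suc n)) → hd w ≡ lookup w zero
    hd-lookup (_ ∷ _) = refl

    tl-lookup : (w : Vec C (suc n)) (i : Fin n) → lookup (tl w) i ≡ lookup w (suc i)
    tl-lookup (_ ∷ _) i = refl

    hd∷tl : (w : Vec C (suc n)) → hd w ∷ tl w ≡ w
    hd∷tl (_ ∷ _) = refl

  instance
    dfn-¬ : {P : Vec C n → Set ℓ} → ⦃ Dfn P ⦄ → Dfn (λ x → ¬ P x)
    dfn-¬ ⦃ d ⦄ = mkDfn (definable (¬ᶠ DefinableSet.formula (set d)) (DefinableSet.params (set d)))
      (λ np q → np (from d q)) (λ ns q → ns (to d q))

    dfn-× : {P Q : Vec C n → Set ℓ} → ⦃ Dfn P ⦄ → ⦃ Dfn Q ⦄ → Dfn (λ x → P x × Q x)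
    dfn-× {n} ⦃ mkDfn (definable {p} φ c) t f ⦄ ⦃ mkDfn (definable {q} ψ e) t′ f′ ⦄ =
      mkDfn (definable (ren ρ φ ∧ᶠ ren ρ′ ψ) (c ++ e))
        (λ {x} (a , b) → sat-ren (agree x) φ (t a) , sat-ren (agree′ x) ψ (t′ b))
        (λ {x} (a , b) → f (sat-ren⁻ (agree x) φ a) , f′ (sat-ren⁻ (agree′ x) ψ b))
      where
      ρ : Fin (n + p) → Fin (n + (p + q))
      ρ i = [ _↑ˡ (p + q) , (λ j → n ↑ʳ (j ↑ˡ q)) ]′ (splitAt n i)
      ρ′ : Fin (n + q) → Fin (n + (p + q))
      ρ′ i = [ _↑ˡ (p + q) , (λ j → n ↑ʳ (p ↑ʳ j)) ]′ (splitAt n i)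
      agree : ∀ x → Agree ρ (x ++ c) (x ++ (c ++ e))
      agree x i with splitAt n i | lookup-splitAt n x c i
      ... | inj₁ j | h = trans h (sym (lookup-++ˡ x (c ++ e) j))
      ... | inj₂ j | h = trans h (sym (trans (lookup-++ʳ x (c ++ e) (j ↑ˡ q)) (lookup-++ˡ c e j)))
      agree′ : ∀ x → Agree ρ′ (x ++ e) (x ++ (c ++ e))
      agree′ x i with splitAt n i | lookup-splitAt n x e i
      ... | inj₁ j | h = trans h (sym (lookup-++ˡ x (c ++ e) j))
      ... | inj₂ j | h = trans h (sym (trans (lookup-++ʳ x (c ++ e) (p ↑ʳ j)) (lookup-++ʳ c e j)))

    dfn-∃ : {P : C → Vec C n → Set ℓ} → ⦃ Dfn (λ w → P (hd w) (tl w)) ⦄ → Dfn (λ x → ∃ λ y → P y x)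
    dfn-∃ {P = P} ⦃ d ⦄ = mkDfn (definable (∃ᶠ DefinableSet.formula (set d)) (DefinableSet.params (set d)))
      (λ {x} (y , p) → y , to d {y ∷ x} (subst₂ P (sym (hd-∷ y x)) (sym (tl-∷ y x)) p))
      (λ {x} (y , s) → y , subst₂ P (hd-∷ y x) (tl-∷ y x) (from d {y ∷ x} s))

    dfn-⊎ : {P Q : Vec C n → Set ℓ} → ⦃ Dfn P ⦄ → ⦃ Dfn Q ⦄ → Dfn (λ x → P x ⊎ Q x)
    dfn-⊎ {P = P} {Q} = dfn-≐ {P = λ x → ¬ (¬ P x × ¬ Q x)}
      (λ {x} h → case em {P = P x} of λ where
        (yes p) → inj₁ p
        (no ¬p) → inj₂ (dne λ ¬q → h (¬p , ¬q)))
      (λ where (inj₁ p) (np , _) → np p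
               (inj₂ q) (_ , nq) → nq q)
      dfn-¬

    dfn-→ : {P Q : Vec C n → Set ℓ} → ⦃ Dfn P ⦄ → ⦃ Dfn Q ⦄ → Dfn (λ x → P x → Q x)
    dfn-→ {P = P} {Q} = dfn-≐ {P = λ x → ¬ (P x × ¬ Q x)}
      (λ h p → dne λ nq → h (p , nq)) (λ h (p , nq) → nq (h p)) dfn-¬

    dfn-∀ : {P : C → Vec C n → Set ℓ} → ⦃ Dfn (λ w → P (hd w) (tl w)) ⦄ → Dfn (λ x → ∀ y → P y x)
    dfn-∀ {P = P} = dfn-≐ {P = λ x → ¬ ∃ λ y → ¬ P y x}
      (λ h y → dne λ np → h (y , np)) (λ h (y , np) → np (h y)) dfn-¬

  dfn-⊤ : Dfn {n} (λ _ → ⊤)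
  dfn-⊤ = mkDfn (definable (∃ᶠ (var zero ≈ᶠ var zero)) []) (λ _ → 𝟘 , refl) (λ _ → tt)

  opaque
    tk : ∀ n → Vec C (n + m) → Vec C n
    tk n = take n

    dp : ∀ n → Vec C (n + m) → Vec C m
    dp n = drop n

    tk-++ : (v : Vec C n) (x : Vec C m) → tk n (v ++ x) ≡ v
    tk-++ {n = n} v x = ++-injectiveˡ _ _ (take++drop≡id n (v ++ x))

    dp-++ : (v : Vec C n) (x : Vec C m) → dp n (v ++ x) ≡ x
    dp-++ {n = n} v x = ++-injectiveʳ (take n (v ++ x)) v (take++drop≡id n (v ++ x))

    tk-lookup : (w : Vec C (n + m)) (i : Fin n) → lookup (tk n w) i ≡ lookup w (i ↑ˡ m)
    tk-lookup {n = n} {m} w i = trans (sym (lookup-++ˡ (take n w) (drop n w) i))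
      (cong (λ v → lookup v (i ↑ˡ m)) (take++drop≡id n w))

    dp-lookup : (w : Vec C (n + m)) (i : Fin m) → lookup (dp n w) i ≡ lookup w (n ↑ʳ i)
    dp-lookup {n = n} {m} w i = trans (sym (lookup-++ʳ (take n w) (drop n w) i))
      (cong (λ v → lookup v (n ↑ʳ i)) (take++drop≡id n w))

  record DfnFun (f : Vec C n → C) : Set ℓ where
    constructor mkDfnFun
    field graph : Dfn (λ w → hd w ≡ f (tl w))

  record DfnMap (g : Vec C m → Vec C n) : Set ℓ where
    constructor mkDfnMap
    field coord : ∀ i → DfnFun (λ x → lookup (g x) i)

  open DfnFun
  open DfnMap

  dfn-Fin : {P : Fin k → Vec C n → Set ℓ} → (∀ i → Dfn (P i)) → Dfn (λ x → ∀ i → P i x)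
  dfn-Fin {zero}  {P = P} d = dfn-≐ {P = λ _ → ⊤} (λ _ ()) (λ _ → tt) dfn-⊤
  dfn-Fin {suc k} {P = P} d =
    dfn-≐ {P = λ x → P zero x × (∀ i → P (suc i) x)}
      (λ where (p , q) zero → p
               (p , q) (suc i) → q i)
      (λ h → h zero , λ i → h (suc i))
      (dfn-× ⦃ d zero ⦄ ⦃ dfn-Fin (λ i → d (suc i)) ⦄)

  dfn-∃++ : ∀ n {Q : Vec C (n + m) → Set ℓ} → Dfn Q → Dfn (λ x → ∃ λ (v : Vec C n) → Q (v ++ x))
  dfn-∃++ zero d = dfn-≐ (λ q → [] , q) (λ where ([] , q) → q) d
  dfn-∃++ {m} (suc n) {Q} d =
    dfn-≐ (λ (v , y , q) → y ∷ v , q) (λ where (y ∷ v , q) → v , y , q)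
      (dfn-∃++ n {λ w → ∃ λ y → Q (y ∷ w)}
        (dfn-∃ ⦃ dfn-≐ (λ {w} → subst Q (sym (hd∷tl w))) (λ {w} → subst Q (hd∷tl w)) d ⦄))

  instance
    dfn-∃V : {P : Vec C n → Vec C m → Set ℓ} →
      ⦃ Dfn (λ w → P (tk n w) (dp n w)) ⦄ → Dfn (λ x → ∃ λ v → P v x)
    dfn-∃V {n = n} {P = P} ⦃ d ⦄ = dfn-≐
      (λ (v , p) → v , subst₂ P (tk-++ v _) (dp-++ v _) p)
      (λ (v , p) → v , subst₂ P (sym (tk-++ v _)) (sym (dp-++ v _)) p)
      (dfn-∃++ n d)

    dfn-∀V : {P : Vec C n → Vec C m → Set ℓ} →
      ⦃ Dfn (λ w → P (tk n w) (dp n w)) ⦄ → Dfn (λ x → ∀ v → P v x)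
    dfn-∀V {P = P} = dfn-≐ {P = λ x → ¬ ∃ λ y → ¬ P y x}
      (λ h y → dne λ np → h (y , np)) (λ h (y , np) → np (h y)) dfn-¬

  -- A definable map need not be given by terms, so nothing can be substituted into the formula of
  -- `P`. The value of `g` is instead quantified: some `v` with `v = g x` lies in `P`.
  dfn-∘ : {P : Vec C n → Set ℓ} → Dfn P → {g : Vec C m → Vec C n} → DfnMap g → Dfn (λ x → P (g x))
  dfn-∘ {n = n} {m = m} {P} d {g} γ =
    dfn-≐ {P = λ x → ∃ λ v → (∀ i → lookup v i ≡ lookup (g x) i) × P v}
      (λ (v , e , p) → subst P (lookup-ext e) p)
      (λ {x} p → g x , (λ _ → refl) , p)
      (dfn-∃V ⦃ dfn-×
        ⦃ dfn-Fin (λ i → dfn-≐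
            (λ {w} → subst₂ (λ a b → a ≡ lookup (g b) i) (hd-∷ _ _) (tl-∷ _ _))
            (λ {w} → subst₂ (λ a b → a ≡ lookup (g b) i) (sym (hd-∷ _ _)) (sym (tl-∷ _ _)))
            (dfn-ren (graph (coord γ i)) (λ w → lookup (tk n w) i ∷ dp n w)
            (λ where zero → i ↑ˡ m
                     (suc j) → n ↑ʳ j)
            (λ where w zero → tk-lookup w i
                     w (suc j) → dp-lookup w j))) ⦄
        ⦃ dfn-ren d (tk n) (_↑ˡ m) tk-lookup ⦄ ⦄)

  dt-lookup : (i : Fin n) → DfnFun (λ x → lookup x i)
  dt-lookup i = mkDfnFun (mkDfn (definable (var zero ≈ᶠ var (suc (i ↑ˡ 0))) [])
    (λ {w} e → trans (hd₀ w) (trans e (tl₀ w)))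
    (λ {w} e → trans (sym (hd₀ w)) (trans e (sym (tl₀ w)))))
    where
    hd₀ : ∀ w → lookup (w ++ []) zero ≡ hd w
    hd₀ (y ∷ x) = sym (hd-∷ y x)
    tl₀ : ∀ w → lookup (tl w) i ≡ lookup (w ++ []) (suc (i ↑ˡ 0))
    tl₀ (y ∷ x) = trans (cong (λ v → lookup v i) (tl-∷ y x)) (sym (lookup-++ˡ x [] i))

  dt-≐ : {f g : Vec C n → C} → (∀ x → f x ≡ g x) → DfnFun f → DfnFun g
  dt-≐ h δ = mkDfnFun (dfn-≐ (λ e → trans e (h _)) (λ e → trans e (sym (h _))) (graph δ))

  dt-tl : {f : Vec C n → C} → DfnFun f → DfnFun (λ w → f (tl w))
  dt-tl {f = f} δ = mkDfnFun (dfn-≐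
    (λ {w} → subst₂ (λ a b → a ≡ f b) (hd-∷ _ _) (tl-∷ _ _))
    (λ {w} → subst₂ (λ a b → a ≡ f b) (sym (hd-∷ _ _)) (sym (tl-∷ _ _)))
    (dfn-ren (graph δ) (λ w → hd w ∷ tl (tl w))
      (λ where zero → zero
               (suc i) → suc (suc i))
      (λ where w zero → hd-lookup w
               w (suc i) → trans (tl-lookup (tl w) i) (tl-lookup w (suc i)))))

  dt-hd : DfnFun {suc n} hd
  dt-hd = dt-≐ (λ x → sym (hd-lookup x)) (dt-lookup zero)

  dm-∷ : {f : Vec C m → C} {g : Vec C m → Vec C n} → DfnFun f → DfnMap g → DfnMap (λ x → f x ∷ g x)
  dm-∷ δ γ = mkDfnMap λ where
    zero    → δ
    (suc i) → coord γ i

  dt-∘ : {f : Vec C n → C} → DfnFun f → {g : Vec C m → Vec C n} → DfnMap g → DfnFun (λ x → f (g x))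
  dt-∘ {f = f} δ γ = mkDfnFun (dfn-≐
    (subst₂ (λ a b → a ≡ f b) (hd-∷ _ _) (tl-∷ _ _))
    (subst₂ (λ a b → a ≡ f b) (sym (hd-∷ _ _)) (sym (tl-∷ _ _)))
    (dfn-∘ (graph δ) (dm-∷ dt-hd (mkDfnMap λ i → dt-tl (coord γ i)))))

  dm-∘ : {f : Vec C n → Vec C k} → DfnMap f → {g : Vec C m → Vec C n} → DfnMap g → DfnMap (λ x → f (g x))
  dm-∘ φ γ = mkDfnMap λ i → dt-∘ (coord φ i) γ

  dt-const : (c : C) → DfnFun {n} (λ _ → c)
  dt-const {n} c = mkDfnFun (mkDfn (definable (var zero ≈ᶠ var (suc (n ↑ʳ zero))) (c ∷ []))
    (λ {w} e → trans (hd₀ w) (trans e (c₀ w)))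
    (λ {w} e → trans (sym (hd₀ w)) (trans e (sym (c₀ w)))))
    where
    hd₀ : ∀ w → lookup (w ++ c ∷ []) zero ≡ hd w
    hd₀ (y ∷ x) = sym (hd-∷ y x)
    c₀ : ∀ w → c ≡ lookup (w ++ c ∷ []) (suc (n ↑ʳ zero))
    c₀ (_ ∷ x) = sym (lookup-++ʳ x (c ∷ []) zero)

  opaque
    unfolding hd
    dt-⊕ : DfnFun {2} (λ x → hd x ⊕ hd (tl x))
    dt-⊕ = mkDfnFun (mkDfn (definable (var zero ≈ᶠ fun +-symbol (var (suc zero) ∷ var (suc (suc zero)) ∷ [])) [])
      (λ { {_ ∷ _ ∷ _ ∷ []} e → e })
      (λ { {_ ∷ _ ∷ _ ∷ []} e → e }))

    dfn-<₀ : Dfn {2} (λ x → hd x < hd (tl x))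
    dfn-<₀ = mkDfn (<-definable R) (λ { {_ ∷ _ ∷ []} e → e }) (λ { {_ ∷ _ ∷ []} e → e })

    dfn-≡₀ : Dfn {2} (λ x → hd x ≡ hd (tl x))
    dfn-≡₀ = mkDfn (definable (var zero ≈ᶠ var (suc zero)) []) (λ { {_ ∷ _ ∷ []} e → e }) (λ { {_ ∷ _ ∷ []} e → e })

  instance
    dm-id : DfnMap {n} (λ w → w)
    dm-id = mkDfnMap dt-lookup

    dm-const : {c : Vec C n} → DfnMap {m} (λ _ → c)
    dm-const {c = c} = mkDfnMap λ i → dt-const (lookup c i)

  dm₂ : {f g : Vec C n → C} → DfnFun f → DfnFun g → DfnMap (λ x → f x ∷ g x ∷ [])
  dm₂ δ ε = dm-∷ δ (dm-∷ ε dm-const)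

  opaque
    unfolding hd
    dt-⊕′ : {f g : Vec C n → C} → DfnFun f → DfnFun g → DfnFun (λ x → f x ⊕ g x)
    dt-⊕′ δ ε = dt-∘ dt-⊕ (dm₂ δ ε)

    dfn-<′ : {f g : Vec C n → C} → DfnFun f → DfnFun g → Dfn (λ x → f x < g x)
    dfn-<′ δ ε = dfn-∘ dfn-<₀ (dm₂ δ ε)

    dfn-≡′ : {f g : Vec C n → C} → DfnFun f → DfnFun g → Dfn (λ x → f x ≡ g x)
    dfn-≡′ δ ε = dfn-∘ dfn-≡₀ (dm₂ δ ε)

    dfn-app : {P : C → Vec C n → Set ℓ} → Dfn (λ w → P (hd w) (tl w)) →
      {f : Vec C m → C} {g : Vec C m → Vec C n} → DfnFun f → DfnMap g → Dfn (λ w → P (f w) (g w))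
    dfn-app d δ γ = dfn-∘ d (dm-∷ δ γ)

  dm-π : {g : Vec C m → Vec C n} → DfnMap g → (σ : Vec (Fin n) k) → DfnMap (λ x → map (lookup (g x)) σ)
  dm-π {g = g} γ σ = mkDfnMap λ i → dt-≐ (λ x → sym (lookup-map i (lookup (g x)) σ)) (coord γ (lookup σ i))

  instance
    dm-tl : {g : Vec C m → Vec C (suc n)} → ⦃ DfnMap g ⦄ → DfnMap (λ w → tl (g w))
    dm-tl {g = g} ⦃ γ ⦄ = mkDfnMap λ i → dt-≐ (λ x → sym (tl-lookup (g x) i)) (coord γ (suc i))

    dm-tk : ∀ {k} {g : Vec C m → Vec C (k + n)} → ⦃ DfnMap g ⦄ → DfnMap (λ w → tk k (g w))
    dm-tk {g = g} ⦃ γ ⦄ = mkDfnMap λ i → dt-≐ (λ x → sym (tk-lookup (g x) i)) (coord γ (i ↑ˡ _))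

    dm-dp : ∀ {k} {g : Vec C m → Vec C (k + n)} → ⦃ DfnMap g ⦄ → DfnMap (λ w → dp k (g w))
    dm-dp {k = k} {g = g} ⦃ γ ⦄ = mkDfnMap λ i → dt-≐ (λ x → sym (dp-lookup {n = k} (g x) i)) (coord γ (k ↑ʳ i))

    dm-∷ᵢ : {f : Vec C m → C} {g : Vec C m → Vec C n} → ⦃ DfnFun f ⦄ → ⦃ DfnMap g ⦄ → DfnMap (λ x → f x ∷ g x)
    dm-∷ᵢ ⦃ δ ⦄ ⦃ γ ⦄ = dm-∷ δ γ

    dt-hdᵢ : {g : Vec C m → Vec C (suc n)} → ⦃ DfnMap g ⦄ → DfnFun (λ x → hd (g x))
    dt-hdᵢ ⦃ γ ⦄ = dt-∘ dt-hd γ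

    dt-constᵢ : {c : C} → DfnFun {n} (λ _ → c)
    dt-constᵢ {c = c} = dt-const c

    dt-⊕ᵢ : {f g : Vec C n → C} → ⦃ DfnFun f ⦄ → ⦃ DfnFun g ⦄ → DfnFun (λ x → f x ⊕ g x)
    dt-⊕ᵢ ⦃ δ ⦄ ⦃ ε ⦄ = dt-⊕′ δ ε

    dfn-< : {f g : Vec C n → C} → ⦃ DfnFun f ⦄ → ⦃ DfnFun g ⦄ → Dfn (λ x → f x < g x)
    dfn-< ⦃ δ ⦄ ⦃ ε ⦄ = dfn-<′ δ ε

    dfn-≡ : {f g : Vec C n → C} → ⦃ DfnFun f ⦄ → ⦃ DfnFun g ⦄ → Dfn (λ x → f x ≡ g x)
    dfn-≡ ⦃ δ ⦄ ⦃ ε ⦄ = dfn-≡′ δ ε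

  open ToNonStrict _≡_ _<_ using (_≤_) public

  it : ∀ {A : Set ℓ} → ⦃ A ⦄ → A
  it ⦃ a ⦄ = a

  -- This is |a - b| < ε without subtraction: `_⊕_` is a function symbol of the language, while `⊖_`
  -- is not.
  record close (ε a b : C) : Set ℓ where
    constructor mkC
    field
      upper : a < b ⊕ ε
      lower : b < a ⊕ ε
  open close public

  record Closeⁿ (ε : C) (x z : Vec C n) : Set ℓ where
    constructor mkCloseⁿ
    field at : ∀ i → close ε (lookup x i) (lookup z i)
  open Closeⁿ public

  dfn-close : {e f g : Vec C n → C} → DfnFun e → DfnFun f → DfnFun g → Dfn (λ w → close (e w) (f w) (g w))
  dfn-close δ ε ζ = dfn-≐ (λ (p , q) → mkC p q) (λ (mkC p q) → p , q)
    (dfn-× ⦃ dfn-<′ ε (dt-⊕′ ζ δ) ⦄ ⦃ dfn-<′ ζ (dt-⊕′ ε δ) ⦄)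

  instance
    dfn-closeᵢ : {e f g : Vec C n → C} → ⦃ DfnFun e ⦄ → ⦃ DfnFun f ⦄ → ⦃ DfnFun g ⦄ → Dfn (λ w → close (e w) (f w) (g w))
    dfn-closeᵢ ⦃ δ ⦄ ⦃ ε ⦄ ⦃ ζ ⦄ = dfn-close δ ε ζ

    dfn-Closeⁿ : {e : Vec C n → C} {f g : Vec C n → Vec C k} → ⦃ DfnFun e ⦄ → ⦃ DfnMap f ⦄ → ⦃ DfnMap g ⦄ → Dfn (λ w → Closeⁿ (e w) (f w) (g w))
    dfn-Closeⁿ ⦃ δ ⦄ ⦃ γ ⦄ ⦃ γ′ ⦄ = dfn-≐ mkCloseⁿ at (dfn-Fin λ i → dfn-close δ (coord γ i) (coord γ′ i))

  HasInt : (Vec C n → Set ℓ) → Set ℓ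
  HasInt P = ∃ λ x → ∃ λ ε → 𝟘 < ε × (∀ z → Closeⁿ ε x z → P z)

module Tameness {ℓ : Level} (em : ∀ {p : Level} → ExcludedMiddle p) (𝓡 : OrderedGroupExpansion ℓ)
  (dc : DefinablyComplete (OrderedGroupExpansion.orderedStructure 𝓡))
  (luf : LUF₂ (OrderedGroupExpansion.orderedStructure 𝓡)) where

  open Definability em 𝓡

  private
    -- The trivial group is excluded because LUF₂ provides an open box around 0.
    positive : ∃ λ c → 𝟘 < c
    positive with luf 1 (<-definable R) 𝟘 (𝟘 ∷ [])
    ... | _ , _ , (_ , d) ∷ [] , _ , _ , (_ , 0<d) ∷ [] , _ = d , 0<d

  abstract
    c₀ : C
    c₀ = proj₁ positive

    c₀>0 : 𝟘 < c₀
    c₀>0 = proj₂ positive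

  open NonStrict± _≤_ using () renaming ([≤]-injective to [≤]±-injective; [_] to [_]≤)
  open Strict± _<_ using (_<±_; ⊥±<[_]; [_]<⊤±) renaming ([_] to <±[_])
  open IsDenseLinearOrder isDenseLinearOrder public
    using (compare; dense) renaming (trans to <-trans; irrefl to <-irrefl; asym to <-asym)
  open IsAbelianGroup isAbelianGroup public using ()
    renaming (assoc to ⊕-assoc; comm to ⊕-comm; identityˡ to ⊕-identityˡ; identityʳ to ⊕-identityʳ;
      inverseˡ to ⊕-inverseˡ; inverseʳ to ⊕-inverseʳ)

  ⊕-commutativeMonoid : CommutativeMonoid ℓ ℓ
  ⊕-commutativeMonoid = record
    { isCommutativeMonoid = IsAbelianGroup.isCommutativeMonoid isAbelianGroup }

  open CMSolver ⊕-commutativeMonoid public using (prove; Expr) renaming (_⊕_ to _:+_; id to :0; var to :v)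

  :a : Expr (1 + n)
  :a = :v zero
  :b : Expr (2 + n)
  :b = :v (suc zero)
  :c : Expr (3 + n)
  :c = :v (suc (suc zero))
  :d : Expr (4 + n)
  :d = :v (suc (suc (suc zero)))
  :e : Expr (5 + n)
  :e = :v (suc (suc (suc (suc zero))))
  :f : Expr (6 + n)
  :f = :v (suc (suc (suc (suc (suc zero)))))

  -- Inequalities and distances in the ordered group

  ≤-refl : ∀ {a} → a ≤ a
  ≤-refl = inj₂ refl

  <⇒≤ : ∀ {a b} → a < b → a ≤ b
  <⇒≤ = inj₁

  ≤-<-trans : ∀ {a b c} → a ≤ b → b < c → a < c
  ≤-<-trans (inj₁ p)    q = <-trans p q
  ≤-<-trans (inj₂ refl) q = q

  <-≤-trans : ∀ {a b c} → a < b → b ≤ c → a < c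
  <-≤-trans p (inj₁ q)    = <-trans p q
  <-≤-trans p (inj₂ refl) = p

  ≤-trans : ∀ {a b c} → a ≤ b → b ≤ c → a ≤ c
  ≤-trans (inj₁ p)    q = inj₁ (<-≤-trans p q)
  ≤-trans (inj₂ refl) q = q

  ≤⇒≯ : ∀ {a b} → a ≤ b → ¬ b < a
  ≤⇒≯ p q = <-irrefl refl (≤-<-trans p q)

  <⊎≥ : ∀ a b → a < b ⊎ b ≤ a
  <⊎≥ a b with compare a b
  ... | tri< p _ _ = inj₁ p
  ... | tri≈ _ p _ = inj₂ (inj₂ (sym p))
  ... | tri> _ _ p = inj₂ (inj₁ p)

  ≮⇒≥ : ∀ {a b} → ¬ a < b → b ≤ a
  ≮⇒≥ {a} {b} np with <⊎≥ a b
  ... | inj₁ p = ⊥-elim (np p)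
  ... | inj₂ q = q

  ≰⇒> : ∀ {a b} → ¬ a ≤ b → b < a
  ≰⇒> {a} {b} np with <⊎≥ b a
  ... | inj₁ p = p
  ... | inj₂ q = ⊥-elim (np q)

  ⊕-monoˡ-≤ : ∀ {a b} c → a ≤ b → a ⊕ c ≤ b ⊕ c
  ⊕-monoˡ-≤ c (inj₁ p)    = inj₁ (<-translation c p)
  ⊕-monoˡ-≤ c (inj₂ refl) = ≤-refl

  infixl 6 _<+<_ _≤+<_ _<+≤_ _≤+≤_

  _≤+<_ : ∀ {a b c d} → a ≤ b → c < d → a ⊕ c < b ⊕ d
  _≤+<_ {a} {b} {c} {d} p q = ≤-<-trans (⊕-monoˡ-≤ c p)
    (subst₂ _<_ (⊕-comm c b) (⊕-comm d b) (<-translation b q))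

  _<+≤_ : ∀ {a b c d} → a < b → c ≤ d → a ⊕ c < b ⊕ d
  _<+≤_ {a} {b} {c} {d} p q = subst₂ _<_ (⊕-comm c a) (⊕-comm d b) (q ≤+< p)

  _<+<_ : ∀ {a b c d} → a < b → c < d → a ⊕ c < b ⊕ d
  p <+< q = <⇒≤ p ≤+< q

  _≤+≤_ : ∀ {a b c d} → a ≤ b → c ≤ d → a ⊕ c ≤ b ⊕ d
  p ≤+≤ inj₁ q = inj₁ (p ≤+< q)
  p ≤+≤ inj₂ refl = ⊕-monoˡ-≤ _ p

  -- x < y follows from u < v if x − y = u − v; the equation is stated without
  -- subtraction, so that the commutative monoid solver proves its instances.
  by< : ∀ {u v x y} → u < v → x ⊕ v ≡ y ⊕ u → x < y
  by< {u} {v} {x} {y} p e with <⊎≥ x y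
  ... | inj₁ q = q
  ... | inj₂ q = ⊥-elim (<-irrefl (sym e) (q ≤+< p))

  by≤ : ∀ {u v x y} → u ≤ v → x ⊕ v ≡ y ⊕ u → x ≤ y
  by≤ {u} {v} {x} {y} p e with <⊎≥ y x
  ... | inj₂ q = q
  ... | inj₁ q = ⊥-elim (<-irrefl (sym e) (q <+≤ p))

  infixl 6 _⊖'_
  _⊖'_ : C → C → C
  a ⊖' b = a ⊕ (⊖ b)

  ⊖-cancel : ∀ a b → (a ⊖' b) ⊕ b ≡ a
  ⊖-cancel a b = trans (⊕-assoc a (⊖ b) b) (trans (cong (a ⊕_) (⊕-inverseˡ b)) (⊕-identityʳ a))

  <⊕ : ∀ {a δ} → 𝟘 < δ → a < a ⊕ δ
  <⊕ {a} {δ} p = by< p (prove 2 (:a :+ :b) ((:a :+ :b) :+ :0) (a ∷ δ ∷ []))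

  ⊖'< : ∀ {a δ} → 𝟘 < δ → a ⊖' δ < a
  ⊖'< {a} {δ} p = subst (a ⊖' δ <_) (⊖-cancel a δ) (<⊕ p)

  pos-diff : ∀ {a b} → a < b → ∃ λ δ → 𝟘 < δ × a ⊕ δ ≡ b
  pos-diff {a} {b} p = b ⊖' a ,
    by< p (trans (⊕-identityˡ b) (sym (⊖-cancel b a))) ,
    trans (⊕-comm a _) (⊖-cancel b a)

  gap : ∀ {a b} → a < b → ∃ λ δ → 𝟘 < δ × a ⊕ δ < b
  gap p with dense p
  ... | c , q , r with pos-diff q
  ... | δ , δ>0 , refl = δ , δ>0 , r

  min₂ : ∀ a b → 𝟘 < a → 𝟘 < b → ∃ λ c → 𝟘 < c × c ≤ a × c ≤ b
  min₂ a b p q with <⊎≥ a b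
  ... | inj₁ r = a , p , ≤-refl , <⇒≤ r
  ... | inj₂ r = b , q , r , ≤-refl

  max₂ : ∀ a b → ∃ λ c → a ≤ c × b ≤ c
  max₂ a b with <⊎≥ a b
  ... | inj₁ r = b , <⇒≤ r , ≤-refl
  ... | inj₂ r = a , ≤-refl , r

  -- The group need not be divisible. Density splits `ε` into two positive parts, and the smaller
  -- one serves.
  half : ∀ {ε} → 𝟘 < ε → ∃ λ δ → 𝟘 < δ × δ ⊕ δ ≤ ε
  half {ε} p with dense p
  ... | c , q , r with pos-diff r
  ... | d , d>0 , refl with min₂ c d q d>0
  ... | δ , δ>0 , δ≤c , δ≤d = δ , δ>0 , δ≤c ≤+≤ δ≤d

  close-sym : ∀ {ε a b} → close ε a b → close ε b a
  close-sym (mkC p q) = mkC q p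

  close-refl : ∀ {ε a} → 𝟘 < ε → close ε a a
  close-refl p = mkC (<⊕ p) (<⊕ p)

  close-mono : ∀ {ε δ a b} → ε ≤ δ → close ε a b → close δ a b
  close-mono h (mkC p q) = mkC (<-≤-trans p (≤-refl ≤+≤ h)) (<-≤-trans q (≤-refl ≤+≤ h))

  close-trans : ∀ {ε δ a b c} → close ε a b → close δ b c → close (ε ⊕ δ) a c
  close-trans {ε} {δ} {a} {b} {c} (mkC p q) (mkC p′ q′) = mkC
    (by< (p <+< p′) (prove 5 (:a :+ ((:b :+ :d) :+ (:c :+ :e))) ((:c :+ (:d :+ :e)) :+ (:a :+ :b)) (a ∷ b ∷ c ∷ ε ∷ δ ∷ [])))
    (by< (q <+< q′) (prove 5 (:c :+ ((:a :+ :d) :+ (:b :+ :e))) ((:a :+ (:d :+ :e)) :+ (:b :+ :c)) (a ∷ b ∷ c ∷ ε ∷ δ ∷ [])))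

  close-shrink : ∀ {ε a b} → close ε a b → ∃ λ δ → 𝟘 < δ × (∀ c → close δ b c → close ε a c)
  close-shrink {ε} {a} {b} (mkC p q) with gap p | gap q
  ... | d , d>0 , p′ | d′ , d′>0 , q′ with min₂ d d′ d>0 d′>0
  ... | δ , δ>0 , δ≤d , δ≤d′ = δ , δ>0 , λ c (mkC u v) → mkC
      (by< ((≤-refl {a} ≤+≤ δ≤d) ≤+< p′ <+< u)
        (prove 6 (:a :+ (((:a :+ :e) :+ (:b :+ :d)) :+ (:c :+ :f))) ((:c :+ :d) :+ (((:a :+ :f) :+ (:a :+ :e)) :+ :b)) (a ∷ b ∷ c ∷ ε ∷ d ∷ δ ∷ [])))
      (by< ((≤-refl {b} ≤+≤ δ≤d′) ≤+< q′ <+< v)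
        (prove 6 (:c :+ (((:b :+ :e) :+ (:a :+ :d)) :+ (:b :+ :f))) ((:a :+ :d) :+ (((:b :+ :f) :+ (:b :+ :e)) :+ :c)) (a ∷ b ∷ c ∷ ε ∷ d′ ∷ δ ∷ [])))

  module _ {x z : Vec C n} where
    vc-sym : ∀ {ε} → Closeⁿ ε x z → Closeⁿ ε z x
    vc-sym h = mkCloseⁿ λ i → close-sym (at h i)

    vc-mono : ∀ {ε δ} → ε ≤ δ → Closeⁿ ε x z → Closeⁿ δ x z
    vc-mono p h = mkCloseⁿ λ i → close-mono p (at h i)

    vc-trans : ∀ {ε δ y} → Closeⁿ ε x z → Closeⁿ δ z y → Closeⁿ (ε ⊕ δ) x y
    vc-trans h h′ = mkCloseⁿ λ i → close-trans (at h i) (at h′ i)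

    vc-∷ : ∀ {ε a b} → close ε a b → Closeⁿ ε x z → Closeⁿ ε (a ∷ x) (b ∷ z)
    vc-∷ c h = mkCloseⁿ λ where
      zero    → c
      (suc i) → at h i

    vc-hd : ∀ {ε a b} → Closeⁿ ε (a ∷ x) (b ∷ z) → close ε a b
    vc-hd h = at h zero

    vc-tl : ∀ {ε a b} → Closeⁿ ε (a ∷ x) (b ∷ z) → Closeⁿ ε x z
    vc-tl h = mkCloseⁿ λ i → at h (suc i)

    vc-π : ∀ {ε} (σ : Vec (Fin n) k) → Closeⁿ ε x z → Closeⁿ ε (map (lookup x) σ) (map (lookup z) σ)
    vc-π σ h = mkCloseⁿ λ i → subst₂ (close _)
      (sym (lookup-map i (lookup x) σ)) (sym (lookup-map i (lookup z) σ)) (at h (lookup σ i))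

  vc-refl : ∀ {ε} {x : Vec C n} → 𝟘 < ε → Closeⁿ ε x x
  vc-refl p = mkCloseⁿ λ i → close-refl p

  vc-[] : ∀ {ε} {x z : Vec C 0} → Closeⁿ ε x z
  vc-[] = mkCloseⁿ λ ()

  vc-shrink : ∀ {ε} {x z : Vec C n} → 𝟘 < ε → Closeⁿ ε x z → ∃ λ δ → 𝟘 < δ × (∀ w → Closeⁿ δ z w → Closeⁿ ε x w)
  vc-shrink {ε = ε} {[]}    {[]}    p h = ε , p , λ w _ → mkCloseⁿ λ ()
  vc-shrink {x = a ∷ x} {b ∷ z} p h =
    let d , d>0 , f = close-shrink (vc-hd h)
        d′ , d′>0 , g = vc-shrink p (vc-tl h)
        δ , δ>0 , u , v = min₂ d d′ d>0 d′>0
    in δ , δ>0 , λ where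
      (c ∷ w) k → vc-∷ (f c (close-mono u (vc-hd k))) (g w (vc-mono v (vc-tl k)))

  -- Topology

  IsClosed : (Vec C n → Set ℓ) → Set ℓ
  IsClosed K = ∀ x → (∀ ε → 𝟘 < ε → ∃ λ z → Closeⁿ ε x z × K z) → K x

  escape : {K : Vec C n → Set ℓ} → IsClosed K → ∀ {z} → ¬ K z → ∃ λ δ → 𝟘 < δ × (∀ w → Closeⁿ δ z w → ¬ K w)
  escape {K = K} cl {z} nk = dne λ h → nk (cl z λ ε p → dne λ h′ → h (ε , p , λ w v kw → h′ (w , v , kw)))

  by-cases : ∀ {a b} (A : Set a) {B : Set b} → (A → B) → (¬ A → B) → B
  by-cases A f g with em {P = A}
  ... | yes a = f a
  ... | no ¬a = g ¬a

  escape-box : {K : Vec C n → Set ℓ} → IsClosed K → ¬ HasInt K → ∀ x ε → 𝟘 < ε →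
    ∃ λ x′ → ∃ λ ε′ → 𝟘 < ε′ × (∀ w → Closeⁿ ε′ x′ w → Closeⁿ ε x w × ¬ K w)
  escape-box {K = K} cl ni x ε p =
    let z , v , nk = dne λ h → ni (x , ε , p , λ z v → dne λ nk → h (z , v , nk))
        δ , δ>0 , f = escape {K = K} cl nk
        δ′ , δ′>0 , g = vc-shrink p v
        η , η>0 , a , b = min₂ δ δ′ δ>0 δ′>0
    in z , η , η>0 , λ w h → g w (vc-mono b h) , f w (vc-mono a h)

  -- The cut is the infimum of `P`; `lo` excludes -∞ and `hi` excludes +∞. Nothing is claimed at the
  -- cut itself. All uses of definable completeness go through this lemma.
  cut : {P : C → Set ℓ} → Dfn {1} (λ w → P (hd w)) → (∀ {q q′} → q ≤ q′ → P q → P q′) →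
    ∀ {lo hi} → ¬ P lo → P hi → ∃ λ a → (∀ q → q < a → ¬ P q) × (∀ q → a < q → P q)
  cut {P} d up {lo} {hi} nlo phi = conv (proj₂ (dc (set d)))
    where
    S = subset R (set d)
    S→P : ∀ {x} → S x → P x
    S→P {x} s = subst P (hd-∷ x []) (from d s)
    P→S : ∀ {x} → P x → S x
    P→S {x} p = to d (subst P (sym (hd-∷ x [])) p)
    below : ∀ {q} → ¬ P q → ∀ x → S x → q ≤ x
    below {q} nq x s with <⊎≥ x q
    ... | inj₁ x<q = ⊥-elim (nq (up (<⇒≤ x<q) (S→P s)))
    ... | inj₂ q≤x = q≤x
    conv : ∃ (IsInfimum R S) → _
    conv (⊥± , lb , gr) = case gr [ lo ]± (λ x s → [ below nlo x s ]≤) of λ where (NonStrict⁺.[ () ])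
    conv (⊤± , lb , gr) = case lb hi (P→S phi) of λ ()
    conv ([ a ]± , lb , gr) = a ,
      (λ q q<a pq → ≤⇒≯ ([≤]±-injective (lb q (P→S pq))) q<a) ,
      (λ q a<q → dne λ nq → ≤⇒≯ ([≤]±-injective (gr [ q ]± (λ x s → [ below nq x s ]≤))) a<q)

  -- The cube with coordinates in [-r, r], again without `⊖_`.
  record Bdd (r : C) (x : Vec C n) : Set ℓ where
    constructor mkBdd
    field bd : ∀ i → 𝟘 ≤ lookup x i ⊕ r × lookup x i ≤ r
  open Bdd public

  dfn-≤ : {f g : Vec C n → C} → DfnFun f → DfnFun g → Dfn (λ w → f w ≤ g w)
  dfn-≤ δ ε = dfn-⊎ ⦃ dfn-<′ δ ε ⦄ ⦃ dfn-≡′ δ ε ⦄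

  instance
    dfn-Bdd : {f : Vec C m → C} {g : Vec C m → Vec C n} → ⦃ DfnFun f ⦄ → ⦃ DfnMap g ⦄ → Dfn (λ w → Bdd (f w) (g w))
    dfn-Bdd ⦃ δ ⦄ ⦃ γ ⦄ = dfn-≐ mkBdd bd (dfn-Fin λ i → dfn-×
      ⦃ dfn-≤ (dt-const 𝟘) (dt-⊕′ (DfnMap.coord γ i) δ) ⦄ ⦃ dfn-≤ (DfnMap.coord γ i) δ ⦄)

  bdd-mono : ∀ {r r′} {x : Vec C n} → r ≤ r′ → Bdd r x → Bdd r′ x
  bdd-mono p b = mkBdd λ i → ≤-trans (proj₁ (bd b i)) (≤-refl ≤+≤ p) , ≤-trans (proj₂ (bd b i)) p

  bdd-tl : ∀ {r y} {x : Vec C n} → Bdd r (y ∷ x) → Bdd r x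
  bdd-tl b = mkBdd λ i → bd b (suc i)

  limit-≤ : ∀ {a b} → (∀ ε → 𝟘 < ε → a ≤ b ⊕ ε) → a ≤ b
  limit-≤ {a} {b} h with <⊎≥ b a
  ... | inj₂ q = q
  ... | inj₁ p =
    let δ , δ>0 , q = gap p in ⊥-elim (≤⇒≯ (h δ δ>0) q)

  limit-≡ : ∀ {a b} → (∀ ε → 𝟘 < ε → close ε a b) → a ≡ b
  limit-≡ h = antisym (limit-≤ λ ε p → <⇒≤ (upper (h ε p))) (limit-≤ λ ε p → <⇒≤ (lower (h ε p)))
    where
    antisym : ∀ {a b} → a ≤ b → b ≤ a → a ≡ b
    antisym (inj₁ p) q = ⊥-elim (≤⇒≯ q p)
    antisym (inj₂ e) q = e

  upper-bound : (x : Vec C n) → ∃ λ r → Bdd r x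
  upper-bound []      = 𝟘 , mkBdd λ ()
  upper-bound (y ∷ x) =
    let r , b = upper-bound x
        s , p , q = max₂ r y
        t , p′ , q′ = max₂ s (⊖ y)
        y≤t = ≤-trans q p′
    in t , mkBdd λ where
      zero    → subst (_≤ y ⊕ t) (⊕-inverseʳ y) (≤-refl ≤+≤ q′) , y≤t
      (suc i) → bd (bdd-mono {x = x} (≤-trans p p′) b) i

  closed-∩ : {P Q : Vec C n → Set ℓ} → IsClosed P → IsClosed Q → IsClosed (λ x → P x × Q x)
  closed-∩ p q x h =
    p x (λ ε ε>0 → let z , v , a , _ = h ε ε>0 in z , v , a) ,
    q x (λ ε ε>0 → let z , v , _ , b = h ε ε>0 in z , v , b)

  closed-∪ : {P Q : Vec C n → Set ℓ} → IsClosed P → IsClosed Q → IsClosed (λ x → P x ⊎ Q x)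
  closed-∪ {P = P} {Q} p q x h = by-cases (P x) inj₁ λ np →
    let δ , δ>0 , f = escape {K = P} p np
    in inj₂ (q x λ ε ε>0 →
      let η , η>0 , u , v = min₂ δ ε δ>0 ε>0
          z , c , a = h η η>0
      in z , vc-mono v c , (case a of λ where
        (inj₁ a) → ⊥-elim (f z (vc-mono u c) a)
        (inj₂ b) → b))

  closed-pre : {P : Vec C n → Set ℓ} (g : Vec C m → Vec C n) →
    (∀ {ε x z} → 𝟘 < ε → Closeⁿ ε x z → Closeⁿ ε (g x) (g z)) → IsClosed P → IsClosed (λ x → P (g x))
  closed-pre g lip p x h = p (g x) λ ε ε>0 → let z , v , a = h ε ε>0 in g z , lip ε>0 v , a

  vc-ren : {g : Vec C m → Vec C n} {σ : Fin n → Fin m} → (∀ x → Agree σ (g x) x) →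
    ∀ {ε x z} → Closeⁿ ε x z → Closeⁿ ε (g x) (g z)
  vc-ren {σ = σ} h v = mkCloseⁿ λ i → subst₂ (close _) (sym (h _ i)) (sym (h _ i)) (at v (σ i))

  closed-≤ : (i : Fin n) (c : C) → IsClosed (λ x → lookup x i ≤ c)
  closed-≤ i c x h = limit-≤ λ ε p →
    let z , v , q = h ε p in <⇒≤ (<-≤-trans (upper (at v i)) (⊕-monoˡ-≤ ε q))

  closed-≥ : (i : Fin n) (c : C) → IsClosed (λ x → c ≤ lookup x i)
  closed-≥ i c x h = limit-≤ λ ε p →
    let z , v , q = h ε p in <⇒≤ (≤-<-trans q (lower (at v i)))

  closed-Bdd : ∀ r → IsClosed (Bdd {n} r)
  closed-Bdd r x h = mkBdd λ i →
    by≤ (closed-≥ i (⊖ r) x λ ε p → let z , v , b = h ε p in z , v ,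
           by≤ (proj₁ (bd b i)) (trans (sym (⊕-assoc _ _ _)) (trans (cong (_⊕ r) (⊕-comm _ _)) (trans (⊖-cancel _ _) (sym (⊕-identityʳ _))))))
        (trans (⊕-identityˡ _) (trans (sym (⊖-cancel _ r)) (trans (⊕-assoc _ _ _) (trans (cong (lookup x i ⊕_) (⊕-comm _ _)) (sym (⊕-assoc _ _ _)))))) ,
    closed-≤ i r x λ ε p → let z , v , b = h ε p in z , v , proj₂ (bd b i)

  -- The value at the limit is the cut of the approximate minima.
  proj-closed : {Y : Vec C (suc n) → Set ℓ} → Dfn Y → IsClosed Y →
    ∀ {lo hi} → (∀ {y x} → Y (y ∷ x) → lo < y × y ≤ hi) → IsClosed (λ x → ∃ λ y → Y (y ∷ x))
  proj-closed {n} {Y} d cl {lo} {hi} b x h =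
    let a , ¬P , Pq = cut dP up ¬Plo Phi in a , cl (a ∷ x) (limit a ¬P Pq)
    where
    instance
      dY : {g : Vec C m → Vec C (suc n)} → ⦃ DfnMap g ⦄ → Dfn (λ w → Y (g w))
      dY ⦃ γ ⦄ = dfn-∘ d γ
    P : C → Set ℓ
    P q = ∀ ε → 𝟘 < ε → ∃ λ x′ → Closeⁿ ε x x′ × ∃ λ y → y ≤ q × Y (y ∷ x′)
    dP : Dfn {1} (λ w → P (hd w))
    dP = it
    up : ∀ {q q′} → q ≤ q′ → P q → P q′
    up q≤q′ p ε ε>0 = let x′ , v , y , l , Yy = p ε ε>0 in x′ , v , y , ≤-trans l q≤q′ , Yy
    ¬Plo : ¬ P lo
    ¬Plo p = let x′ , v , y , l , Yy = p c₀ c₀>0 in ≤⇒≯ l (proj₁ (b Yy))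
    Phi : P hi
    Phi ε ε>0 = let x′ , v , y , Yy = h ε ε>0 in x′ , v , y , proj₂ (b Yy) , Yy
    limit : ∀ a → (∀ q → q < a → ¬ P q) → (∀ q → a < q → P q) → ∀ ε → 𝟘 < ε → ∃ λ z → Closeⁿ ε (a ∷ x) z × Y z
    limit a ¬P Pq ε ε>0 = dne λ none → ¬P (a ⊖' ε) (⊖'< ε>0) λ ε₁ ε₁>0 →
      let η , η>0 , u , v = min₂ ε ε₁ ε>0 ε₁>0
          q′ , a<q′ , q′<a+ε = dense (<⊕ ε>0)
          x′ , c , y , y≤q′ , Yy = Pq q′ a<q′ η η>0
      in x′ , vc-mono v c , y ,
         ≮⇒≥ (λ q<y → none ((y ∷ x′) ,
           vc-∷ (mkC (subst (_< y ⊕ ε) (⊖-cancel a ε) (<-translation ε q<y)) (≤-<-trans y≤q′ q′<a+ε)) (vc-mono u c) , Yy)) ,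
         Yy

  -- D_Σ sets

  -- Compactness of a member is encoded as closedness together with the bound `r` given by its own
  -- index. Projections thus find explicit bounds for the eliminated coordinate, and monotonicity
  -- makes the family directed.
  record DΣ {n : ℕ} (A : Vec C n → Set ℓ) : Set (lsuc ℓ) where
    field
      fam    : C → C → Vec C n → Set ℓ
      fam-dfn    : Dfn (λ w → fam (hd w) (hd (tl w)) (tl (tl w)))
      fam-closed : ∀ r {s} → 𝟘 < s → IsClosed (fam r s)
      fam-bdd    : ∀ {r s x} → fam r s x → Bdd r x
      fam-mono   : ∀ {r r′ s s′ x} → r ≤ r′ → s′ ≤ s → fam r s x → fam r′ s′ x
      ∈⇒fam      : ∀ {x} → A x → ∃ λ r → ∃ λ s → 𝟘 < s × fam r s x
      fam⇒∈      : ∀ {r s x} → 𝟘 < s → fam r s x → A x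

    fam-app : {e f : Vec C m → C} {g : Vec C m → Vec C n} → DfnFun e → DfnFun f → DfnMap g →
      Dfn (λ w → fam (e w) (f w) (g w))
    fam-app δ ε γ = dfn-≐
      (subst id (fam-≡ _ _ _)) (subst id (sym (fam-≡ _ _ _)))
      (dfn-∘ fam-dfn (dm-∷ δ (dm-∷ ε γ)))
      where
      fam-≡ : ∀ r s x → fam (hd (r ∷ s ∷ x)) (hd (tl (r ∷ s ∷ x))) (tl (tl (r ∷ s ∷ x))) ≡ fam r s x
      fam-≡ r s x = trans
        (cong₂ (λ a b → fam a (hd b) (tl b)) (hd-∷ r (s ∷ x)) (tl-∷ r (s ∷ x)))
        (cong₂ (fam r) (hd-∷ s x) (tl-∷ s x))

    instance
      fam-inst : {e f : Vec C m → C} {g : Vec C m → Vec C n} → ⦃ DfnFun e ⦄ → ⦃ DfnFun f ⦄ → ⦃ DfnMap g ⦄ →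
        Dfn (λ w → fam (e w) (f w) (g w))
      fam-inst ⦃ δ ⦄ ⦃ ε ⦄ ⦃ γ ⦄ = fam-app δ ε γ

    set-dfn : Dfn A
    set-dfn = dfn-≐ {P = λ x → ∃ λ r → ∃ λ s → 𝟘 < s × fam r s x}
      (λ (r , s , p , q) → fam⇒∈ p q) ∈⇒fam it

    fam-join : ∀ {r r′ s s′} → 𝟘 < s → 𝟘 < s′ → ∃ λ r″ → ∃ λ s″ → 𝟘 < s″ ×
      (∀ {x} → fam r s x → fam r″ s″ x) × (∀ {x} → fam r′ s′ x → fam r″ s″ x)
    fam-join {r} {r′} {s} {s′} p p′ =
      let r″ , a , b = max₂ r r′
          s″ , q , c , d = min₂ s s′ p p′
      in r″ , s″ , q , fam-mono a c , fam-mono b d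
  open DΣ public hiding (fam-inst)

  Σ-≐ : {A B : Vec C n → Set ℓ} → (∀ {x} → A x → B x) → (∀ {x} → B x → A x) → DΣ A → DΣ B
  Σ-≐ f g D = record
    { fam = fam D ; fam-dfn = fam-dfn D ; fam-closed = fam-closed D ; fam-bdd = fam-bdd D
    ; fam-mono = fam-mono D ; ∈⇒fam = ∈⇒fam D ∘ g ; fam⇒∈ = λ p → f ∘ fam⇒∈ D p }

  Σ-closed : {K : Vec C n → Set ℓ} → Dfn K → IsClosed K → DΣ K
  Σ-closed {K = K} d cl = record
    { fam        = λ r s x → K x × Bdd r x
    ; fam-dfn    = it
    ; fam-closed = λ r _ → closed-∩ cl (closed-Bdd r)
    ; fam-bdd    = proj₂
    ; fam-mono   = λ p _ (k , b) → k , bdd-mono p b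
    ; ∈⇒fam      = λ {x} k → let r , b = upper-bound x in r , c₀ , c₀>0 , k , b
    ; fam⇒∈      = λ _ → proj₁
    }
    where
    instance
      dK : {g : Vec C m → Vec C _} → ⦃ DfnMap g ⦄ → Dfn (λ w → K (g w))
      dK ⦃ γ ⦄ = dfn-∘ d γ

  Opn : (Vec C n → Set ℓ) → Set ℓ
  Opn O = ∀ x → O x → ∃ λ ε → 𝟘 < ε × (∀ z → Closeⁿ ε x z → O z)

  -- The members consist of the points of a cube whose distance from the complement of `O` is at
  -- least `s`.
  Σ-open : {O : Vec C n → Set ℓ} → Dfn O → Opn O → DΣ O
  Σ-open {O = O} d op = record
    { fam        = λ r s x → Bdd r x × (∀ z → Closeⁿ s x z → O z)
    ; fam-dfn    = it
    ; fam-closed = λ r s>0 → closed-∩ (closed-Bdd r) λ x h z v →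
        let δ , δ>0 , f = vc-shrink s>0 (vc-sym v)
            w , c , k   = h δ δ>0
        in k z (vc-sym (f w c))
    ; fam-bdd    = proj₁
    ; fam-mono   = λ p q (b , k) → bdd-mono p b , λ z v → k z (vc-mono q v)
    ; ∈⇒fam      = λ {x} k → let r , b = upper-bound x
                                 s , s>0 , f = op x k
                             in r , s , s>0 , b , f
    ; fam⇒∈      = λ {_} {_} {x} s>0 (_ , k) → k x (vc-refl s>0)
    }
    where
    instance
      dO : {g : Vec C m → Vec C _} → ⦃ DfnMap g ⦄ → Dfn (λ w → O (g w))
      dO ⦃ γ ⦄ = dfn-∘ d γ

  Σ-∩ : {A B : Vec C n → Set ℓ} → DΣ A → DΣ B → DΣ (λ x → A x × B x)
  Σ-∩ D E = record
    { fam        = λ r s x → fam D r s x × fam E r s x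
    ; fam-dfn    = it
    ; fam-closed = λ r p → closed-∩ (fam-closed D r p) (fam-closed E r p)
    ; fam-bdd    = fam-bdd D ∘ proj₁
    ; fam-mono   = λ p q (a , b) → fam-mono D p q a , fam-mono E p q b
    ; ∈⇒fam      = λ (a , b) →
        let r , s , s>0 , u    = ∈⇒fam D a
            r′ , s′ , s′>0 , v = ∈⇒fam E b
            r″ , p , p′        = max₂ r r′
            s″ , s″>0 , q , q′ = min₂ s s′ s>0 s′>0
        in r″ , s″ , s″>0 , fam-mono D p q u , fam-mono E p′ q′ v
    ; fam⇒∈      = λ p (a , b) → fam⇒∈ D p a , fam⇒∈ E p b
    }
    where
    open DΣ D using () renaming (fam-inst to i₁)
    open DΣ E using () renaming (fam-inst to i₂)

  Σ-∪ : {A B : Vec C n → Set ℓ} → DΣ A → DΣ B → DΣ (λ x → A x ⊎ B x)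
  Σ-∪ D E = record
    { fam        = λ r s x → fam D r s x ⊎ fam E r s x
    ; fam-dfn    = it
    ; fam-closed = λ r p → closed-∪ (fam-closed D r p) (fam-closed E r p)
    ; fam-bdd    = [ fam-bdd D , fam-bdd E ]′
    ; fam-mono   = λ p q → Sum.map (fam-mono D p q) (fam-mono E p q)
    ; ∈⇒fam      = λ where
        (inj₁ a) → let r , s , p , u = ∈⇒fam D a in r , s , p , inj₁ u
        (inj₂ b) → let r , s , p , u = ∈⇒fam E b in r , s , p , inj₂ u
    ; fam⇒∈      = λ p → Sum.map (fam⇒∈ D p) (fam⇒∈ E p)
    }
    where
    open DΣ D using () renaming (fam-inst to i₁)
    open DΣ E using () renaming (fam-inst to i₂)

  -- `proj-closed` wants a strict lower bound, because its cut starts at a height where nothing has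
  -- been reached yet; hence -r is lowered by `c₀`.
  ⊖-≤ : ∀ {y r} → 𝟘 ≤ y ⊕ r → (⊖ r) ⊖' c₀ < y
  ⊖-≤ {y} {r} p = <-≤-trans (⊖'< c₀>0)
    (by≤ p (trans (⊕-comm _ _) (trans (⊕-assoc y r (⊖ r)) (cong (y ⊕_) (trans (⊕-inverseʳ r) refl)))))

  -- Projections of closed sets need not be closed; the bound on the members is what makes
  -- `proj-closed` applicable.
  Σ-∃ : {A : Vec C (suc n) → Set ℓ} → DΣ A → DΣ (λ x → ∃ λ y → A (y ∷ x))
  Σ-∃ D = record
    { fam        = λ r s x → ∃ λ y → fam D r s (y ∷ x)
    ; fam-dfn    = it
    ; fam-closed = λ r {s} p → proj-closed (fam-app D (dt-const r) (dt-const s) dm-id) (fam-closed D r p)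
        (λ f → let b , b′ = bd (fam-bdd D f) zero in ⊖-≤ b , b′)
    ; fam-bdd    = λ (y , f) → bdd-tl (fam-bdd D f)
    ; fam-mono   = λ p q (y , f) → y , fam-mono D p q f
    ; ∈⇒fam      = λ (y , a) → let r , s , p , u = ∈⇒fam D a in r , s , p , y , u
    ; fam⇒∈      = λ p (y , f) → y , fam⇒∈ D p f
    }
    where open DΣ D using (fam-inst)

  -- Preimages of bounded sets may be unbounded, so a bound on `x` is added to the members. The maps
  -- that occur do not increase distances, which keeps closedness elementary.
  Σ-pre : {A : Vec C n → Set ℓ} → DΣ A → {g : Vec C m → Vec C n} → DfnMap g →
    (∀ {ε x z} → 𝟘 < ε → Closeⁿ ε x z → Closeⁿ ε (g x) (g z)) → DΣ (λ x → A (g x))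
  Σ-pre {m = m} D {g} γ lip = record
    { fam        = λ r s x → Bdd r x × fam D r s (g x)
    ; fam-dfn    = it
    ; fam-closed = λ r p → closed-∩ (closed-Bdd r) (closed-pre g lip (fam-closed D r p))
    ; fam-bdd    = proj₁
    ; fam-mono   = λ p q (b , f) → bdd-mono p b , fam-mono D p q f
    ; ∈⇒fam      = λ {x} a →
        let r , b = upper-bound x
            r′ , s , s>0 , f = ∈⇒fam D a
            r″ , p , p′ = max₂ r r′
        in r″ , s , s>0 , bdd-mono p b , fam-mono D p′ ≤-refl f
    ; fam⇒∈      = λ p (_ , f) → fam⇒∈ D p f
    }
    where
    open DΣ D using (fam-inst)
    instance
      dg : DfnMap {suc (suc m)} (λ w → g (tl (tl w)))
      dg = dm-∘ γ it

  Σ-∃V : ∀ n {A : Vec C (n + m) → Set ℓ} → DΣ A → DΣ (λ x → ∃ λ (v : Vec C n) → A (v ++ x))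
  Σ-∃V zero    D = Σ-≐ ([] ,_) (λ where ([] , a) → a) D
  Σ-∃V (suc n) D = Σ-≐ (λ (v , y , a) → y ∷ v , a) (λ where (y ∷ v , a) → v , y , a) (Σ-∃V n (Σ-∃ D))

  π : Vec (Fin n) k → Vec C n → Vec C k
  π σ x = map (lookup x) σ

  Σ-image : {A : Vec C n → Set ℓ} → DΣ A → (σ : Vec (Fin n) k) → DΣ (λ z → ∃ λ x → A x × π σ x ≡ z)
  Σ-image {n = n} {k = k} {A} D σ = Σ-≐
    (λ (x , a , e) → x , subst A (tk-++ x _) a , trans (cong (π σ) (sym (tk-++ x _))) (trans (lookup-ext e) (dp-++ x _)))
    (λ (x , a , e) → x , subst A (sym (tk-++ x _)) a ,
      λ i → cong (λ v → lookup v i) (trans (cong (π σ) (tk-++ x _)) (trans e (sym (dp-++ x _)))))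
    (Σ-∃V n (Σ-∩ (Σ-pre D dm-tk (λ _ → vc-tk)) (Σ-closed dE λ w h i → limit-≡ λ ε ε>0 → half-close w h i ε ε>0)))
    where
    E : Vec C (n + k) → Set ℓ
    E w = ∀ i → lookup (π σ (tk n w)) i ≡ lookup (dp n w) i
    dE : Dfn E
    dE = dfn-Fin λ i → dfn-≡′ (DfnMap.coord (dm-π dm-tk σ) i) (DfnMap.coord dm-dp i)
    vc-tk : ∀ {ε x z} → Closeⁿ {n + k} ε x z → Closeⁿ ε (tk n x) (tk n z)
    vc-tk = vc-ren {σ = _↑ˡ k} tk-lookup
    vc-dp : ∀ {ε x z} → Closeⁿ {n + k} ε x z → Closeⁿ ε (dp n x) (dp n z)
    vc-dp = vc-ren {σ = n ↑ʳ_} dp-lookup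
    half-close : ∀ w → (∀ ε → 𝟘 < ε → ∃ λ z → Closeⁿ ε w z × E z) → ∀ i ε → 𝟘 < ε →
      close ε (lookup (π σ (tk n w)) i) (lookup (dp n w) i)
    half-close w h i ε ε>0 =
      let δ , δ>0 , δδ≤ε = half ε>0
          z , v , e = h δ δ>0
      in close-mono δδ≤ε (close-trans (at (vc-π σ (vc-tk v)) i)
           (subst (λ a → close δ a (lookup (dp n w) i)) (sym (e i)) (close-sym (at (vc-dp v) i))))

  -- Finiteness and chains

  -- Beware of the shift: Many r S k asks for a chain of k + 1 elements.
  Chain : (C → C → Set ℓ) → (C → Set ℓ) → ℕ → C → Set ℓ
  Chain _~_ S zero    y = ⊤
  Chain _~_ S (suc k) y = ∃ λ z → y ~ z × S z × Chain _~_ S k z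

  Many : (C → C → Set ℓ) → (C → Set ℓ) → ℕ → Set ℓ
  Many _~_ S k = ∃ λ y → S y × Chain _~_ S k y

  chain-map : {r r′ : C → C → Set ℓ} {S S′ : C → Set ℓ} → (∀ {y z} → r y z → r′ y z) → (∀ {y} → S y → S′ y) →
    ∀ k {y} → Chain r S k y → Chain r′ S′ k y
  chain-map f g zero    c = tt
  chain-map f g (suc k) (z , p , q , c) = z , f p , g q , chain-map f g k c

  many-map : {r r′ : C → C → Set ℓ} {S S′ : C → Set ℓ} → (∀ {y z} → r y z → r′ y z) → (∀ {y} → S y → S′ y) →
    ∀ {k} → Many r S k → Many r′ S′ k
  many-map f g {k} (y , p , c) = y , g p , chain-map f g k c

  dfn-chain : {r : Vec C m → C → C → Set ℓ} {S : Vec C m → C → Set ℓ} →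
    Dfn (λ w → r (tl (tl w)) (hd (tl w)) (hd w)) → Dfn (λ w → S (tl w) (hd w)) →
    ∀ k → Dfn (λ w → Chain (r (tl w)) (S (tl w)) k (hd w))
  dfn-chain d e zero = dfn-⊤
  dfn-chain {r = r} {S} d e (suc k) = dfn-∃ ⦃ dfn-× ⦃ d ⦄ ⦃ dfn-× ⦃ at₂ {S} e ⦄ ⦃ at₂ {λ x y → Chain (r x) (S x) k y} (dfn-chain {r = r} {S} d e k) ⦄ ⦄ ⦄
    where
    at₂ : {P : Vec C _ → C → Set ℓ} → Dfn (λ w → P (tl w) (hd w)) → Dfn (λ w → P (tl (tl w)) (hd w))
    at₂ {P} p = dfn-app {P = λ y x → P x y} p dt-hd it

  dfn-many : {r : Vec C m → C → C → Set ℓ} {S : Vec C m → C → Set ℓ} →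
    Dfn (λ w → r (tl (tl w)) (hd (tl w)) (hd w)) → Dfn (λ w → S (tl w) (hd w)) →
    ∀ k → Dfn (λ x → Many (r x) (S x) k)
  dfn-many {r = r} {S} d e k = dfn-∃ ⦃ dfn-× ⦃ e ⦄ ⦃ dfn-chain {r = r} {S} d e k ⦄ ⦄

  elems : {r : C → C → Set ℓ} {S : C → Set ℓ} → ∀ k {y} → Chain r S k y → List C
  elems zero    c = []
  elems (suc k) (z , _ , _ , c) = z ∷ elems k c

  length-elems : {r : C → C → Set ℓ} {S : C → Set ℓ} → ∀ k {y} (c : Chain r S k y) → length (elems k c) ≡ k
  length-elems zero    c = refl
  length-elems (suc k) (_ , _ , _ , c) = cong suc (length-elems k c)

  elems-∈ : {r : C → C → Set ℓ} {S : C → Set ℓ} → ∀ k {y} (c : Chain r S k y) {z} → z ∈ˡ elems k c → S z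
  elems-∈ (suc k) (_ , _ , s , c) (here refl) = s
  elems-∈ (suc k) (_ , _ , s , c) (there i)   = elems-∈ k c i

  -- A point missed by the chain lengthens it. The chain may live in a smaller set with a finer
  -- relation: `stab` uses an `s`-separated chain in one member of a family to list all points of a
  -- fibre of the whole set.
  chain-insert : {r : C → C → Set ℓ} {S₀ S : C → Set ℓ} → (∀ {y z} → r y z → y < z) → (∀ {y} → S₀ y → S y) →
    ∀ k {y} (c : Chain r S₀ k y) {z} → S z → y < z → z ∈ˡ elems k c ⊎ Chain _<_ S (suc k) y
  chain-insert f g zero    c           {z} s y<z = inj₂ (z , y<z , s , tt)
  chain-insert f g (suc k) (x , p , q , c) {z} s y<z = case compare x z of λ where
    (tri≈ _ refl _) → inj₁ (here refl)
    (tri> _ _ z<x)  → inj₂ (z , y<z , s , x , z<x , g q , chain-map f g k c)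
    (tri< x<z _ _)  → case chain-insert f g k c s x<z of λ where
      (inj₁ i)  → inj₁ (there i)
      (inj₂ c′) → inj₂ (x , f p , g q , c′)

  many-insert : {r : C → C → Set ℓ} {S₀ S : C → Set ℓ} → (∀ {y z} → r y z → y < z) → (∀ {y} → S₀ y → S y) →
    ∀ {k} → ¬ Many _<_ S (suc k) → ∀ {y} → S₀ y → (c : Chain r S₀ k y) → ∀ {z} → S z → z ∈ˡ y ∷ elems k c
  many-insert f g {k} nm {y} s₀ c {z} s = case compare y z of λ where
    (tri≈ _ refl _) → here refl
    (tri> _ _ z<y)  → ⊥-elim (nm (z , s , y , z<y , g s₀ , chain-map f g k c))
    (tri< y<z _ _)  → case chain-insert f g k c s y<z of λ where
      (inj₁ i)  → there i
      (inj₂ c′) → ⊥-elim (nm (y , g s₀ , c′))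

  ¬many⇒card : ∀ N {S : C → Set ℓ} → ¬ Many _<_ S N → Card≤ R N S
  ¬many⇒card zero    nm = [] , ℕ.z≤n , λ s → ⊥-elim (nm (_ , s , tt))
  ¬many⇒card (suc N) {S} nm = by-cases (Many _<_ S N)
    (λ (y , s , c) → y ∷ elems N c , ℕ.s≤s (ℕₚ.≤-reflexive (length-elems N c)) , λ {z} s′ → many-insert id id nm s c s′)
    (λ nm′ → let xs , p , q = ¬many⇒card N nm′ in xs , ℕₚ.m≤n⇒m≤1+n p , λ {z} → q {z})

  remove : ∀ {y} {xs : List C} → y ∈ˡ xs → ∃ λ ys → length xs ≡ suc (length ys) × (∀ {z} → z ∈ˡ xs → ¬ z ≡ y → z ∈ˡ ys)
  remove {xs = x ∷ xs} (here refl) = xs , refl , λ where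
    (here e)  ne → ⊥-elim (ne e)
    (there i) ne → i
  remove {xs = x ∷ xs} (there i) =
    let ys , e , f = remove i in x ∷ ys , cong suc e , λ where
      (here e)  ne → here e
      (there j) ne → there (f j ne)

  chain-length : {S : C → Set ℓ} → ∀ k {y} → Chain _<_ S k y → ∀ xs → (∀ {z} → S z → y < z → z ∈ˡ xs) → k ℕ.≤ length xs
  chain-length zero    c xs h = ℕ.z≤n
  chain-length (suc k) (z , y<z , s , c) xs h =
    let ys , e , f = remove (h s y<z)
    in subst (suc k ℕ.≤_) (sym e) (ℕ.s≤s (chain-length k c ys λ s′ z<z′ →
         f (h s′ (<-trans y<z z<z′)) λ e → <-irrefl (sym e) z<z′))

  card⇒¬many : ∀ {N} {S : C → Set ℓ} → Card≤ R N S → ¬ Many _<_ S N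
  -- `chain-length` does not count the start of a chain, so a dummy start below `y` is put in front.
  card⇒¬many (xs , l , h) (y , s , c) = ℕₚ.<⇒≱ (chain-length (suc _) {y ⊖' c₀} (y , ⊖'< c₀>0 , s , c) xs (λ s _ → h s)) l

  card-∪ : ∀ {M N} {S T U : C → Set ℓ} → Card≤ R M S → Card≤ R N T → (∀ {y} → U y → S y ⊎ T y) → Card≤ R (M + N) U
  card-∪ (xs , p , f) (ys , q , g) h = xs List.++ ys ,
    subst (ℕ._≤ _) (sym (Listₚ.length-++ xs)) (ℕₚ.+-mono-≤ p q) ,
    λ u → [ (λ s → ∈ˡ.∈-++⁺ˡ (f s)) , (λ t → ∈ˡ.∈-++⁺ʳ xs (g t)) ]′ (h u)

  card-subsingleton : ∀ {S : C → Set ℓ} → (∀ {y z} → S y → S z → ¬ y < z) → Card≤ R 1 S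
  card-subsingleton {S} h = by-cases (∃ S)
    (λ (y , s) → y ∷ [] , ℕ.s≤s ℕ.z≤n , λ {z} s′ → case compare y z of λ where
      (tri< p _ _) → ⊥-elim (h s s′ p)
      (tri≈ _ e _) → here (sym e)
      (tri> _ _ p) → ⊥-elim (h s′ s p))
    (λ ns → [] , ℕ.z≤n , λ {z} s → ⊥-elim (ns (z , s)))

  half< : ∀ {ε} → 𝟘 < ε → ∃ λ δ → 𝟘 < δ × δ ⊕ δ < ε
  half< p = let c , c>0 , c<ε = dense p
                δ , δ>0 , h   = half c>0
            in δ , δ>0 , ≤-<-trans h c<ε

  -- As t grows, a ζ-separated set gains at most two points in [a − t , a + t]
  -- at a time, so its cardinality cannot jump from at most N to infinity.
  separated-bound : {S : C → Set ℓ} → Dfn {1} (λ w → S (hd w)) → ∀ {ζ} → 𝟘 < ζ →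
    (∀ {y z} → S y → S z → y < z → y ⊕ ζ ≤ z) →
    ∀ {a e I N} → 𝟘 < e → (∀ {y} → a ≤ y ⊕ e → y ≤ a ⊕ e → Closed R I y) →
    UniformlyFiniteNear R a I N S → ¬ Many _<_ (λ y → S y × close e a y) N
  separated-bound {S} d {ζ} ζ>0 sep {a} {e} {I} {N} e>0 e⊆I ufn Pe =
    let t* , ¬P , Pt = cut dP up ¬P𝟘 Pe in step t* ¬P Pt
    where
    instance
      dS : {f : Vec C m → C} → ⦃ DfnFun f ⦄ → Dfn (λ w → S (f w))
      dS ⦃ δ ⦄ = dfn-≐ (subst S (hd-∷ _ _)) (subst S (sym (hd-∷ _ _))) (dfn-∘ {P = λ w → S (hd w)} d (dm-∷ δ (dm-const {c = []})))
    P : C → Set ℓ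
    P t = Many _<_ (λ y → S y × close t a y) N
    dP : Dfn {1} (λ w → P (hd w))
    dP = dfn-many {r = λ _ → _<_} {S = λ w y → S y × close (hd w) a y} it it N
    up : ∀ {q q′} → q ≤ q′ → P q → P q′
    up h = many-map id (λ (s , c) → s , close-mono h c)
    ¬P𝟘 : ¬ P 𝟘
    ¬P𝟘 (y , (_ , mkC p q) , _) = <-asym (subst (a <_) (⊕-identityʳ y) p) (subst (y <_) (⊕-identityʳ a) q)
    step : ∀ t → (∀ q → q < t → ¬ P q) → (∀ q → t < q → P q) → ⊥
    step t ¬P Pt =
      let δ , δ>0 , δδ<ζ = half< ζ>0
          -- `q′` is the smaller of `t ⊕ δ` and `e`: more than `N` points are known at either
          -- radius, and beyond `e` the interval `J` might leave `I`.
          q′ , t+δ≥q′ , q′≤e , Pq′ = choose δ δ>0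
          q′>0 : 𝟘 < q′
          q′>0 = ≰⇒> λ q′≤0 → ¬P𝟘 (up q′≤0 Pq′)
          -- Between the radii `t ⊖' δ` and `q′` each side has length at most `δ ⊕ δ`, which is less
          -- than `ζ`, and so holds at most one point.
          fin  = finite (t ⊖' δ) q′ (≤-<-trans t+δ≥q′ (by< δδ<ζ (trans
                    (cong (λ u → (u ⊕ δ) ⊕ ζ) (sym (⊖-cancel t δ)))
                    (prove 3 (((:a :+ :b) :+ :b) :+ :c) ((:a :+ :c) :+ (:b :+ :b)) (t ⊖' δ ∷ δ ∷ ζ ∷ [])))))
                  (¬many⇒card N (¬P _ (⊖'< δ>0)))
      in case ufn (J q′) (a∈int q′ q′>0) (λ (B , y∈B , B⊆J) → J⊆I q′ q′≤e (B⊆J y∈B)) of λ where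
        (inj₁ inf) → inf (_ , fin)
        (inj₂ c)   → card⇒¬many c (many-map id (λ (s , mkC u v) → s , to-J q′ (<⇒≤ u) (<⇒≤ v)) Pq′)
      where
      J : C → Interval R
      J q = a ⊖' q , a ⊕ q
      to-J : ∀ q {y} → a ≤ y ⊕ q → y ≤ a ⊕ q → Closed R (J q) y
      to-J q {y} u v = by≤ u (trans
        (prove 4 ((:a :+ :b) :+ (:c :+ :d)) ((:a :+ :c) :+ (:b :+ :d)) (a ∷ ⊖ q ∷ y ∷ q ∷ []))
        (trans (cong ((a ⊕ y) ⊕_) (⊕-inverseˡ q)) (trans (⊕-identityʳ _) (⊕-comm a y)))) , v
      from-J : ∀ q {y} → Closed R (J q) y → a ≤ y ⊕ q × y ≤ a ⊕ q
      from-J q {y} (u , v) = subst (_≤ y ⊕ q) (⊖-cancel a q) (⊕-monoˡ-≤ q u) , v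
      a∈int : ∀ q → 𝟘 < q → int R (Closed R (J q)) a
      a∈int q p = ([ a ⊖' q ]± , [ a ⊕ q ]±) , (<±[ ⊖'< p ] , <±[ <⊕ p ]) ,
        λ (u , v) → <⇒≤ (Strict±.[<]-injective _<_ u) , <⇒≤ (Strict±.[<]-injective _<_ v)
      J⊆I : ∀ q → q ≤ e → ∀ {y} → Closed R (J q) y → Closed R I y
      J⊆I q q≤e y∈J = let u , v = from-J q y∈J in
        e⊆I (≤-trans u (≤-refl ≤+≤ q≤e)) (≤-trans v (≤-refl ≤+≤ q≤e))
      choose : ∀ δ → 𝟘 < δ → ∃ λ q → q ≤ t ⊕ δ × q ≤ e × P q
      choose δ δ>0 = case <⊎≥ (t ⊕ δ) e of λ where
        (inj₁ p) → t ⊕ δ , ≤-refl , <⇒≤ p , Pt _ (<⊕ δ>0)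
        (inj₂ p) → e , p , ≤-refl , Pe
      finite : ∀ q q′ → q′ < q ⊕ ζ → Card≤ R N (λ y → S y × close q a y) →
        Card≤ R (N + (1 + 1)) (λ y → S y × Closed R (J q′) y)
      finite q q′ q′<q+ζ c = card-∪ c (card-∪ {S = λ y → S y × (a ≤ y ⊕ q′ × y ⊕ q ≤ a)} {T = λ y → S y × (a ⊕ q ≤ y × y ≤ a ⊕ q′)}
        (card-subsingleton λ {y} {z} (s , u , v) (s′ , u′ , v′) y<z → ≤⇒≯ (sep s s′ y<z)
          (by< (u ≤+≤ v′ ≤+< q′<q+ζ) (prove 6 (:a :+ (((:b :+ :c) :+ :d) :+ (:e :+ :f))) ((:b :+ :f) :+ ((:d :+ (:a :+ :e)) :+ :c))
            (z ∷ y ∷ q′ ∷ a ∷ q ∷ ζ ∷ []))))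
        (card-subsingleton λ {y} {z} (s , u , v) (s′ , u′ , v′) y<z → ≤⇒≯ (sep s s′ y<z)
          (by< (v′ ≤+≤ u ≤+< q′<q+ζ) (prove 6 (:a :+ (((:d :+ :c) :+ :b) :+ (:e :+ :f))) ((:b :+ :f) :+ ((:a :+ (:d :+ :e)) :+ :c))
            (z ∷ y ∷ q′ ∷ a ∷ q ∷ ζ ∷ []))))
        id)
        λ {y} (s , y∈J) → let u , v = from-J q′ y∈J in case <⊎≥ a (y ⊕ q) of λ where
          (inj₂ p) → inj₂ (inj₁ (s , u , p))
          (inj₁ p) → case <⊎≥ y (a ⊕ q) of λ where
            (inj₁ r) → inj₁ (s , mkC p r)
            (inj₂ r) → inj₂ (inj₂ (s , r , v))

  HasInt₁ : (C → Set ℓ) → Set ℓ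
  HasInt₁ S = ∃ λ y → ∃ λ ε → 𝟘 < ε × (∀ z → close ε y z → S z)

  -- The order of a finite chain survives small displacements. The scale `δ` is found before `S′` is
  -- named, so it applies to every sufficiently fine approximation of `S`.
  many-perturb : ∀ N {S : C → Set ℓ} {a e} → Many _<_ (λ y → S y × close e a y) N →
    ∃ λ δ → 𝟘 < δ × (∀ {S′ : C → Set ℓ} → (∀ {y} → S y → close e a y → ∃ λ z → S′ z × close δ y z) →
      Many _<_ (λ z → S′ z × close e a z) N)
  many-perturb N {S} {a} {e} (y , (s , c) , ch) =
    case (chain-perturb N ch) of λ (δ , δ>0 , f) →
    case (close-shrink c) of λ (δ′ , δ′>0 , g) →
    case (min₂ δ δ′ δ>0 δ′>0) of λ (η , η>0 , u , v) →
    η , η>0 , λ {S′} h → case h s c of λ (z , s′ , d) →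
         z , (s′ , g z (close-mono v d)) ,
         f (λ s c → map₂ (map₂ (close-mono u)) (h s c)) z (<-≤-trans (lower d) (≤-refl ≤+≤ u))
    where
    chain-perturb : ∀ k {y} → Chain _<_ (λ y → S y × close e a y) k y →
      ∃ λ δ → 𝟘 < δ × (∀ {S′ : C → Set ℓ} → (∀ {y} → S y → close e a y → ∃ λ z → S′ z × close δ y z) →
        ∀ z → z < y ⊕ δ → Chain _<_ (λ z → S′ z × close e a z) k z)
    chain-perturb zero    _ = c₀ , c₀>0 , λ _ _ _ → tt
    chain-perturb (suc k) {y} (y₁ , y<y₁ , (s , c) , ch) =
      case (chain-perturb k ch) of λ (δ , δ>0 , f) →
      case (close-shrink c) of λ (δ′ , δ′>0 , g) →
      case (pos-diff y<y₁) of λ (ε , ε>0 , y+ε≡y₁) →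
      -- Neighbours whose distance is `ε` keep their order when each moves by less than half of it.
      case (half ε>0) of λ (δ″ , δ″>0 , δδ≤ε) →
      case (min₂ δ δ′ δ>0 δ′>0) of λ (η₁ , η₁>0 , u₁ , v₁) →
      case (min₂ η₁ δ″ η₁>0 δ″>0) of λ (η , η>0 , u , v) →
      η , η>0 , λ {S′} h z z<y+η → case h s c of λ (z₁ , s′ , d) →
           z₁ , by< (z<y+η <+< upper d <+≤ ≤-trans (v ≤+≤ v) δδ≤ε)
                  (subst (λ w → z ⊕ (((y ⊕ η) ⊕ (z₁ ⊕ η)) ⊕ ε) ≡ z₁ ⊕ ((z ⊕ w) ⊕ (η ⊕ η))) y+ε≡y₁
                    (prove 5 (:a :+ (((:b :+ :c) :+ (:d :+ :c)) :+ :e)) (:d :+ ((:a :+ (:b :+ :e)) :+ (:c :+ :c)))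
                      (z ∷ y ∷ η ∷ z₁ ∷ ε ∷ []))) ,
           (s′ , g z₁ (close-mono (≤-trans u v₁) d)) ,
           f (λ s c → map₂ (map₂ (close-mono (≤-trans u u₁))) (h s c)) z₁
             (<-≤-trans (lower d) (≤-refl ≤+≤ ≤-trans u u₁))

  -- A chain involves finitely many indices, and these have a common upper bound.
  many-directed : {T : Set ℓ} (_≼_ : T → T → Set ℓ) (join : ∀ s t → ∃ λ u → s ≼ u × t ≼ u) →
    {r : T → C → C → Set ℓ} {S : T → C → Set ℓ} →
    (∀ {s t y z} → s ≼ t → r s y z → r t y z) → (∀ {s t y} → s ≼ t → S s y → S t y) →
    ∀ k → Many (λ y z → ∃ λ t → r t y z) (λ y → ∃ λ t → S t y) k → ∃ λ t → Many (r t) (S t) k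
  many-directed {T} _≼_ join {r} {S} r-mono S-mono k (y , (t₁ , s) , c) =
    case chain-directed t₁ k c of λ (t₂ , c′) →
    case join t₁ t₂ of λ (t , u₁ , u₂) →
    t , y , S-mono u₁ s , chain-map (r-mono u₂) (S-mono u₂) k c′
    where
    chain-directed : T → ∀ k {y} → Chain (λ y z → ∃ λ t → r t y z) (λ y → ∃ λ t → S t y) k y → ∃ λ t → Chain (r t) (S t) k y
    chain-directed t₀ zero    _ = t₀ , tt
    chain-directed t₀ (suc k) (z , (t₁ , p) , (t₂ , q) , c) =
      case chain-directed t₀ k c of λ (t₃ , c′) →
      case join t₁ t₂ of λ (t₄ , u₁ , u₂) →
      case join t₄ t₃ of λ (t , v₄ , v₃) →
      t , z , r-mono v₄ (r-mono u₁ p) , S-mono v₄ (S-mono u₂ q) , chain-map (r-mono v₃) (S-mono v₃) k c′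

  opaque
    unfolding hd
    uncons₃-≡ : (G : C → C → C → Vec C m → Set ℓ) → ∀ {a b c x} →
      (let v = a ∷ b ∷ c ∷ x) → G (hd v) (hd (tl v)) (hd (tl (tl v))) (tl (tl (tl v))) ≡ G a b c x
    uncons₃-≡ G = refl

  snoc-≡ : (G : Vec C n → C → Set ℓ) → ∀ x y → G (tk n (x ++ y ∷ [])) (hd (dp n (x ++ y ∷ []))) ≡ G x y
  snoc-≡ G x y = cong₂ G (tk-++ x _) (trans (cong hd (dp-++ x _)) (hd-∷ y []))

  -- Uniform bounds for the fibres of a D_Σ set

  module FibreBound {m : ℕ} {A : Vec C (suc m) → Set ℓ} (D : DΣ A) (a : C) where
    open DΣ D using (fam-inst)

    instance
      dA : ∀ {k} {g : Vec C k → Vec C (suc m)} → ⦃ DfnMap g ⦄ → Dfn (λ w → A (g w))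
      dA ⦃ γ ⦄ = dfn-∘ (set-dfn D) γ

    -- The window has the fixed radius `c₀`: the radius `e` on which points are counted is known
    -- only after uniform finiteness has been applied to a set built from `Approx`. It is chosen
    -- with `e ≤ c₀`.
    Approx : C → C → C → Vec C m → Set ℓ
    Approx r s η x = ∀ y → A (y ∷ x) → close c₀ a y → ∃ λ y′ → fam D r s (y′ ∷ x) × close η y y′

    -- The members of the family which approximate A within η have no least
    -- index in general; intersecting their enlargements by c₀ avoids choosing one.
    Core : C → C → Vec C m → C → Set ℓ
    Core η s x y = ∀ r → Approx r s η x → fam D (r ⊕ c₀) s (y ∷ x)

    Gap : C → C → C → Vec C m → C → Set ℓ
    Gap η s ζ x y = Core η s x y × (∀ z → Core η s x z → y < z → y ⊕ ζ ≤ z)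

    private
      G : Vec C (3 + m) → C → Set ℓ
      G v = Gap (hd v) (hd (tl v)) (hd (tl (tl v))) (tl (tl (tl v)))

      abstract
        gap-dfn : Dfn {(3 + m) + 1} (λ w → G (tk (3 + m) w) (hd (dp (3 + m) w)))
        gap-dfn = it

    -- The scales are coordinates of the set and not parameters of its definition. The bound `N`
    -- obtained from one application of uniform finiteness therefore does not change as they shrink.
    gapSet : Definable R ((3 + m) + 1)
    gapSet = set gap-dfn

    gap⇒ : ∀ {η s ζ x y} → Gap η s ζ x y → fibre R gapSet (η ∷ s ∷ ζ ∷ x) y
    gap⇒ {η} {s} {ζ} {x} {y} g = to gap-dfn {(η ∷ s ∷ ζ ∷ x) ++ y ∷ []}
      (subst id (sym (trans (snoc-≡ G (η ∷ s ∷ ζ ∷ x) y) (uncons₃-≡ (λ η s ζ x → Gap η s ζ x y)))) g)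

    ⇒gap : ∀ {η s ζ x y} → fibre R gapSet (η ∷ s ∷ ζ ∷ x) y → Gap η s ζ x y
    ⇒gap {η} {s} {ζ} {x} {y} g = subst id
      (trans (snoc-≡ G (η ∷ s ∷ ζ ∷ x) y) (uncons₃-≡ (λ η s ζ x → Gap η s ζ x y) {η} {s} {ζ} {x}))
      (from gap-dfn {(η ∷ s ∷ ζ ∷ x) ++ y ∷ []} g)

    module _ (x : Vec C m) where
      -- Approximation can be pushed past every height. If it succeeds up to `t ⊖' δ`, then one
      -- point of `A` between there and `t ⊕ δ`, if any exists, approximates all the others, since
      -- `δ ⊕ δ ≤ η`. By directedness the member containing it can be joined to the old one.
      approx : ∀ {η} → 𝟘 < η → ∃ λ r → ∃ λ s → 𝟘 < s × Approx r s η x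
      approx {η} η>0 = dne λ none →
        -- `Q` says that approximation fails, which makes it upward closed. It is false at
        -- `a ⊖' c₀`, below which the window is empty, and success at `a ⊕ c₀` would be success
        -- everywhere.
        case (cut dQ up {lo = a ⊖' c₀} {hi = a ⊕ c₀} ¬Qlo λ (r , s , s>0 , h) →
              none (r , s , s>0 , λ y Ay c → h y Ay c (<⇒≤ (lower c)))) of λ (t , ¬Q , Qt) →
        case (half η>0) of λ (δ , δ>0 , δδ≤η) →
        case (dense (<⊕ {t} δ>0)) of λ (q , t<q , q<t+δ) →
        case (dne (¬Q (t ⊖' δ) (⊖'< δ>0))) of λ (r , s , s>0 , h) →
        Qt q t<q (by-cases (∃ λ y → A (y ∷ x) × close c₀ a y × t ⊖' δ < y × y ≤ q)
             (λ (y , Ay , c , l , u) →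
               case (∈⇒fam D Ay) of λ (r′ , s′ , s′>0 , f) →
               case (fam-join D s>0 s′>0) of λ (r″ , s″ , s″>0 , i , j) →
               r″ , s″ , s″>0 , λ z Az c′ z≤q → case <⊎≥ (t ⊖' δ) z of λ where
                    (inj₂ z≤) → let z′ , f′ , d = h z Az c′ z≤ in z′ , i f′ , d
                    (inj₁ <z) → y , j f , mkC (near t δ q q<t+δ δδ≤η z≤q l) (near t δ q q<t+δ δδ≤η u <z))
             (λ no → r , s , s>0 , λ z Az c′ z≤q → case <⊎≥ (t ⊖' δ) z of λ where
               (inj₂ z≤) → h z Az c′ z≤
               (inj₁ <z) → ⊥-elim (no (z , Az , c′ , <z , z≤q))))
        where
        Q : C → Set ℓ
        Q q = ¬ ∃ λ r → ∃ λ s → 𝟘 < s × (∀ y → A (y ∷ x) → close c₀ a y → y ≤ q → ∃ λ y′ → fam D r s (y′ ∷ x) × close η y y′)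
        dQ : Dfn {1} (λ w → Q (hd w))
        dQ = it
        up : ∀ {q q′} → q ≤ q′ → Q q → Q q′
        up l nq (r , s , s>0 , h) = nq (r , s , s>0 , λ y Ay c y≤q → h y Ay c (≤-trans y≤q l))
        ¬Qlo : ¬ Q (a ⊖' c₀)
        ¬Qlo nq = nq (𝟘 , c₀ , c₀>0 , λ y Ay c y≤ → ⊥-elim (<-irrefl refl
          (<-≤-trans (upper c) (subst (y ⊕ c₀ ≤_) (⊖-cancel a c₀) (⊕-monoˡ-≤ c₀ y≤)))))
        near : ∀ t δ q → q < t ⊕ δ → δ ⊕ δ ≤ η → ∀ {y z} → y ≤ q → t ⊖' δ < z → y < z ⊕ η
        near t δ q q< δδ≤ {y} {z} y≤q <z = by< (≤-<-trans y≤q q< <+< <z <+≤ δδ≤)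
          (trans (cong (λ w → y ⊕ (((w ⊕ δ) ⊕ z) ⊕ η)) (sym (⊖-cancel t δ)))
            (prove 5 (:a :+ ((((:b :+ :c) :+ :c) :+ :d) :+ :e)) ((:d :+ :e) :+ ((:a :+ :b) :+ (:c :+ :c)))
              (y ∷ t ⊖' δ ∷ δ ∷ z ∷ η ∷ [])))

      gap-bound : ∀ {e I N η s ζ} → 𝟘 < e → (∀ {y} → a ≤ y ⊕ e → y ≤ a ⊕ e → Closed R I y) → 𝟘 < ζ →
        UniformlyFiniteNear R a I N (fibre R gapSet (η ∷ s ∷ ζ ∷ x)) → ¬ Many _<_ (λ y → Gap η s ζ x y × close e a y) N
      gap-bound {e} {I} {N} {η} {s} {ζ} e>0 e⊆I ζ>0 ufn many =
        separated-bound {S = fibre R gapSet (η ∷ s ∷ ζ ∷ x)}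
          (dfn-≐ {P = λ w → Gap η s ζ x (hd w)} (λ {w} → gap⇒ {η} {s} {ζ} {x} {hd w}) (λ {w} → ⇒gap {η} {s} {ζ} {x} {hd w}) it)
          ζ>0
          (λ {y} {z} g g′ y<z → proj₂ (⇒gap {η} {s} {ζ} {x} {y} g) z (proj₁ (⇒gap {η} {s} {ζ} {x} {z} g′)) y<z)
          e>0 e⊆I ufn
          (many-map id (λ {y} (g , c) → gap⇒ {η} {s} {ζ} {x} {y} g , c) many)

      gap-mono : ∀ {η s ζ ζ′ y} → ζ′ ≤ ζ → Gap η s ζ x y → Gap η s ζ′ x y
      gap-mono l (k , g) = k , λ z kz p → ≤-trans (≤-refl ≤+≤ l) (g z kz p)

      gap-directed : ∀ {e N η s δ} → 𝟘 < δ → Many _<_ (λ z → (∃ λ ζ → 𝟘 < ζ × Gap η s ζ x z) × close e a z) N →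
        ∃ λ ζ → 𝟘 < ζ × ζ < δ × Many _<_ (λ y → Gap η s ζ x y × close e a y) N
      gap-directed {e} {N} {η} {s} {δ} δ>0 many =
        case many-directed {T = ∃ λ ζ → 𝟘 < ζ} (λ (ζ , _) (ζ′ , _) → ζ′ ≤ ζ)
          (λ (ζ , p) (ζ′ , p′) → let ξ , q , i , j = min₂ ζ ζ′ p p′ in (ξ , q) , i , j)
          {λ _ → _<_} {λ (ζ , _) z → Gap η s ζ x z × close e a z}
          (λ _ p → p) (λ {(ζ , _)} {(ζ′ , _)} {y} l (g , c) → gap-mono {η} {s} {ζ} {ζ′} {y} l g , c)
          N (many-map (λ p → (c₀ , c₀>0) , p) (λ ((ζ , ζ>0 , g) , c) → (ζ , ζ>0) , g , c) many) of
          λ ((ζ₀ , ζ₀>0) , m) →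
        case min₂ ζ₀ δ ζ₀>0 δ>0 of λ (ζ₁ , ζ₁>0 , i , j) →
        case dense ζ₁>0 of λ (ζ , ζ>0 , ζ<ζ₁) →
        ζ , ζ>0 , <-≤-trans ζ<ζ₁ j ,
        many-map id (λ {y} (g , c) → gap-mono {η} {s} {ζ₀} {ζ} {y} (<⇒≤ (<-≤-trans ζ<ζ₁ i)) g , c) m

      module _ (no-int : ∀ r {s} → 𝟘 < s → ¬ HasInt₁ (λ y → fam D r s (y ∷ x))) where

        module _ {η s : C} (s>0 : 𝟘 < s) {r₀ : C} (ap : Approx r₀ s η x) where
          core-closed : ∀ y → (∀ ε → 𝟘 < ε → ∃ λ z → close ε y z × Core η s x z) → Core η s x y
          core-closed y h r ap′ = fam-closed D _ s>0 (y ∷ x) λ ε ε>0 →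
            let z , c , k = h ε ε>0 in z ∷ x , vc-∷ c (vc-refl ε>0) , k r ap′

          -- The summand `c₀` in `Core` pays for the infimum `t` of the admissible indices, which
          -- may not be attained: an admissible `r₁ < t ⊕ c₀` lies below `r ⊕ c₀` for every
          -- admissible `r`, so the points found for `r₁` are in `Core`.
          core-dense : ∀ {y} → A (y ∷ x) → close c₀ a y → ∃ λ y′ → Core η s x y′ × close η y y′
          core-dense {y} Ay c =
            -- Members with negative index are empty, while `y` has to be approximated, so `⊖ c₀` is
            -- not admissible.
            case (cut dQ up {lo = ⊖ c₀} ¬Qlo ap) of λ (t , ¬Q , Qt) →
            case (dense (<⊕ {t} c₀>0)) of λ (r₁ , t<r₁ , r₁<t+c) →
            case (Qt r₁ t<r₁ y Ay c) of λ (y′ , f , d) →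
            y′ , (λ r ap′ → fam-mono D (<⇒≤ (<-≤-trans r₁<t+c (⊕-monoˡ-≤ c₀ (≮⇒≥ λ r<t → ¬Q r r<t ap′)))) ≤-refl f) , d
            where
            Q : C → Set ℓ
            Q r = Approx r s η x
            dQ : Dfn {1} (λ w → Q (hd w))
            dQ = it
            up : ∀ {q q′} → q ≤ q′ → Q q → Q q′
            up l ap y Ay c = let y′ , f , d = ap y Ay c in y′ , fam-mono D l ≤-refl f , d
            ¬Qlo : ¬ Q (⊖ c₀)
            ¬Qlo ap =
              case (ap y Ay c) of λ (y′ , f , _) →
              case (bd (fam-bdd D f) zero) of λ (u , v) →
              let -c<0 = subst (⊖ c₀ <_) (⊕-inverseˡ c₀) (<⊕ c₀>0) in
              ≤⇒≯ u (subst (y′ ⊕ (⊖ c₀) <_) (⊕-identityʳ 𝟘) (≤-<-trans v -c<0 <+< -c<0))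

          -- Since the members have no interior, some `w` between `y` and `u` lies outside `Core`.
          -- The supremum `t` of `Core` below `w` belongs to `Core` by closedness, and the gap from
          -- `t` to `w` gives `ζ`.
          core-gap : ∀ {y u} → Core η s x y → y < u → ∃ λ z → y ≤ z × z < u × ∃ λ ζ → 𝟘 < ζ × Gap η s ζ x z
          core-gap {y} {u} k y<u =
            case (outside) of λ (w , y<w , w<u , nk) →
            case (cut (dQ w) (λ {q} {q′} → up w {q} {q′}) {lo = y ⊖' c₀} {hi = w}
                  (λ q → ≤⇒≯ (q y k (<⇒≤ y<w)) (⊖'< c₀>0)) (λ z _ z≤w → z≤w)) of λ (t , ¬Q , Qt) →
            let bound : ∀ z → Core η s x z → z ≤ w → z ≤ t
                bound z kz z≤w = ≮⇒≥ λ t<z → let q , t<q , q<z = dense t<z in ≤⇒≯ (Qt q t<q z kz z≤w) q<z in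
            let kt : Core η s x t
                kt = core-closed t λ ε ε>0 → dne λ none → ¬Q (t ⊖' ε) (⊖'< ε>0) λ z kz z≤w → ≮⇒≥ λ <z →
                  none (z , mkC (subst (_< z ⊕ ε) (⊖-cancel t ε) (<-translation ε <z)) (≤-<-trans (bound z kz z≤w) (<⊕ ε>0)) , kz) in
            let t≤w : t ≤ w
                t≤w = ≮⇒≥ λ w<t → ¬Q w w<t (λ z _ z≤w → z≤w) in
            let t<w : t < w
                t<w = ≰⇒> λ w≤t → nk (subst (Core η s x) (case t≤w of λ where
                  (inj₁ p) → ⊥-elim (≤⇒≯ w≤t p)
                  (inj₂ e) → e) kt) in
            case (pos-diff t<w) of λ (ζ , ζ>0 , e) →
            t , bound y k (<⇒≤ y<w) , <-trans t<w w<u , ζ , ζ>0 , kt , λ z kz t<z →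
                 subst (_≤ z) (sym e) (≮⇒≥ λ z<w → ≤⇒≯ (bound z kz (<⇒≤ z<w)) t<z)
            where
            Q : C → C → Set ℓ
            Q w q = ∀ z → Core η s x z → z ≤ w → z ≤ q
            dQ : ∀ w → Dfn {1} (λ v → Q w (hd v))
            dQ w = it
            up : ∀ w {q q′} → q ≤ q′ → Q w q → Q w q′
            up w l h z kz z≤w = ≤-trans (h z kz z≤w) l
            outside : ∃ λ w → y < w × w < u × ¬ Core η s x w
            outside =
              case (dense y<u) of λ (v , y<v , v<u) →
              case (pos-diff y<v) of λ (ε₁ , ε₁>0 , e₁) →
              case (pos-diff v<u) of λ (ε₂ , ε₂>0 , e₂) →
              case (min₂ ε₁ ε₂ ε₁>0 ε₂>0) of λ (ε , ε>0 , l₁ , l₂) →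
              dne λ none → no-int (r₀ ⊕ c₀) s>0 (v , ε , ε>0 , λ z c → dne λ nf → none (z ,
                   by< (upper (close-mono l₁ c)) (subst (λ v → y ⊕ (z ⊕ ε₁) ≡ z ⊕ v) e₁
                     (prove 3 (:a :+ (:b :+ :c)) (:b :+ (:a :+ :c)) (y ∷ z ∷ ε₁ ∷ []))) ,
                   subst (z <_) e₂ (lower (close-mono l₂ c)) , λ kz → nf (kz r₀ ap)))

        near-gap : ∀ {η s r δ y} → 𝟘 < s → Approx r s η x → η ≤ δ → A (y ∷ x) → close c₀ a y →
          ∃ λ z → (∃ λ ζ → 𝟘 < ζ × Gap η s ζ x z) × close δ y z
        near-gap {η} {s} {δ = δ} {y} s>0 ap η≤δ Ay c =
          case core-dense {η} {s} s>0 ap Ay c of λ (y′ , k , d) →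
          case core-gap {η} {s} s>0 ap {y′} {y ⊕ δ} k (<-≤-trans (lower d) (≤-refl ≤+≤ η≤δ)) of λ (z , y′≤z , z< , g) →
          z , g , mkC (<-≤-trans (upper d) (y′≤z ≤+≤ η≤δ)) z<

        many-gap : ∀ {e N δ} → e ≤ c₀ → 𝟘 < δ → Many _<_ (λ y → A (y ∷ x) × close e a y) N →
          ∃ λ η → ∃ λ s → (𝟘 < η × η < δ) × (𝟘 < s × s < δ) ×
            Many _<_ (λ z → (∃ λ ζ → 𝟘 < ζ × Gap η s ζ x z) × close e a z) N
        many-gap {e} {N} {δ} e≤c₀ δ>0 many =
          case many-perturb N many of λ (δ₁ , δ₁>0 , perturb) →
          case scales δ₁>0 of λ (η , s , r , p , q , ap , η≤δ₁) →
          η , s , p , q , perturb {λ z → ∃ λ ζ → 𝟘 < ζ × Gap η s ζ x z}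
            (λ {y} Ay c → near-gap {η} {s} (proj₁ q) ap η≤δ₁ Ay (close-mono e≤c₀ c))
          where
          scales : ∀ {δ₁} → 𝟘 < δ₁ → ∃ λ η → ∃ λ s → ∃ λ r → (𝟘 < η × η < δ) × (𝟘 < s × s < δ) × Approx r s η x × η ≤ δ₁
          scales {δ₁} δ₁>0 =
            case min₂ δ₁ δ δ₁>0 δ>0 of λ (δ₂ , δ₂>0 , u₁ , u) →
            case dense δ₂>0 of λ (η , η>0 , η<δ₂) →
            case approx η>0 of λ (r , s₀ , s₀>0 , ap) →
            case min₂ s₀ δ s₀>0 δ>0 of λ (s₁ , s₁>0 , v₁ , v) →
            case dense s₁>0 of λ (s , s>0 , s<s₁) →
            η , s , r , (η>0 , <-≤-trans η<δ₂ u) , (s>0 , <-≤-trans s<s₁ v) ,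
            (λ y Ay c → map₂ (λ (f , d) → fam-mono D ≤-refl (<⇒≤ (<-≤-trans s<s₁ v₁)) f , d) (ap y Ay c)) ,
            <⇒≤ (<-≤-trans η<δ₂ u₁)

        fibre-bound : ∀ {e I N δ} → 𝟘 < e → e ≤ c₀ → (∀ {y} → a ≤ y ⊕ e → y ≤ a ⊕ e → Closed R I y) → 𝟘 < δ →
          (∀ {η s ζ} → 𝟘 < η → η < δ → 𝟘 < s → s < δ → 𝟘 < ζ → ζ < δ →
            UniformlyFiniteNear R a I N (fibre R gapSet (η ∷ s ∷ ζ ∷ x))) →
          ¬ Many _<_ (λ y → A (y ∷ x) × close e a y) N
        fibre-bound {e} {I} {N} {δ} e>0 e≤c₀ e⊆I δ>0 ufn many =
          case many-gap e≤c₀ δ>0 many of λ (η , s , (η>0 , η<δ) , (s>0 , s<δ) , many′) →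
          case gap-directed {e} {N} {η} {s} δ>0 many′ of λ (ζ , ζ>0 , ζ<δ , many″) →
          gap-bound {e} {I} {N} {η} {s} {ζ} e>0 e⊆I ζ>0 (ufn η>0 η<δ s>0 s<δ ζ>0 ζ<δ) many″

  interval-int : ∀ {u v} → u < v → HasInt₁ (λ z → u < z × z < v)
  interval-int {u} {v} u<v =
    case dense u<v of λ (w , u<w , w<v) →
    case pos-diff u<w of λ (ε₁ , ε₁>0 , e₁) →
    case pos-diff w<v of λ (ε₂ , ε₂>0 , e₂) →
    case min₂ ε₁ ε₂ ε₁>0 ε₂>0 of λ (ε , ε>0 , l₁ , l₂) →
    w , ε , ε>0 , λ z c →
      by< (upper (close-mono l₁ c)) (subst (λ v → u ⊕ (z ⊕ ε₁) ≡ z ⊕ v) e₁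
        (prove 3 (:a :+ (:b :+ :c)) (:b :+ (:a :+ :c)) (u ∷ z ∷ ε₁ ∷ []))) ,
      subst (z <_) e₂ (lower (close-mono l₂ c))

  int₁-map : {S T : C → Set ℓ} → (∀ {y} → S y → T y) → HasInt₁ S → HasInt₁ T
  int₁-map f (y , ε , ε>0 , h) = y , ε , ε>0 , λ z c → f (h z c)

  int-map : {S T : Vec C n → Set ℓ} → (∀ {y} → S y → T y) → HasInt S → HasInt T
  int-map f (y , ε , ε>0 , h) = y , ε , ε>0 , λ z c → f (h z c)

  int-× : {S : C → Set ℓ} {T : Vec C n → Set ℓ} {A : Vec C (suc n) → Set ℓ} →
    (∀ {y x} → S y → T x → A (y ∷ x)) → HasInt₁ S → HasInt T → HasInt A
  int-× f (y , ε , ε>0 , g) (x , δ , δ>0 , h) =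
    case min₂ ε δ ε>0 δ>0 of λ (η , η>0 , u , v) →
    y ∷ x , η , η>0 , λ where
      (z ∷ w) c → f (g z (close-mono u (vc-hd c))) (h w (vc-mono v (vc-tl c)))

  interval-many : ∀ {u v} → u < v → ∀ N → Many _<_ (λ y → u < y × y < v) N
  interval-many {u} {v} u<v N =
    case dense u<v of λ (w , u<w , w<v) → w , (u<w , w<v) , chain N w u<w w<v
    where
    chain : ∀ N w → u < w → w < v → Chain _<_ (λ y → u < y × y < v) N w
    chain zero    w u<w w<v = tt
    chain (suc N) w u<w w<v =
      case dense w<v of λ (w′ , w<w′ , w′<v) →
      w′ , w<w′ , (<-trans u<w w<w′ , w′<v) , chain N w′ (<-trans u<w w<w′) w′<v

  basic-nbhd : ∀ {a} l u → BasicOpen R (l , u) a → ∃ λ e → 𝟘 < e × (∀ {y} → a ≤ y ⊕ e → y ≤ a ⊕ e → BasicOpen R (l , u) y)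
  basic-nbhd {a} l u (l<a , a<u) =
    case left l l<a of λ (e₁ , e₁>0 , f) →
    case right u a<u of λ (e₂ , e₂>0 , g) →
    case min₂ e₁ e₂ e₁>0 e₂>0 of λ (e , e>0 , i , j) →
    e , e>0 , λ {y} p q → f (≤-trans p (≤-refl ≤+≤ i)) , g (≤-trans q (≤-refl ≤+≤ j))
    where
    left : ∀ l → l <± [ a ]± → ∃ λ e → 𝟘 < e × (∀ {y} → a ≤ y ⊕ e → l <± [ y ]±)
    left ⊥±    p = c₀ , c₀>0 , λ {y} _ → ⊥±<[ y ]
    left ⊤±    ()
    left [ c ]± <±[ c<a ] =
      case gap c<a of λ (e , e>0 , q) → e , e>0 , λ {y} p → <±[ by< (q <+≤ p)
        (prove 4 (:a :+ (:d :+ (:b :+ :c))) (:b :+ ((:a :+ :c) :+ :d)) (c ∷ y ∷ e ∷ a ∷ [])) ]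
    right : ∀ u → [ a ]± <± u → ∃ λ e → 𝟘 < e × (∀ {y} → y ≤ a ⊕ e → [ y ]± <± u)
    right ⊥±    Strict⁺.[ () ]
    right ⊤±    p = c₀ , c₀>0 , λ {y} _ → [ y ]<⊤±
    right [ c ]± <±[ a<c ] =
      case gap a<c of λ (e , e>0 , q) → e , e>0 , λ {y} p → <±[ ≤-<-trans p q ]

  int-nbhd : ∀ {I a} → int R (Closed R I) a → ∃ λ e → 𝟘 < e × e ≤ c₀ × (∀ {y} → a ≤ y ⊕ e → y ≤ a ⊕ e → Closed R I y)
  int-nbhd {I} {a} ((l , u) , a∈B , sub) =
    case basic-nbhd l u a∈B of λ (e₁ , e₁>0 , f) →
    case min₂ e₁ c₀ e₁>0 c₀>0 of λ (e , e>0 , i , e≤c₀) →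
    e , e>0 , e≤c₀ , λ {y} p q → sub (f (≤-trans p (≤-refl ≤+≤ i)) (≤-trans q (≤-refl ≤+≤ i)))

  open-nbhd : ∀ {c d a} → c < a → a < d → ∃ λ δ → 𝟘 < δ × (∀ {z} → close δ a z → Open R (c , d) z)
  open-nbhd {c} {d} {a} c<a a<d =
    case pos-diff c<a of λ (ε₁ , ε₁>0 , e₁) →
    case pos-diff a<d of λ (ε₂ , ε₂>0 , e₂) →
    case min₂ ε₁ ε₂ ε₁>0 ε₂>0 of λ (δ , δ>0 , l₁ , l₂) →
    δ , δ>0 , λ {z} h →
      by< (upper (close-mono l₁ h)) (subst (λ v → c ⊕ (z ⊕ ε₁) ≡ z ⊕ v) e₁
        (prove 3 (:a :+ (:b :+ :c)) (:b :+ (:a :+ :c)) (c ∷ z ∷ ε₁ ∷ []))) ,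
      subst (z <_) e₂ (lower (close-mono l₂ h))

  box-nbhd : {U : Vec (Interval R) n} {x : Vec C n} → OpenBox R U x → ∃ λ δ → 𝟘 < δ × (∀ {z} → Closeⁿ δ x z → OpenBox R U z)
  box-nbhd [] = c₀ , c₀>0 , λ { {[]} _ → [] }
  box-nbhd ((c<x , x<d) ∷ xs) =
    case open-nbhd c<x x<d of λ (δ₁ , δ₁>0 , f) →
    case box-nbhd xs of λ (δ₂ , δ₂>0 , g) →
    case min₂ δ₁ δ₂ δ₁>0 δ₂>0 of λ (δ , δ>0 , u , v) →
    δ , δ>0 , λ { {_ ∷ _} h → f (close-mono u (vc-hd h)) ∷ g (vc-mono v (vc-tl h)) }

  close-𝟘 : ∀ {η δ} → 𝟘 < η → η < δ → close δ 𝟘 η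
  close-𝟘 {η} {δ} p q = mkC (<-trans p (<⊕ (<-trans p q))) (subst (η <_) (sym (⊕-identityˡ δ)) q)

  -- The height a is the cut of those q for which the part of Y below q projects
  -- onto sets with interior arbitrarily close to x₀.
  localize : {Y : Vec C (suc n) → Set ℓ} → Dfn Y → IsClosed Y → ∀ {lo hi} → (∀ {y x} → Y (y ∷ x) → lo < y × y ≤ hi) →
    ∀ {x₀ ε₀} → 𝟘 < ε₀ → (∀ x → Closeⁿ ε₀ x₀ x → ∃ λ y → Y (y ∷ x)) →
    ∃ λ a → ∀ δ → 𝟘 < δ → HasInt (λ x → Closeⁿ δ x₀ x × ∃ λ y → close δ y a × Y (y ∷ x))
  localize {n} {Y} d cl {lo} {hi} b {x₀} {ε₀} ε₀>0 onto =
    case cut dP up ¬Plo Phi of λ (a , ¬P , Pq) → a , near a ¬P Pq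
    where
    instance
      dY : ∀ {m} {g : Vec C m → Vec C (suc n)} → ⦃ DfnMap g ⦄ → Dfn (λ w → Y (g w))
      dY ⦃ γ ⦄ = dfn-∘ d γ
    P : C → Set ℓ
    P q = ∀ δ → 𝟘 < δ → HasInt (λ x → Closeⁿ δ x₀ x × ∃ λ y → y ≤ q × Y (y ∷ x))
    abstract
      dP : Dfn {1} (λ w → P (hd w))
      dP = it
    up : ∀ {q q′} → q ≤ q′ → P q → P q′
    up l p δ δ>0 = int-map (λ (v , y , y≤q , Yy) → v , y , ≤-trans y≤q l , Yy) (p δ δ>0)
    ¬Plo : ¬ P lo
    ¬Plo p = case p c₀ c₀>0 of λ (x , ε , ε>0 , h) → case h x (vc-refl ε>0) of λ (_ , y , y≤lo , Yy) → ≤⇒≯ y≤lo (proj₁ (b Yy))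
    Phi : P hi
    Phi δ δ>0 = case min₂ δ ε₀ δ>0 ε₀>0 of λ (η , η>0 , u , v) →
      x₀ , η , η>0 , λ z c → vc-mono u c , map₂ (λ Yy → proj₂ (b Yy) , Yy) (onto z (vc-mono v c))
    K : C → Vec C n → Set ℓ
    K q x = ∃ λ y → Y (y ∷ x) × y ≤ q
    K-closed : ∀ q → IsClosed (K q)
    K-closed q = proj-closed {Y = λ w → Y w × lookup w zero ≤ q} (dfn-× ⦃ d ⦄ ⦃ dfn-≤ (dt-lookup zero) (dt-const q) ⦄)
      (closed-∩ cl (closed-≤ zero q)) (λ (Yy , _) → b Yy)
    near : ∀ a → (∀ q → q < a → ¬ P q) → (∀ q → a < q → P q) →
      ∀ δ → 𝟘 < δ → HasInt (λ x → Closeⁿ δ x₀ x × ∃ λ y → close δ y a × Y (y ∷ x))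
    near a ¬P Pq δ δ>0 = dne λ none → ¬P (a ⊖' δ) (⊖'< δ>0) λ δ₁ δ₁>0 →
      case min₂ δ δ₁ δ>0 δ₁>0 of λ (η , η>0 , u , v) →
      case dense (<⊕ {a} δ>0) of λ (q′ , a<q′ , q′<a+δ) →
      case Pq q′ a<q′ η η>0 of λ (x₁ , ε₁ , ε₁>0 , h) →
      x₁ , ε₁ , ε₁>0 , λ z c → vc-mono v (proj₁ (h z c)) ,
        -- Otherwise a ball around `z` misses this closed set. Over it, points of `Y` of height at
        -- most `q′` lie within `δ` of `a`, against the assumption `none`.
        (case dne {A = K (a ⊖' δ) z} (λ nk → none
          (case escape {K = K (a ⊖' δ)} (K-closed (a ⊖' δ)) nk of λ (ε₂ , ε₂>0 , f) →
           case vc-shrink ε₁>0 c of λ (ε₃ , ε₃>0 , g) →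
           case min₂ ε₂ ε₃ ε₂>0 ε₃>0 of λ (ε , ε>0 , i , j) →
           z , ε , ε>0 , λ w c′ →
             case h w (g w (vc-mono j c′)) of λ (k , y , y≤q′ , Yy) →
             vc-mono u k , y ,
             mkC (≤-<-trans y≤q′ q′<a+δ)
                 (subst (_< y ⊕ δ) (⊖-cancel a δ) (<-translation δ (≰⇒> λ y≤ → f w (vc-mono i c′) (y , Yy , y≤)))) ,
             Yy))
         of λ (y , Yy , y≤) → y , y≤ , Yy)

  -- Interior is excluded for the members and not for `A` itself. This weaker hypothesis is what
  -- allows `fibre-baire` to be deduced.
  local-bound : {A : Vec C (suc m) → Set ℓ} (D : DΣ A) → ∀ a b → ∃ λ N → ∃ λ e → ∃ λ δ → 𝟘 < e × 𝟘 < δ ×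
    (∀ x → Closeⁿ δ b x → (∀ r {s} → 𝟘 < s → ¬ HasInt₁ (λ y → fam D r s (y ∷ x))) → ¬ Many _<_ (λ y → A (y ∷ x) × close e a y) N)
  local-bound {m} D a b =
    -- The base point is the origin in the coordinates `η`, `s` and `ζ`, because `fibre-bound` needs
    -- only small positive values of them.
    case luf (3 + m) gapSet a (𝟘 ∷ 𝟘 ∷ 𝟘 ∷ b) of λ (N , I , U , _ , a∈I , b∈U , ufn) →
    case int-nbhd {I} a∈I of λ (e , e>0 , e≤c₀ , e⊆I) →
    case box-nbhd b∈U of λ (δ , δ>0 , δ⊆U) →
    N , e , δ , e>0 , δ>0 , λ x c no-int → fibre-bound x no-int {I = I} e>0 e≤c₀ e⊆I δ>0
      λ {η} {s} {ζ} p p′ q q′ t t′ → ufn (η ∷ s ∷ ζ ∷ x)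
        (δ⊆U (vc-∷ (close-𝟘 p p′) (vc-∷ (close-𝟘 q q′) (vc-∷ (close-𝟘 t t′) c))))
    where open FibreBound D a using (gapSet; fibre-bound)

  -- The Baire property

  fibre-baire : {A : Vec C (suc m) → Set ℓ} (D : DΣ A) → ∀ {x} → HasInt₁ (λ y → A (y ∷ x)) →
    ∃ λ r → ∃ λ s → 𝟘 < s × HasInt₁ (λ y → fam D r s (y ∷ x))
  fibre-baire D {x} (a , ε , ε>0 , h) = dne λ none →
    case local-bound D a x of λ (N , e , δ , e>0 , δ>0 , bound) →
    case min₂ ε e ε>0 e>0 of λ (η , η>0 , u , v) →
    -- The points between `a` and `a ⊕ η` lie in the fibre and in the window, and an interval has
    -- more than `N` points.
    bound x (vc-refl δ>0) (λ r s>0 i → none (r , _ , s>0 , i))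
      (many-map id (λ {y} (p , q) → let c = mkC {η} {a} {y} (<-trans p (<⊕ η>0)) q in
        h y (close-mono u c) , close-mono v c) (interval-many (<⊕ η>0) N))

  module _ {A : Vec C (suc n) → Set ℓ} (D : DΣ A) where
    private
      open DΣ D using (fam-inst)

      -- The index `s` is also the length of the segment, so the sets of left end points form a
      -- monotone family. The left end is listed on its own because bounds are required for all `s`,
      -- and for negative `s` the segment is empty.
      Seg : C → C → Vec C (suc n) → Set ℓ
      Seg r s w = fam D r s w × (∀ z → hd w ≤ z → z ≤ hd w ⊕ s → fam D r s (z ∷ tl w))

      seg-tl : ∀ {r s y x} → Seg r s (y ∷ x) → ∀ z → y ≤ z → z ≤ y ⊕ s → fam D r s (z ∷ x)
      seg-tl {r} {s} {y} {x} (_ , h) z p q = subst (λ v → fam D r s (z ∷ v)) (tl-∷ y x)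
        (h z (subst (_≤ z) (sym (hd-∷ y x)) p) (subst (λ u → z ≤ u ⊕ s) (sym (hd-∷ y x)) q))

      tl-seg : ∀ {r s y x} → fam D r s (y ∷ x) → (∀ z → y ≤ z → z ≤ y ⊕ s → fam D r s (z ∷ x)) → Seg r s (y ∷ x)
      tl-seg {r} {s} {y} {x} f h = f , λ z p q → subst (λ v → fam D r s (z ∷ v)) (sym (tl-∷ y x))
        (h z (subst (_≤ z) (hd-∷ y x) p) (subst (λ u → z ≤ u ⊕ s) (hd-∷ y x) q))

      seg-bdd : ∀ {r s y x} → Seg r s (y ∷ x) → (⊖ r) ⊖' c₀ < y × y ≤ r
      seg-bdd (f , _) = case bd (fam-bdd D f) zero of λ (b , b′) → ⊖-≤ b , b′

      seg-closed : ∀ r {s} → 𝟘 < s → IsClosed (Seg r s)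
      seg-closed r {s} s>0 (y ∷ x) h = tl-seg
        (fam-closed D r s>0 (y ∷ x) λ ε ε>0 → case h ε ε>0 of λ (w , c , f , _) → w , c , f)
        λ z p q → fam-closed D r s>0 (z ∷ x) λ ε ε>0 → case h ε ε>0 of λ where
          -- The point of the nearby segment at the same distance from its left end as `z` from `y`.
          (y′ ∷ x′ , c , g) → (z ⊕ y′) ⊖' y ∷ x′ ,
            vc-∷ (mkC
              (by< (upper (vc-hd c)) (trans
                (prove 3 (:a :+ (:b :+ :c)) ((:a :+ :b) :+ :c) (z ∷ y′ ∷ ε ∷ []))
                (trans (cong (_⊕ ε) (sym (⊖-cancel (z ⊕ y′) y)))
                  (prove 3 ((:a :+ :b) :+ :c) ((:a :+ :c) :+ :b) ((z ⊕ y′) ⊖' y ∷ y ∷ ε ∷ [])))))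
              (by< (lower (vc-hd c)) (trans
                (prove 3 (:a :+ (:b :+ :c)) ((:a :+ :b) :+ :c) ((z ⊕ y′) ⊖' y ∷ y ∷ ε ∷ []))
                (trans (cong (_⊕ ε) (⊖-cancel (z ⊕ y′) y))
                  (prove 3 ((:a :+ :b) :+ :c) ((:a :+ :c) :+ :b) (z ∷ y′ ∷ ε ∷ []))))))
              (vc-tl c) ,
            seg-tl g _
              (by≤ p (trans (prove 2 (:a :+ :b) (:b :+ :a) (y′ ∷ z ∷ [])) (sym (⊖-cancel (z ⊕ y′) y))))
              (by≤ q (trans
                (prove 3 (:a :+ (:b :+ :c)) ((:a :+ :b) :+ :c) ((z ⊕ y′) ⊖' y ∷ y ∷ s ∷ []))
                (trans (cong (_⊕ s) (⊖-cancel (z ⊕ y′) y))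
                  (prove 3 ((:a :+ :b) :+ :c) ((:b :+ :c) :+ :a) (z ∷ y′ ∷ s ∷ [])))))

      abstract
        seg-dfn : Dfn (λ w → ∃ λ y → Seg (hd w) (hd (tl w)) (y ∷ tl (tl w)))
        seg-dfn = it
        seg-dfn′ : ∀ r s → Dfn (Seg r s)
        seg-dfn′ r s = it

    Fat : Vec C n → Set ℓ
    Fat x = HasInt₁ (λ y → A (y ∷ x))

    -- That every fat fibre contains a segment of a single member is exactly `fibre-baire`.
    Σ-fat : DΣ Fat
    Σ-fat = record
      { fam        = λ r s x → ∃ λ y → Seg r s (y ∷ x)
      ; fam-dfn    = seg-dfn
      ; fam-closed = λ r {s} s>0 → proj-closed (seg-dfn′ r s) (seg-closed r s>0) seg-bdd
      ; fam-bdd    = λ (y , f , _) → bdd-tl (fam-bdd D f)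
      ; fam-mono   = λ p q (y , g) → y , tl-seg (fam-mono D p q (proj₁ g))
          (λ z u v → fam-mono D p q (seg-tl g z u (≤-trans v (≤-refl ≤+≤ q))))
      ; ∈⇒fam      = λ i →
          case fibre-baire D i of λ (r , s , s>0 , y , ε , ε>0 , h) →
          case dense ε>0 of λ (δ , δ>0 , δ<ε) →
          case min₂ s δ s>0 δ>0 of λ (t , t>0 , t≤s , t≤δ) →
          r , t , t>0 , y , tl-seg (fam-mono D ≤-refl t≤s (h y (close-refl ε>0)))
            (λ z p q → fam-mono D ≤-refl t≤s (h z (mkC (≤-<-trans p (<⊕ ε>0)) (≤-<-trans q (≤-refl ≤+< ≤-<-trans t≤δ δ<ε)))))
      ; fam⇒∈      = λ s>0 (y , g) →
          int₁-map (λ (p , q) → fam⇒∈ D s>0 (seg-tl g _ (<⇒≤ p) (<⇒≤ q))) (interval-int (<⊕ s>0))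
      }

    -- The segments over a box start at varying heights. `localize` finds a smaller box where some
    -- of them start within `δ` of one height `a`; having length `s > δ ⊕ δ`, these share the
    -- interval from `a ⊕ δ` to `(a ⊕ s) ⊖' δ`.
    fat-fam : ∀ {r s} → 𝟘 < s → HasInt (fam Σ-fat r s) → HasInt (fam D r s)
    fat-fam {r} {s} s>0 (x₀ , ε₀ , ε₀>0 , onto) =
      case half< s>0 of λ (δ , δ>0 , δδ<s) →
      case localize (seg-dfn′ r s) (seg-closed r s>0) seg-bdd ε₀>0 onto of λ (a , near) →
      int-× {S = λ z → a ⊕ δ < z × z < (a ⊕ s) ⊖' δ} {T = λ x → Closeⁿ δ x₀ x × ∃ λ y → close δ y a × Seg r s (y ∷ x)}
        (λ {z} (p , q) (_ , y , c , g) → seg-tl g z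
          (<⇒≤ (<-trans (upper c) p))
          (<⇒≤ (<-trans q (by< (lower c) (trans
            (prove 4 (:a :+ (:b :+ :c)) ((:a :+ :c) :+ :b) ((a ⊕ s) ⊖' δ ∷ y ∷ δ ∷ δ ∷ []))
            (trans (cong (_⊕ y) (⊖-cancel (a ⊕ s) δ))
              (prove 3 ((:a :+ :b) :+ :c) ((:c :+ :b) :+ :a) (a ∷ s ∷ y ∷ []))))))))
        (interval-int (by< δδ<s (trans
          (sym (trans
            (prove 2 (:a :+ (:b :+ :b)) ((:a :+ :b) :+ :b) ((a ⊕ s) ⊖' δ ∷ δ ∷ []))
            (trans (cong (_⊕ δ) (⊖-cancel (a ⊕ s) δ)) (prove 3 ((:a :+ :b) :+ :c) ((:a :+ :c) :+ :b) (a ∷ s ∷ δ ∷ [])))))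
          refl)))
        (near δ δ>0)

  baire : ∀ n {A : Vec C n → Set ℓ} (D : DΣ A) → HasInt A → ∃ λ r → ∃ λ s → 𝟘 < s × HasInt (fam D r s)
  baire zero D ([] , ε , ε>0 , h) =
    case ∈⇒fam D (h [] (vc-refl ε>0)) of λ (r , s , s>0 , f) → r , s , s>0 , [] , ε , ε>0 , λ where [] _ → f
  baire (suc n) D (y ∷ x , ε , ε>0 , h) =
    case baire n (Σ-fat D) (x , ε , ε>0 , λ w c → y , ε , ε>0 , λ z c′ → h (z ∷ w) (vc-∷ c′ c)) of λ (r , s , s>0 , i) →
    r , s , s>0 , fat-fam D s>0 i

  -- The intervals in the fibres have at first neither a common length nor a common position.
  -- `baire` makes the length uniform, and `fat-fam` the position.
  fat-int : {A : Vec C (suc n) → Set ℓ} (D : DΣ A) → HasInt (Fat D) → HasInt A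
  fat-int D i = case baire _ (Σ-fat D) i of λ (r , s , s>0 , j) → int-map (fam⇒∈ D s>0) (fat-fam D s>0 j)

  -- Closedness proofs match on vectors, whereas definability is derived through the opaque `hd` and
  -- `tl`. These forms, with `dfn-un₁` and `dfn-un₂`, pass between the two.
  un₁ : (C → Vec C n → Set ℓ) → Vec C (suc n) → Set ℓ
  un₁ P (y ∷ x) = P y x

  un₂ : (C → C → Vec C n → Set ℓ) → Vec C (suc (suc n)) → Set ℓ
  un₂ P (z ∷ y ∷ x) = P z y x

  opaque
    unfolding hd
    dfn-un₁ : {P : C → Vec C n → Set ℓ} → Dfn (λ w → P (hd w) (tl w)) → Dfn (un₁ P)
    dfn-un₁ = dfn-≐ (λ { {_ ∷ _} p → p }) (λ { {_ ∷ _} p → p })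

    dfn-un₂ : {P : C → C → Vec C n → Set ℓ} → Dfn (λ w → P (hd w) (hd (tl w)) (tl (tl w))) → Dfn (un₂ P)
    dfn-un₂ = dfn-≐ (λ { {_ ∷ _ ∷ _} p → p }) (λ { {_ ∷ _ ∷ _} p → p })

  module _ {S : C → Set ℓ} {s : C} (s>0 : 𝟘 < s) where
    elems-≥ : ∀ k {y} (c : Chain (λ y z → y ⊕ s ≤ z) S k y) {z} → z ∈ˡ elems k c → y ⊕ s ≤ z
    elems-≥ (suc k) (_ , p , _ , c) (here refl) = p
    elems-≥ (suc k) (_ , p , _ , c) (there i)   = ≤-trans p (≤-trans (<⇒≤ (<⊕ s>0)) (elems-≥ k c i))

    elems-separated : ∀ k {y} (c : Chain (λ y z → y ⊕ s ≤ z) S k y) {z z′} →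
      z ∈ˡ y ∷ elems k c → z′ ∈ˡ y ∷ elems k c → z < z′ → z ⊕ s ≤ z′
    elems-separated k       c               (here refl) (here refl) z<z = ⊥-elim (<-irrefl refl z<z)
    elems-separated k       c               (here refl) (there j)   _   = elems-≥ k c j
    elems-separated k       c               (there i)   (here refl) z<y =
      ⊥-elim (≤⇒≯ (elems-≥ k c i) (<-trans z<y (<⊕ s>0)))
    elems-separated (suc k) (_ , _ , _ , c) (there i)   (there j)   z<z′ = elems-separated k c i j z<z′

  module _ {A : Vec C (suc n) → Set ℓ} (D : DΣ A) where
    private
      open DΣ D using (fam-inst)

      step : C → C → C → Set ℓ
      step s y z = y ⊕ s ≤ z

      F : C → C → Vec C n → C → Set ℓ
      F r s x y = fam D r s (y ∷ x)

      chain-dfn : ∀ r s k → Dfn (λ w → Chain (step s) (F r s (tl w)) k (hd w))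
      chain-dfn r s k = dfn-chain {r = λ _ → step s} {S = F r s} it it k

      many-dfn : ∀ k → Dfn (λ w → Many (step (hd (tl w))) (F (hd w) (hd (tl w)) (tl (tl w))) k)
      many-dfn k = dfn-many {r = λ w → step (hd (tl w))} {S = λ w → F (hd w) (hd (tl w)) (tl (tl w))} it it k

      F-bdd : ∀ {r s y x} → fam D r s (y ∷ x) → (⊖ r) ⊖' c₀ < y × y ≤ r
      F-bdd f = case bd (fam-bdd D f) zero of λ (b , b′) → ⊖-≤ b , b′

      Next : C → C → ℕ → C → C → Vec C n → Set ℓ
      Next r s k z y x = y ⊕ s ≤ z × F r s x z × Chain (step s) (F r s x) k z

      next-dfn : ∀ r s k → Dfn (λ w → Next r s k (hd w) (hd (tl w)) (tl (tl w)))
      next-dfn r s k = dfn-× ⦃ it ⦄ ⦃ dfn-× ⦃ it ⦄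
        ⦃ dfn-app {P = λ z x → Chain (step s) (F r s x) k z} (chain-dfn r s k) dt-hd it ⦄ ⦄

      F-closed : ∀ r {s} → 𝟘 < s → ∀ y x → (∀ ε → 𝟘 < ε → ∃ λ y′ → ∃ λ x′ → close ε y y′ × Closeⁿ ε x x′ × F r s x′ y′) → F r s x y
      F-closed r s>0 y x h = fam-closed D r s>0 (y ∷ x) λ ε ε>0 →
        case h ε ε>0 of λ (y′ , x′ , c , v , f) → y′ ∷ x′ , vc-∷ c v , f

      -- Each further element of the chain ranges over a closed bounded fibre, so `proj-closed`
      -- eliminates it.
      chain-closed : ∀ r {s} → 𝟘 < s → ∀ k → IsClosed (un₁ λ y x → Chain (step s) (F r s x) k y)
      chain-closed r s>0 zero    (y ∷ x) h = tt
      chain-closed r {s} s>0 (suc k) (y ∷ x) h =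
        proj-closed {Y = un₂ (Next r s k)} (dfn-un₂ {P = Next r s k} (next-dfn r s k)) next-closed
          (λ {z} {w} → next-bdd z w) (y ∷ x)
          (λ ε ε>0 → un-y (h ε ε>0))
        where
        un-y : ∀ {ε} → (∃ λ w → Closeⁿ ε (y ∷ x) w × un₁ (λ y x → Chain (step s) (F r s x) (suc k) y) w) →
          ∃ λ w → Closeⁿ ε (y ∷ x) w × ∃ λ z → un₂ (Next r s k) (z ∷ w)
        un-y (y′ ∷ x′ , c , ch) = y′ ∷ x′ , c , ch
        next-bdd : ∀ z w → un₂ (Next r s k) (z ∷ w) → (⊖ r) ⊖' c₀ < z × z ≤ r
        next-bdd z (_ ∷ _) (_ , f , _) = F-bdd f
        next-closed : IsClosed (un₂ (Next r s k))
        next-closed (z ∷ y ∷ x) h =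
          limit-≤ (λ ε ε>0 → case half ε>0 of λ (δ , δ>0 , δδ≤ε) → sep ε δ δδ≤ε (h δ δ>0)) ,
          F-closed r s>0 z x (λ ε ε>0 → fib (h ε ε>0)) ,
          chain-closed r s>0 k (z ∷ x) (λ ε ε>0 → rest (h ε ε>0))
          where
          sep : ∀ ε δ → δ ⊕ δ ≤ ε → (∃ λ w → Closeⁿ δ (z ∷ y ∷ x) w × un₂ (Next r s k) w) → y ⊕ s ≤ z ⊕ ε
          sep ε δ δδ≤ε (z′ ∷ y′ ∷ x′ , c , p , _) =
            <⇒≤ (<-≤-trans
              (by< (upper (vc-hd (vc-tl c)) <+≤ p <+< lower (vc-hd c))
                (trans (cong ((y ⊕ s) ⊕_) (⊕-comm _ _))
                (trans (sym (⊕-assoc _ _ _))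
                (prove 6 (((:a :+ :b) :+ (:f :+ :d)) :+ ((:c :+ :d) :+ :e)) ((:f :+ (:d :+ :d)) :+ ((:a :+ (:c :+ :b)) :+ :e))
                  (y ∷ s ∷ y′ ∷ δ ∷ z′ ∷ z ∷ [])))))
              (≤-refl ≤+≤ δδ≤ε))
          fib : ∀ {ε} → (∃ λ w → Closeⁿ ε (z ∷ y ∷ x) w × un₂ (Next r s k) w) → ∃ λ y′ → ∃ λ x′ → close ε z y′ × Closeⁿ ε x x′ × F r s x′ y′
          fib (z′ ∷ y′ ∷ x′ , c , _ , f , _) = z′ , x′ , vc-hd c , vc-tl (vc-tl c) , f
          rest : ∀ {ε} → (∃ λ w → Closeⁿ ε (z ∷ y ∷ x) w × un₂ (Next r s k) w) →
            ∃ λ w → Closeⁿ ε (z ∷ x) w × un₁ (λ y x → Chain (step s) (F r s x) k y) w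
          rest (z′ ∷ y′ ∷ x′ , c , _ , _ , ch) = z′ ∷ x′ , vc-∷ (vc-hd c) (vc-tl (vc-tl c)) , ch

      many-closed : ∀ r {s} → 𝟘 < s → ∀ k → IsClosed (λ x → Many (step s) (F r s x) k)
      many-closed r {s} s>0 k =
        proj-closed {Y = un₁ Start} (dfn-un₁ {P = Start} (dfn-× ⦃ it ⦄ ⦃ chain-dfn r s k ⦄))
          start-closed (λ (f , _) → F-bdd f)
        where
        Start : C → Vec C n → Set ℓ
        Start y x = F r s x y × Chain (step s) (F r s x) k y
        start-closed : IsClosed (un₁ Start)
        start-closed (y ∷ x) h =
          F-closed r s>0 y x (λ ε ε>0 → fib (h ε ε>0)) , chain-closed r s>0 k (y ∷ x) (λ ε ε>0 → rest (h ε ε>0))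
          where
          fib : ∀ {ε} → (∃ λ w → Closeⁿ ε (y ∷ x) w × un₁ Start w) → ∃ λ y′ → ∃ λ x′ → close ε y y′ × Closeⁿ ε x x′ × F r s x′ y′
          fib (y′ ∷ x′ , c , f , _) = y′ , x′ , vc-hd c , vc-tl c , f
          rest : ∀ {ε} → (∃ λ w → Closeⁿ ε (y ∷ x) w × un₁ Start w) →
            ∃ λ w → Closeⁿ ε (y ∷ x) w × un₁ (λ y x → Chain (step s) (F r s x) k y) w
          rest (y′ ∷ x′ , c , _ , ch) = y′ ∷ x′ , c , ch

    -- The strict order is not a closed relation, so the members ask for chains with steps of length
    -- at least `s`. The steps of a finite chain have a common positive lower bound.
    Σ-many : ∀ k → DΣ (λ x → Many _<_ (λ y → A (y ∷ x)) k)
    Σ-many k = record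
      { fam        = λ r s x → Many (step s) (F r s x) k
      ; fam-dfn    = many-dfn k
      ; fam-closed = λ r s>0 → many-closed r s>0 k
      ; fam-bdd    = λ (_ , f , _) → bdd-tl (fam-bdd D f)
      ; fam-mono   = λ p q → many-map (≤-trans (≤-refl ≤+≤ q)) (fam-mono D p q)
      ; ∈⇒fam      = λ {x} m →
          case many-directed {T = C × ∃ λ s → 𝟘 < s} (λ (r , s , _) (r′ , s′ , _) → r ≤ r′ × s′ ≤ s) join
            {λ (_ , s , _) → step s} {λ (r , s , _) → F r s x}
            (λ (_ , q) p → ≤-trans (≤-refl ≤+≤ q) p) (λ (p , q) → fam-mono D p q) k (many-map
            (λ {y} {z} p → case pos-diff p of λ (s , s>0 , e) → (𝟘 , s , s>0) , inj₂ e)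
            (λ a → case ∈⇒fam D a of λ (r , s , s>0 , f) → (r , s , s>0) , f) m)
          of λ ((r , s , s>0) , m′) → r , s , s>0 , m′
      ; fam⇒∈      = λ s>0 → many-map (λ p → <-≤-trans (<⊕ s>0) p) (fam⇒∈ D s>0)
      }
      where
      join : (t t′ : C × ∃ λ s → 𝟘 < s) → ∃ λ ((r″ , s″ , _) : C × ∃ λ s → 𝟘 < s) →
        (proj₁ t ≤ r″ × s″ ≤ proj₁ (proj₂ t)) × (proj₁ t′ ≤ r″ × s″ ≤ proj₁ (proj₂ t′))
      join (r , s , p) (r′ , s′ , p′) =
        case max₂ r r′ of λ (r″ , i , j) →
        case min₂ s s′ p p′ of λ (s″ , q , u , v) →
        (r″ , s″ , q) , (i , u) , (j , v)

  -- Nowhere density of D_Σ sets without interior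

  closed-wide : ∀ a e → IsClosed {suc n} (λ w → a ≤ lookup w zero ⊕ e × lookup w zero ≤ a ⊕ e)
  closed-wide a e w h =
    limit-≤ (λ ε ε>0 → case h ε ε>0 of λ (v , c , p , _) → <⇒≤ (by< (p ≤+< lower (at c zero))
      (prove 5 (:a :+ ((:b :+ :c) :+ (:d :+ :e))) (((:d :+ :c) :+ :e) :+ (:a :+ :b)) (a ∷ lookup v zero ∷ e ∷ lookup w zero ∷ ε ∷ [])))) ,
    limit-≤ (λ ε ε>0 → case h ε ε>0 of λ (v , c , _ , q) → <⇒≤ (<-≤-trans (upper (at c zero)) (⊕-monoˡ-≤ ε q)))

  Σ-box : (x : Vec C n) → ∀ {ε} → 𝟘 < ε → DΣ (Closeⁿ ε x)
  Σ-box x ε>0 = Σ-open it λ z c → vc-shrink ε>0 c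

  Strip : C → C → Vec C (suc n) → Set ℓ
  Strip e a w = close e a (lookup w zero)

  Σ-strip : ∀ e a → DΣ (Strip {n} e a)
  Σ-strip e a = Σ-open (dfn-close (dt-const e) (dt-const a) (dt-lookup zero)) λ w c →
    case close-shrink c of λ (δ , δ>0 , f) → δ , δ>0 , λ v c′ → f (lookup v zero) (at c′ zero)

  NowhereDense : (Vec C n → Set ℓ) → Set ℓ
  NowhereDense A = ∀ x ε → 𝟘 < ε → ∃ λ x′ → ∃ λ ε′ → 𝟘 < ε′ × (∀ w → Closeⁿ ε′ x′ w → Closeⁿ ε x w × ¬ A w)

  baire-in : {A : Vec C n → Set ℓ} (D : DΣ A) → ∀ {x ε} → 𝟘 < ε → HasInt (λ w → A w × Closeⁿ ε x w) →
    ∃ λ r → ∃ λ s → 𝟘 < s × ∃ λ x′ → ∃ λ ε′ → 𝟘 < ε′ × (∀ w → Closeⁿ ε′ x′ w → Closeⁿ ε x w × fam D r s w)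
  baire-in {n} {A} D {x} {ε} ε>0 i =
    case baire n (Σ-∩ D box) i of λ (r , s , s>0 , x′ , ε′ , ε′>0 , h) →
    r , s , s>0 , x′ , ε′ , ε′>0 , λ w c → fam⇒∈ box s>0 (proj₂ (h w c)) , proj₁ (h w c)
    where
    box : DΣ (Closeⁿ ε x)
    box = Σ-box x ε>0

  ND : ℕ → Set (lsuc ℓ)
  ND n = {A : Vec C n → Set ℓ} → DΣ A → ¬ HasInt A → NowhereDense A

  -- Either the maximal number of points occurs on a set with interior, and then by
  -- the Baire property they form a separated chain in one member of the family, or
  -- k can be lowered on a smaller box.
  stab : ND n → {A : Vec C (suc n) → Set ℓ} (D : DΣ A) → ∀ k {x₀ ε₀} → 𝟘 < ε₀ →
    (∀ x → Closeⁿ ε₀ x₀ x → ¬ Many _<_ (λ y → A (y ∷ x)) k) →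
    ∃ λ r → ∃ λ s → 𝟘 < s × ∃ λ x₁ → ∃ λ ε₁ → 𝟘 < ε₁ × (∀ x → Closeⁿ ε₁ x₁ x → Closeⁿ ε₀ x₀ x ×
      (∀ {y} → A (y ∷ x) → fam D r s (y ∷ x)) × (∀ {y z} → A (y ∷ x) → A (z ∷ x) → y < z → y ⊕ s ≤ z))
  -- `Many` at 0 already excludes a single point: the fibres are empty, and any indices will do.
  stab nd D zero {x₀} {ε₀} ε₀>0 few = 𝟘 , c₀ , c₀>0 , x₀ , ε₀ , ε₀>0 , λ x c → c ,
    (λ a → ⊥-elim (few x c (_ , a , tt))) , λ a _ _ → ⊥-elim (few x c (_ , a , tt))
  stab nd {A} D (suc k) {x₀} {ε₀} ε₀>0 few = by-cases (HasInt (λ x → Many _<_ (λ y → A (y ∷ x)) k × Closeⁿ ε₀ x₀ x))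
    (λ i → case baire-in (Σ-many D k) ε₀>0 i of λ (r , s , s>0 , x₁ , ε₁ , ε₁>0 , h) →
      r , s , s>0 , x₁ , ε₁ , ε₁>0 , λ x c → case h x c of λ (c′ , y₀ , f₀ , ch) →
        let chain-all : ∀ {z} → A (z ∷ x) → z ∈ˡ y₀ ∷ elems k ch
            chain-all = many-insert (λ p → <-≤-trans (<⊕ s>0) p) (λ f → fam⇒∈ D s>0 f) (few x c′) f₀ ch
        in c′ , (λ {y} a → chain-fam f₀ ch (chain-all a)) ,
           λ {y} {z} a b → elems-separated s>0 k ch (chain-all a) (chain-all b))
    (λ ni → case nd (Σ-∩ (Σ-many D k) (Σ-box x₀ ε₀>0)) ni x₀ ε₀ ε₀>0 of λ (x₁ , ε₁ , ε₁>0 , h) →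
      case stab nd D k ε₁>0 (λ x c m → proj₂ (h x c) (m , proj₁ (h x c))) of λ (r , s , s>0 , x₂ , ε₂ , ε₂>0 , g) →
      r , s , s>0 , x₂ , ε₂ , ε₂>0 , λ x c → case g x c of λ (c′ , p) → proj₁ (h x c′) , p)
    where
    chain-fam : ∀ {r s x y₀} → fam D r s (y₀ ∷ x) → (ch : Chain (λ y z → y ⊕ s ≤ z) (λ y → fam D r s (y ∷ x)) k y₀) →
      ∀ {y} → y ∈ˡ y₀ ∷ elems k ch → fam D r s (y ∷ x)
    chain-fam f₀ ch (here refl) = f₀
    chain-fam f₀ ch (there i)   = elems-∈ k ch i

  fibre-few : {A : Vec C (suc n) → Set ℓ} (D : DΣ A) → ∀ a x → ∃ λ N → ∃ λ e → ∃ λ δ → 𝟘 < e × 𝟘 < δ ×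
    (∀ z → Closeⁿ δ x z → ¬ Fat D z → ¬ Many _<_ (λ y → A (y ∷ z) × close e a y) N)
  fibre-few D a x = case local-bound D a x of λ (N , e , δ , e>0 , δ>0 , bound) →
    N , e , δ , e>0 , δ>0 , λ z c nf → bound z c (λ r s>0 i → nf (int₁-map (fam⇒∈ D s>0) i))

  -- Closed sets without interior are easily avoided. Over a box with thin fibres, `stab` puts the
  -- part of `A` in a strip around `y` into one member of the family, which is closed and has no
  -- interior because `A` has none.
  nd : ∀ n → ND n
  nd zero {A} D ni x ε ε>0 = x , ε , ε>0 , λ w c → c , λ a → ni (w , ε , ε>0 , λ where
    [] _ → subst A (vec0 w) a)
    where
    vec0 : (w : Vec C 0) → w ≡ []
    vec0 [] = refl
  nd (suc n) {A} D ni (y ∷ x) ε ε>0 =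
    case nd n (Σ-fat D) (λ i → ni (fat-int D i)) x ε ε>0 of λ (x₁ , ε₁ , ε₁>0 , thin) →
    case fibre-few D y x₁ of λ (N , e , δ , e>0 , δ>0 , few) →
    case min₂ ε₁ δ ε₁>0 δ>0 of λ (ε₂ , ε₂>0 , u , v) →
    case stab (nd n) (Σ-∩ D (Σ-strip e y)) N ε₂>0 (λ z c → few z (vc-mono v c) (proj₂ (thin z (vc-mono u c)))) of
      λ (r , s , s>0 , x₃ , ε₃ , ε₃>0 , st) →
    case min₂ ε₃ e ε₃>0 e>0 of λ (ε₄ , ε₄>0 , i , j) →
    case min₂ ε₄ ε ε₄>0 ε>0 of λ (ε₅ , ε₅>0 , i′ , j′) →
    case escape-box {K = fam D r s} (fam-closed D r s>0) (λ h → ni (int-map (fam⇒∈ D s>0) h)) (y ∷ x₃) ε₅ ε₅>0 of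
      λ (x′ , ε′ , ε′>0 , esc) →
    x′ , ε′ , ε′>0 , λ w c → fin u i j i′ j′ thin st w (esc w c)
    where
    fin : ∀ {x₁ ε₁ ε₂ ε₃ ε₄ ε₅ e r s x₃} → ε₂ ≤ ε₁ → ε₄ ≤ ε₃ → ε₄ ≤ e → ε₅ ≤ ε₄ → ε₅ ≤ ε →
      (∀ z → Closeⁿ ε₁ x₁ z → Closeⁿ ε x z × ¬ Fat D z) →
      (∀ z → Closeⁿ ε₃ x₃ z → Closeⁿ ε₂ x₁ z × (∀ {y′} → A (y′ ∷ z) × close e y y′ →
        fam (Σ-∩ D (Σ-strip e y)) r s (y′ ∷ z)) × (∀ {y′ z′} → A (y′ ∷ z) × close e y y′ → A (z′ ∷ z) × close e y z′ → y′ < z′ → y′ ⊕ s ≤ z′)) →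
      ∀ w → Closeⁿ ε₅ (y ∷ x₃) w × ¬ fam D r s w → Closeⁿ ε (y ∷ x) w × ¬ A w
    fin u i j i′ j′ thin st (z ∷ v) (c , nf) =
      case st v (vc-mono (≤-trans i′ i) (vc-tl c)) of λ (c₂ , f , _) →
      vc-∷ (close-mono j′ (vc-hd c)) (proj₁ (thin v (vc-mono u c₂))) ,
      λ a → nf (proj₁ (f (a , close-mono (≤-trans i′ j) (vc-hd c))))

  -- Single-valued parts of D_Σ sets

  private
    -- The closed counterpart of `close e a`, since `localize` applies to closed sets.
    Wide : C → C → C → Set ℓ
    Wide e a y = a ≤ y ⊕ e × y ≤ a ⊕ e

    wide-dfn : ∀ a e → Dfn {suc n} (λ w → Wide e a (lookup w zero))
    wide-dfn a e = dfn-× ⦃ dfn-≤ (dt-const a) (dt-⊕′ (dt-lookup zero) (dt-const e)) ⦄ ⦃ dfn-≤ (dt-lookup zero) (dt-const (a ⊕ e)) ⦄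

    close-wide : ∀ {a a′ d e y y₁} → close d y₁ a′ → Wide e a y₁ → d ⊕ d ≤ e → close d a′ y → close (e ⊕ e) a y
    close-wide {a} {a′} {d} {e} {y} {y₁} c (w₁ , w₂) dd≤e c′ = case close-trans c c′ of λ (mkC u v) → mkC
      (by< (w₁ ≤+< u <+≤ dd≤e) (prove 5 (:a :+ (((:b :+ :c) :+ (:d :+ :e)) :+ :c)) ((:d :+ (:c :+ :c)) :+ ((:a :+ :b) :+ :e)) (a ∷ y₁ ∷ e ∷ y ∷ d ⊕ d ∷ [])))
      (by< (w₂ ≤+< v <+≤ dd≤e) (prove 5 (:d :+ (((:a :+ :c) :+ (:b :+ :e)) :+ :c)) ((:a :+ (:c :+ :c)) :+ ((:b :+ :d) :+ :e)) (a ∷ y₁ ∷ e ∷ y ∷ d ⊕ d ∷ [])))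

    separated⇒unique : ∀ {S : C → Set ℓ} {s d a y y′} → (∀ {y z} → S y → S z → y < z → y ⊕ s ≤ z) → d ⊕ d ≤ s →
      S y → S y′ → close d a y → close d a y′ → y ≡ y′
    separated⇒unique {S} {s} {d} {a} {y} {y′} sep dd≤s p p′ q q′ = case compare y y′ of λ where
      (tri≈ _ e _) → e
      (tri< l _ _) → ⊥-elim (≤⇒≯ (sep p p′ l) (<-≤-trans (lower (close-trans (close-sym q) q′)) (≤-refl ≤+≤ dd≤s)))
      (tri> _ _ l) → ⊥-elim (≤⇒≯ (sep p′ p l) (<-≤-trans (lower (close-trans (close-sym q′) q)) (≤-refl ≤+≤ dd≤s)))

    module _ {X : Vec C (suc n) → Set ℓ} (D : DΣ X) {K : Vec C (suc n) → Set ℓ} (dK : Dfn K) (cl : IsClosed K)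
      {lo hi : C} (K-bdd : ∀ {y x} → K (y ∷ x) → lo < y × y ≤ hi) where

      few-near : ∀ {x₀ ε₀} → 𝟘 < ε₀ → (∀ z → Closeⁿ ε₀ x₀ z → ¬ Fat D z × ∃ λ y → K (y ∷ z)) →
        ∃ λ a → ∃ λ e → 𝟘 < e × ∃ λ N → ∃ λ x₁ → ∃ λ ε₁ → 𝟘 < ε₁ × (∀ z → Closeⁿ ε₁ x₁ z → Closeⁿ ε₀ x₀ z ×
          (∃ λ y → K (y ∷ z) × Wide e a y) × ¬ Many _<_ (λ y → X (y ∷ z) × close (e ⊕ e) a y) N)
      few-near {x₀} {ε₀} ε₀>0 onto =
        case localize dK cl K-bdd ε₀>0 (λ z c → proj₂ (onto z c)) of λ (a , near) →
        case fibre-few D a x₀ of λ (N , e₀ , δ , e₀>0 , δ>0 , few) →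
        case half e₀>0 of λ (e , e>0 , ee≤e₀) →
        case min₂ e δ e>0 δ>0 of λ (η₀ , η₀>0 , i₀ , j₀) →
        case min₂ η₀ ε₀ η₀>0 ε₀>0 of λ (η , η>0 , i , j) →
        case near η η>0 of λ (x₁ , ε₁ , ε₁>0 , on) →
        a , e , e>0 , N , x₁ , ε₁ , ε₁>0 , λ z c →
          case on z c of λ (c′ , y , d , k) →
          vc-mono j c′ ,
          (y , k , <⇒≤ (lower (close-mono (≤-trans i i₀) d)) , <⇒≤ (upper (close-mono (≤-trans i i₀) d))) ,
          λ m → few z (vc-mono (≤-trans i j₀) c′) (proj₁ (onto z (vc-mono j c′)))
            (many-map id (λ (x , c) → x , close-mono ee≤e₀ c) m)

      separate : ∀ {x₀ ε₀} → 𝟘 < ε₀ → (∀ z → Closeⁿ ε₀ x₀ z → ¬ Fat D z × ∃ λ y → K (y ∷ z)) →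
        ∃ λ a → ∃ λ e → ∃ λ s → 𝟘 < e × 𝟘 < s × ∃ λ x₁ → ∃ λ ε₁ → 𝟘 < ε₁ × (∀ z → Closeⁿ ε₁ x₁ z → Closeⁿ ε₀ x₀ z ×
          (∃ λ y → K (y ∷ z) × Wide e a y) ×
          (∀ {y y′} → X (y ∷ z) × close (e ⊕ e) a y → X (y′ ∷ z) × close (e ⊕ e) a y′ → y < y′ → y ⊕ s ≤ y′))
      separate {x₀} {ε₀} ε₀>0 onto =
        case few-near ε₀>0 onto of λ (a , e , e>0 , N , x₁ , ε₁ , ε₁>0 , h) →
        case stab (nd n) (Σ-∩ D (Σ-strip (e ⊕ e) a)) N ε₁>0 (λ z c → proj₂ (proj₂ (h z c))) of
          λ (_ , s , s>0 , x₂ , ε₂ , ε₂>0 , st) →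
        a , e , s , e>0 , s>0 , x₂ , ε₂ , ε₂>0 , λ z c →
          case st z c of λ (c₁ , _ , sep) →
          case h z c₁ of λ (c₀′ , k , _) →
          c₀′ , k , λ {y} {y′} p q → sep p q

      -- The separation `s` is known only after the window around `a` has been fixed, so the height
      -- is localized a second time, at a scale `d` with `d ⊕ d ≤ s`. The new window lies within
      -- `e ⊕ e` of `a`, which is why separation was arranged at that radius.
      isolate : ∀ {x₀ ε₀ a e s} → 𝟘 < ε₀ → 𝟘 < e → 𝟘 < s →
        (∀ z → Closeⁿ ε₀ x₀ z → (∃ λ y → K (y ∷ z) × Wide e a y) ×
          (∀ {y y′} → X (y ∷ z) × close (e ⊕ e) a y → X (y′ ∷ z) × close (e ⊕ e) a y′ → y < y′ → y ⊕ s ≤ y′)) →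
        ∃ λ a′ → ∃ λ d → ∃ λ x₁ → ∃ λ ε₁ → 𝟘 < ε₁ × (∀ z → Closeⁿ ε₁ x₁ z → Closeⁿ ε₀ x₀ z ×
          (∃ λ y → close d a′ y × K (y ∷ z)) ×
          (∀ {y y′} → X (y ∷ z) → X (y′ ∷ z) → close d a′ y → close d a′ y′ → y ≡ y′))
      isolate {x₀} {ε₀} {a} {e} {s} ε₀>0 e>0 s>0 h =
        case localize {Y = λ w → K w × Wide e a (lookup w zero)} (dfn-× ⦃ dK ⦄ ⦃ wide-dfn a e ⦄)
          (closed-∩ cl (closed-wide a e)) (λ (k , _) → K-bdd k) ε₀>0 (λ z c → proj₁ (h z c)) of λ (a′ , near) →
        case half s>0 of λ (d₁ , d₁>0 , dd≤s) →
        case half e>0 of λ (d₂ , d₂>0 , dd≤e) →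
        case min₂ d₁ d₂ d₁>0 d₂>0 of λ (d₃ , d₃>0 , k₁ , k₂) →
        case min₂ d₃ ε₀ d₃>0 ε₀>0 of λ (d , d>0 , k₃ , k₄) →
        case near d d>0 of λ (x₁ , ε₁ , ε₁>0 , on) →
        a′ , d , x₁ , ε₁ , ε₁>0 , λ z c →
          case on z c of λ (c₀′ , y₁ , c₁ , k , w) →
          vc-mono k₄ c₀′ , (y₁ , close-sym c₁ , k) ,
          λ {y} {y′} p p′ q q′ → separated⇒unique {S = λ y → X (y ∷ z) × close (e ⊕ e) a y}
            (proj₂ (h z (vc-mono k₄ c₀′))) (≤-trans (≤-trans k₃ k₁ ≤+≤ ≤-trans k₃ k₁) dd≤s)
            (p , close-wide c₁ w (≤-trans (≤-trans k₃ k₂ ≤+≤ ≤-trans k₃ k₂) dd≤e) q)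
            (p′ , close-wide c₁ w (≤-trans (≤-trans k₃ k₂ ≤+≤ ≤-trans k₃ k₂) dd≤e) q′) q q′

  -- `Y` supplies the height of the window. By the Baire property one of its compact members already
  -- covers a box, and the heights of that member can be localized; thinness of the fibres of `X`
  -- then leaves at most one of its points in the window.
  single : {X Y : Vec C (suc n) → Set ℓ} → DΣ X → ¬ HasInt X → DΣ Y → ∀ {x₀ ε₀} → 𝟘 < ε₀ →
    (∀ z → Closeⁿ ε₀ x₀ z → ∃ λ y → Y (y ∷ z)) →
    ∃ λ a → ∃ λ δ → ∃ λ x₁ → ∃ λ ε₁ → 𝟘 < ε₁ × (∀ z → Closeⁿ ε₁ x₁ z → Closeⁿ ε₀ x₀ z ×
      (∃ λ y → close δ a y × Y (y ∷ z)) ×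
      (∀ {y y′} → X (y ∷ z) → X (y′ ∷ z) → close δ a y → close δ a y′ → y ≡ y′))
  single {n} {X} {Y} D ni E {x₀} {ε₀} ε₀>0 onto =
    case nd n (Σ-fat D) (λ i → ni (fat-int D i)) x₀ ε₀ ε₀>0 of λ (x₁ , ε₁ , ε₁>0 , thin) →
    case baire-in (Σ-∃ E) ε₁>0 (x₁ , ε₁ , ε₁>0 , λ z c → onto z (proj₁ (thin z c)) , c) of
      λ (r , s , s>0 , x₂ , ε₂ , ε₂>0 , base) →
    case separate D (E-dfn r s) (fam-closed E r s>0) E-bdd ε₂>0
      (λ z c → proj₂ (thin z (proj₁ (base z c))) , proj₂ (base z c)) of λ (a , e , t , e>0 , t>0 , x₃ , ε₃ , ε₃>0 , sep) →
    case isolate D (E-dfn r s) (fam-closed E r s>0) E-bdd ε₃>0 e>0 t>0 (λ z c → proj₂ (sep z c)) of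
      λ (a′ , d , x₄ , ε₄ , ε₄>0 , iso) →
    a′ , d , x₄ , ε₄ , ε₄>0 , λ z c →
      case iso z c of λ (c₃ , (y , c′ , f) , u) →
      proj₁ (thin z (proj₁ (base z (proj₁ (sep z c₃))))) , (y , c′ , fam⇒∈ E s>0 f) , λ {y} {y′} → u {y} {y′}
    where
    abstract
      E-dfn : ∀ r s → Dfn (fam E r s)
      E-dfn r s = fam-app E (dt-const r) (dt-const s) dm-id
    E-bdd : ∀ {r s y x} → fam E r s (y ∷ x) → (⊖ r) ⊖' c₀ < y × y ≤ r
    E-bdd f = case bd (fam-bdd E f) zero of λ (b , b′) → ⊖-≤ b , b′

  -- Dimension

  Clo : (Vec C n → Set ℓ) → Vec C n → Set ℓ
  Clo P x = ∀ ε → 𝟘 < ε → ∃ λ z → Closeⁿ ε x z × P z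

  closed-Clo : (P : Vec C n → Set ℓ) → IsClosed (Clo P)
  closed-Clo P x h ε ε>0 =
    case half ε>0 of λ (δ , δ>0 , δδ≤ε) →
    case h δ δ>0 of λ (z , c , k) →
    case k δ δ>0 of λ (w , c′ , p) → w , vc-mono δδ≤ε (vc-trans c c′) , p

  ⊆-Clo : {P : Vec C n → Set ℓ} → ∀ {x} → P x → Clo P x
  ⊆-Clo p ε ε>0 = _ , vc-refl ε>0 , p

  dfn-Clo : {P : Vec C n → Set ℓ} → Dfn P → Dfn (Clo P)
  dfn-Clo {P = P} d = it
    where
    instance
      dP : {g : Vec C m → Vec C _} → ⦃ DfnMap g ⦄ → Dfn (λ w → P (g w))
      dP ⦃ γ ⦄ = dfn-∘ d γ

  -- Off this set `A` is closed in a neighbourhood, so `A` is locally closed exactly at its points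
  -- outside `Residue A`. Although a complement occurs in it, `Residue A` is D_Σ for a simple
  -- reason: it is closed and definable.
  Residue : (Vec C n → Set ℓ) → Vec C n → Set ℓ
  Residue A = Clo (λ z → Clo A z × ¬ A z)

  Σ-Residue : {A : Vec C n → Set ℓ} → DΣ A → DΣ (Residue A)
  Σ-Residue {A = A} D = Σ-closed
    (dfn-Clo (dfn-× ⦃ dfn-Clo (set-dfn D) ⦄ ⦃ dfn-¬ ⦃ set-dfn D ⦄ ⦄))
    (closed-Clo (λ z → Clo A z × ¬ A z))

  Image : (Vec C n → Set ℓ) → Vec (Fin n) k → Vec C k → Set ℓ
  Image A σ z = ∃ λ x → A x × π σ x ≡ z

  -- Projections along σ with a repeated coordinate are harmless: their images lie
  -- in a diagonal and never have interior.
  Dim< : (Vec C n → Set ℓ) → ℕ → Set ℓ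
  Dim< {n} A d = (σ : Vec (Fin n) d) → ¬ HasInt (Image A σ)

  ∃V-fam : ∀ n {A : Vec C (n + m) → Set ℓ} (D : DΣ A) {r s x} → fam (Σ-∃V n D) r s x → ∃ λ v → fam D r s (v ++ x)
  ∃V-fam zero    D f = [] , f
  ∃V-fam (suc n) D f = case ∃V-fam n (Σ-∃ D) f of λ (v , y , f′) → y ∷ v , f′

  -- The Baire property, applied to an image, yields a member of the family of the image; by
  -- construction this is the projection of points of one member for `D`.
  image-fam : {A : Vec C n → Set ℓ} (D : DΣ A) (σ : Vec (Fin n) k) → ∀ {r s z} →
    fam (Σ-image D σ) r s z → ∃ λ x → fam D r s x × π σ x ≡ z
  image-fam {n = n} D σ f = case ∃V-fam n _ f of λ (v , (_ , g) , e , _) →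
    tk n (v ++ _) , g , trans (lookup-ext e) (dp-++ v _)

  -- By the pigeonhole principle `σ` repeats a coordinate, and moving only one of the two copies
  -- leaves the diagonal.
  dim<-suc : (A : Vec C n → Set ℓ) → Dim< A (suc n)
  dim<-suc {n} A σ (z , ε , ε>0 , h) =
    case Finₚ.pigeonhole (ℕₚ.n<1+n n) (lookup σ) of λ (i , j , i<j , e) →
    case dense ε>0 of λ (δ , δ>0 , δ<ε) →
    let diag : ∀ {w} → Image A σ w → lookup w i ≡ lookup w j
        diag = λ (x , _ , p) → subst (λ w → lookup w i ≡ lookup w j) p
          (trans (lookup-map i (lookup x) σ) (trans (cong (lookup x) e) (sym (lookup-map j (lookup x) σ))))
        w = z [ i ]≔ (lookup z i ⊕ δ)
        near : ∀ l → close ε (lookup z l) (lookup w l)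
        near l = case l Finₚ.≟ i of λ where
          (yes refl) → subst (close ε (lookup z i)) (sym (lookup∘update i z _))
            (mkC (<-trans (<⊕ δ>0) (<⊕ ε>0)) (≤-refl ≤+< δ<ε))
          (no l≢i)   → subst (close ε (lookup z l)) (sym (lookup∘update′ l≢i z _)) (close-refl ε>0)
    in <-irrefl
      (trans (diag (h z (vc-refl ε>0))) (trans (sym (lookup∘update′ (λ e → Finₚ.<⇒≢ i<j (sym e)) z _))
        (trans (sym (diag (h w (mkCloseⁿ near)))) (lookup∘update i z _))))
      (<⊕ δ>0)

  module _ {A : Vec C n → Set ℓ} (D : DΣ A) {d : ℕ} (dim : Dim< A (suc d)) (σ : Vec (Fin n) d) where
    private
      A′ : Vec C n → Set ℓ
      A′ x = A x × Residue A x

      Σ-A′ : DΣ A′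
      Σ-A′ = Σ-∩ D (Σ-Residue D)

      -- `L` lists the coordinates which, inside `O` and over the box, are determined by the
      -- projection. They are settled one at a time while `O` and the box shrink. Uniqueness
      -- concerns all of `A`, because residue points are limits of `A` and not only of `A′`.
      record Isolated (L : List (Fin n)) : Set (lsuc ℓ) where
        field
          O      : Vec C n → Set ℓ
          O-dfn  : Dfn O
          O-opn  : Opn O
          z₀     : Vec C d
          ε₀     : C
          ε₀>0   : 𝟘 < ε₀
          onto   : ∀ z → Closeⁿ ε₀ z₀ z → Image (λ x → A′ x × O x) σ z
          unique : ∀ {i} → i ∈ˡ L → ∀ {x x′} → A x → A x′ → O x → O x′ → Closeⁿ ε₀ z₀ (π σ x) → π σ x ≡ π σ x′ →
            lookup x i ≡ lookup x′ i

      isolated : HasInt (Image A′ σ) → ∀ L → Isolated L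
      isolated (z₀ , ε₀ , ε₀>0 , onto) [] = record
        { O = λ _ → ⊤ ; O-dfn = dfn-⊤ ; O-opn = λ _ _ → c₀ , c₀>0 , λ _ _ → tt
        ; z₀ = z₀ ; ε₀ = ε₀ ; ε₀>0 = ε₀>0
        ; onto = λ z c → case onto z c of λ (x , a , e) → x , (a , tt) , e
        ; unique = λ () }
      isolated int (i ∷ L) =
        -- The bound on the dimension enters here: with `i` added to `σ` there is one coordinate too
        -- many for the image to have interior.
        case single (Σ-image D (i ∷ σ)) (dim (i ∷ σ)) (Σ-image (Σ-∩ Σ-A′ (Σ-open O-dfn O-opn)) (i ∷ σ)) ε₀>0
          (λ z c → case onto z c of λ (x , p , e) → lookup x i , x , p , cong (lookup x i ∷_) e) of
          λ (a , δ , z₁ , ε₁ , ε₁>0 , h) → record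
        { O      = λ x → O x × close δ a (lookup x i)
        ; O-dfn  = dfn-× ⦃ O-dfn ⦄ ⦃ dfn-close (dt-const δ) (dt-const a) (dt-lookup i) ⦄
        ; O-opn  = λ x (o , c) →
            case O-opn x o of λ (η₁ , η₁>0 , f) →
            case close-shrink c of λ (η₂ , η₂>0 , g) →
            case min₂ η₁ η₂ η₁>0 η₂>0 of λ (η , η>0 , u , v) →
            η , η>0 , λ w c′ → f w (vc-mono u c′) , g (lookup w i) (close-mono v (at c′ i))
        ; z₀ = z₁ ; ε₀ = ε₁ ; ε₀>0 = ε₁>0
        ; onto   = λ z c → case h z c of λ (_ , (y , c′ , x , (a′ , o) , e) , _) →
            x , (a′ , o , subst (close δ a) (sym (∷-injectiveˡ e)) c′) , ∷-injectiveʳ e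
        ; unique = λ where
            (here refl) {x} {x′} p p′ (_ , c) (_ , c′) b e → case h (π σ x) b of λ (_ , _ , u) →
              u {lookup x i} {lookup x′ i} (x , p , refl) (x′ , p′ , cong (lookup x′ i ∷_) (sym e)) c c′
            (there j) p p′ (o , _) (o′ , _) b e → unique j p p′ o o′ (proj₁ (h _ b)) e
        }
        where open Isolated (isolated int L)

    residue-dim : ¬ HasInt (Image (λ x → A x × Residue A x) σ)
    residue-dim int =
      case baire-in (Σ-image B σ) ε₀>0 (z₀ , ε₀ , ε₀>0 , λ z c → onto z c , c) of λ (r , s , s>0 , z₁ , ε₁ , ε₁>0 , h) →
      contra r s>0 ε₁>0 h (image-fam B σ (proj₂ (h z₁ (vc-refl ε₁>0))))
      where
      open Isolated (isolated int (List.allFin n))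
      B : DΣ (λ x → A′ x × O x)
      B = Σ-∩ Σ-A′ (Σ-open O-dfn O-opn)
      contra : ∀ r {s z₁ ε₁} → 𝟘 < s → 𝟘 < ε₁ → (∀ z → Closeⁿ ε₁ z₁ z → Closeⁿ ε₀ z₀ z × fam (Σ-image B σ) r s z) →
        (∃ λ x → fam B r s x × π σ x ≡ z₁) → ⊥
      contra r {s} {z₁} {ε₁} s>0 ε₁>0 h (x , f , refl) =
        case fam⇒∈ B s>0 f of λ ((_ , bad) , o) →
        case O-opn x o of λ (η₁ , η₁>0 , O⊇) →
        case min₂ η₁ ε₁ η₁>0 ε₁>0 of λ (η , η>0 , u , v) →
        -- A limit `q` of `A` outside `A`. Near `x`, however, `A` lies in the closed member
        -- `fam B r s`, so `q` belongs to that member and hence to `A`.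
        case bad η η>0 of λ (q , c , q∈Clo , q∉A) →
        q∉A (proj₁ (proj₁ (fam⇒∈ B s>0 (limit q (O⊇ q (vc-mono u c)) (vc-mono v (vc-π σ c)) q∈Clo))))
        where
        capture : ∀ {y} → A y → O y → Closeⁿ ε₁ z₁ (π σ y) → fam B r s y
        capture {y} a o c = case h (π σ y) c of λ (c₀′ , g) →
          case image-fam B σ g of λ (y′ , g′ , e) →
          subst (fam B r s) (lookup-ext λ i → sym
            (unique (∈ˡ.∈-allFin i) a (proj₁ (proj₁ (fam⇒∈ B s>0 g′))) o (proj₂ (fam⇒∈ B s>0 g′)) c₀′ (sym e))) g′
        limit : ∀ q → O q → Closeⁿ ε₁ z₁ (π σ q) → Clo A q → fam B r s q
        limit q o c q∈Clo = fam-closed B r s>0 q λ ε ε>0 →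
          case O-opn q o of λ (η₁ , η₁>0 , O⊇) →
          case vc-shrink ε₁>0 c of λ (η₂ , η₂>0 , g) →
          case min₂ η₁ η₂ η₁>0 η₂>0 of λ (η₃ , η₃>0 , u , v) →
          case min₂ η₃ ε η₃>0 ε>0 of λ (η , η>0 , u′ , v′) →
          case q∈Clo η η>0 of λ (y , c′ , a) →
          y , vc-mono v′ c′ , capture a (O⊇ y (vc-mono (≤-trans u′ u) c′)) (g _ (vc-mono (≤-trans u′ v) (vc-π σ c′)))

  -- A point is outside `A` iff it is outside `A ∩ Residue A` and, moreover, outside the closure of
  -- `A` or in `Residue A`. Only the first condition complements a set that is not closed, and that
  -- set has smaller dimension.
  Σ-¬-dim : ∀ d {A : Vec C n → Set ℓ} → DΣ A → Dim< A d → DΣ (λ x → ¬ A x)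
  Σ-¬-dim zero D dim = Σ-≐
    -- Any nonempty set projects onto the one-point space, so dimension below 0 means that `A` is
    -- empty.
    (λ {x} _ a → dim [] ([] , c₀ , c₀>0 , λ where [] _ → x , a , refl)) (λ _ → tt)
    (Σ-closed dfn-⊤ λ _ _ → tt)
  Σ-¬-dim (suc d) {A} D dim = Σ-≐
    (λ (na′ , out) a → case out of λ where
      (inj₁ nc)  → nc (⊆-Clo a)
      (inj₂ bad) → na′ (a , bad))
    (λ {x} na → (λ (a , _) → na a) , by-cases (Clo A x) (λ c → inj₂ (⊆-Clo (c , na))) inj₁)
    (Σ-∩ (Σ-¬-dim d (Σ-∩ D (Σ-Residue D)) (residue-dim D dim))
      (Σ-∪ (Σ-open (dfn-¬ ⦃ dfn-Clo (set-dfn D) ⦄) λ x nc → escape {K = Clo A} (closed-Clo A) nc) (Σ-Residue D)))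

  Σ-¬ : {A : Vec C n → Set ℓ} → DΣ A → DΣ (λ x → ¬ A x)
  Σ-¬ {n} {A} D = Σ-¬-dim (suc n) D (dim<-suc A)

  -- Formulas of the open core

  IsOpen⇒Opn : {P : Vec C n → Set ℓ} → IsOpen R P → Opn P
  IsOpen⇒Opn op x p = case op x p of λ (B , x∈B , B⊆P) →
    case nbhd B x∈B of λ (δ , δ>0 , f) → δ , δ>0 , λ z c → B⊆P (f z c)
    where
    nbhd : ∀ {n} {x : Vec C n} (B : Vec (C ± × C ±) n) → BasicOpenBox R B x → ∃ λ δ → 𝟘 < δ × (∀ z → Closeⁿ δ x z → BasicOpenBox R B z)
    nbhd []       []       = c₀ , c₀>0 , λ where [] _ → []
    nbhd ((l , u) ∷ B) (p ∷ ps) =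
      case basic-nbhd l u p of λ (δ₁ , δ₁>0 , f) →
      case nbhd B ps of λ (δ₂ , δ₂>0 , g) →
      case min₂ δ₁ δ₂ δ₁>0 δ₂>0 of λ (δ , δ>0 , i , j) →
      δ , δ>0 , λ where
        (y ∷ z) c → f (<⇒≤ (upper (close-mono i (vc-hd c)))) (<⇒≤ (lower (close-mono i (vc-hd c)))) ∷ g z (vc-mono j (vc-tl c))

  dm-ren : (g : Vec C m → Vec C n) (σ : Fin n → Fin m) → (∀ x → Agree σ (g x) x) → DfnMap g
  dm-ren g σ h = mkDfnMap λ i → dt-≐ (λ x → sym (h x i)) (dt-lookup (σ i))

  dm-++ : (c : Vec C k) → DfnMap {n} (λ x → x ++ c)
  dm-++ {n = n} c = mkDfnMap λ i → dt-≐ (λ x → sym (lookup-splitAt n x c i)) (coordinate (splitAt n i))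
    where
    coordinate : (j : Fin n ⊎ Fin _) → DfnFun (λ x → [ lookup x , lookup c ]′ j)
    coordinate (inj₁ j) = dt-lookup j
    coordinate (inj₂ j) = dt-const (lookup c j)

  vc-++ : (c : Vec C k) → ∀ {ε} {x z : Vec C n} → 𝟘 < ε → Closeⁿ ε x z → Closeⁿ ε (x ++ c) (z ++ c)
  vc-++ {n = zero}  c {x = []}    {[]}    ε>0 v = vc-refl ε>0
  vc-++ {n = suc n} c {x = y ∷ x} {w ∷ z} ε>0 v = vc-∷ (vc-hd v) (vc-++ c ε>0 (vc-tl v))

  Core : Structure (openCoreLanguage R)
  Core = openCoreStructure R

  index : Term (openCoreLanguage R) n → Fin n
  index (var i) = i

  eval-index : ∀ (t : Term (openCoreLanguage R) n) x → eval Core t x ≡ lookup x (index t)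
  eval-index (var i) x = refl

  indices : Vec (Term (openCoreLanguage R) n) k → Fin k → Fin n
  indices ts i = index (lookup ts i)

  evals-agree : ∀ (ts : Vec (Term (openCoreLanguage R) n) k) x → Agree (indices ts) (evals Core ts x) x
  evals-agree (t ∷ ts) x zero    = eval-index t x
  evals-agree (t ∷ ts) x (suc i) = evals-agree ts x i

  -- Relation symbols denote open sets, and equality is closed. Negation is the only connective that
  -- needs the induction on dimension.
  Σ-sat : (φ : Formula (openCoreLanguage R) n) → DΣ (sat Core φ)
  Σ-sat (rel (_ , X , op) ts) = Σ-pre (Σ-open (dfn-⟦⟧ X) (IsOpen⇒Opn op))
    (dm-ren _ _ (evals-agree ts)) (λ _ → vc-ren (evals-agree ts))
  Σ-sat (s ≈ᶠ t) = Σ-closed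
    (dfn-≡′ (dt-≐ (λ x → sym (eval-index s x)) (dt-lookup (index s))) (dt-≐ (λ x → sym (eval-index t x)) (dt-lookup (index t))))
    λ x h → trans (eval-index s x) (trans (limit-≡ λ ε ε>0 →
        case half ε>0 of λ (δ , δ>0 , δδ≤ε) →
        case h δ δ>0 of λ (z , c , e) →
        close-mono δδ≤ε (close-trans (at c (index s))
          (subst (λ a → close δ a (lookup x (index t)))
            (trans (sym (eval-index t z)) (trans (sym e) (eval-index s z))) (close-sym (at c (index t))))))
      (sym (eval-index t x)))
  Σ-sat (¬ᶠ φ)   = Σ-¬ (Σ-sat φ)
  Σ-sat (φ ∧ᶠ ψ) = Σ-∩ (Σ-sat φ) (Σ-sat ψ)
  Σ-sat (∃ᶠ φ)   = Σ-∃ (Σ-sat φ)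

  -- The coordinate of the fibre is the last one in `fibre`, but the first one for D_Σ sets, where
  -- projections eliminate the first coordinate.
  Σ-core : (X : Definable (openCore R) (n + 1)) → DΣ (un₁ λ y x → fibre (openCore R) X x y)
  Σ-core {n} (definable φ c) = Σ-≐ (λ { {_ ∷ _} p → p }) (λ { {_ ∷ _} p → p })
    (Σ-pre (Σ-pre (Σ-sat φ) (dm-++ c) (vc-++ c)) (dm-ren snoc σ agree) (λ _ → vc-ren agree))
    where
    snoc : Vec C (suc n) → Vec C (n + 1)
    snoc (y ∷ x) = x ++ y ∷ []
    σ : Fin (n + 1) → Fin (suc n)
    σ i = [ suc , (λ _ → zero) ]′ (splitAt n i)
    agree : ∀ w → Agree σ (snoc w) w
    agree (y ∷ x) i = trans (lookup-splitAt n x (y ∷ []) i) (choose (splitAt n i))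
      where
      choose : (j : Fin n ⊎ Fin 1) → [ lookup x , lookup (y ∷ []) ]′ j ≡ lookup (y ∷ x) ([ suc , (λ _ → zero) ]′ j)
      choose (inj₁ j)    = refl
      choose (inj₂ zero) = refl

  -- The fibrewise boundary

  Near : (C → Set ℓ) → C → C → Set ℓ
  Near S ε y = ∃ λ z → close ε y z × S z

  Bd : (C → Set ℓ) → C → Set ℓ
  Bd S y = ∀ ε → 𝟘 < ε → Near S ε y × Near (λ z → ¬ S z) ε y

  fib : (Vec C (suc n) → Set ℓ) → Vec C n → C → Set ℓ
  fib A x y = A (y ∷ x)

  -- The distance `ε` is a coordinate, because `Σ-bd` quantifies over it; `close` is open in all
  -- three of its arguments.
  Σ-near : {A : Vec C (suc n) → Set ℓ} → DΣ A → DΣ (un₂ λ ε y x → Near (fib A x) ε y)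
  Σ-near {n} D = Σ-≐ (λ { {_ ∷ _ ∷ _} p → p }) (λ { {_ ∷ _ ∷ _} p → p })
    (Σ-∃ (Σ-∩ Σ-close (Σ-pre D (dm-ren skip σ agree) (λ _ → vc-ren agree))))
    where
    skip : Vec C (3 + n) → Vec C (suc n)
    skip (z ∷ _ ∷ _ ∷ x) = z ∷ x
    σ : Fin (suc n) → Fin (3 + n)
    σ zero    = zero
    σ (suc i) = suc (suc (suc i))
    agree : ∀ w → Agree σ (skip w) w
    agree (_ ∷ _ ∷ _ ∷ _) zero    = refl
    agree (_ ∷ _ ∷ _ ∷ _) (suc i) = refl
    less-opn : ∀ {a b ε} → a < b ⊕ ε → ∃ λ δ → 𝟘 < δ × (∀ {a′ b′ ε′} → close δ a a′ → close δ b b′ → close δ ε ε′ → a′ < b′ ⊕ ε′)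
    less-opn {a} {b} {ε} p =
      case gap p of λ (d , d>0 , q) →
      -- A quarter of the slack `d` is enough, as three arguments move by `δ` each.
      case half d>0 of λ (d₁ , d₁>0 , dd≤d) →
      case half d₁>0 of λ (δ , δ>0 , δδ≤d₁) →
      δ , δ>0 , λ {a′} {b′} {ε′} u v w →
        by< (q <+< lower u <+< upper v <+< upper w <+≤ ≤-trans (≤-trans (<⇒≤ (three δ>0)) (δδ≤d₁ ≤+≤ δδ≤d₁)) dd≤d)
          (prove′ a′ b′ ε′ a b ε d δ)
      where
      three : ∀ {δ} → 𝟘 < δ → (δ ⊕ δ) ⊕ δ < (δ ⊕ δ) ⊕ (δ ⊕ δ)
      three δ>0 = ≤-refl ≤+< <⊕ δ>0
      prove′ : ∀ a′ b′ ε′ a b ε d δ →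
        a′ ⊕ (((((b ⊕ ε) ⊕ (a ⊕ δ)) ⊕ (b′ ⊕ δ)) ⊕ (ε′ ⊕ δ)) ⊕ d) ≡
        (b′ ⊕ ε′) ⊕ (((((a ⊕ d) ⊕ a′) ⊕ b) ⊕ ε) ⊕ ((δ ⊕ δ) ⊕ δ))
      prove′ a′ b′ ε′ a b ε d δ = prove 8
        (:a :+ (((((:e :+ :f) :+ (:d :+ :h)) :+ (:b :+ :h)) :+ (:c :+ :h)) :+ :g))
        ((:b :+ :c) :+ (((((:d :+ :g) :+ :a) :+ :e) :+ :f) :+ ((:h :+ :h) :+ :h)))
        (a′ ∷ b′ ∷ ε′ ∷ a ∷ b ∷ ε ∷ d ∷ δ ∷ [])
        where
        :g :h : Expr 8
        :g = :v (suc (suc (suc (suc (suc (suc zero))))))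
        :h = :v (suc (suc (suc (suc (suc (suc (suc zero)))))))
    Σ-close : DΣ {3 + n} (λ w → close (lookup w (suc zero)) (lookup w (suc (suc zero))) (lookup w zero))
    Σ-close = Σ-open (dfn-close (dt-lookup _) (dt-lookup _) (dt-lookup _)) λ w (mkC p q) →
      case less-opn p of λ (δ₁ , δ₁>0 , f) →
      case less-opn q of λ (δ₂ , δ₂>0 , g) →
      case min₂ δ₁ δ₂ δ₁>0 δ₂>0 of λ (δ , δ>0 , i , j) →
      δ , δ>0 , λ z c → mkC
        (f (close-mono i (at c (suc (suc zero)))) (close-mono i (at c zero)) (close-mono i (at c (suc zero))))
        (g (close-mono j (at c zero)) (close-mono j (at c (suc (suc zero)))) (close-mono j (at c (suc zero))))

  -- The quantifier over all `ε` is expressed by complements and a projection, the operations under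
  -- which D_Σ sets are now known to be stable.
  Σ-bd : {A : Vec C (suc n) → Set ℓ} → DΣ A → DΣ (un₁ λ y x → Bd (fib A x) y)
  Σ-bd {n} {A} D = Σ-≐
    (λ { {y ∷ x} h ε ε>0 → dne (λ k → h (ε , ε>0 , inj₁ k)) , dne (λ k → h (ε , ε>0 , inj₂ k)) })
    (λ { {y ∷ x} h (ε , ε>0 , k) → [ (λ i → i (proj₁ (h ε ε>0))) , (λ o → o (proj₂ (h ε ε>0))) ]′ k })
    (Σ-¬ (Σ-∃ (Σ-∩ Σ-pos (Σ-∪ (Σ-¬ (Σ-near D)) (Σ-¬ (Σ-near (Σ-¬ D)))))))
    where
    Σ-pos : DΣ {2 + n} (λ w → 𝟘 < lookup w zero)
    Σ-pos = Σ-open (dfn-<′ (dt-const 𝟘) (dt-lookup zero)) λ w p →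
      case open-nbhd p (<⊕ {lookup w zero} c₀>0) of λ (δ , δ>0 , f) → δ , δ>0 , λ z c → proj₁ (f (at c zero))

  -- A fibre which is dense in an interval has interior there, by nowhere density.
  bd-thin : {A : Vec C (suc n) → Set ℓ} → DΣ A → ∀ x → ¬ HasInt₁ (Bd (fib A x))
  bd-thin {n} {A} D x (y , ε , ε>0 , h) = by-cases (HasInt (λ w → B w × Closeⁿ ε (y ∷ []) w))
    (λ where
      (z ∷ [] , δ , δ>0 , k) → case proj₂ (h z (vc-hd (proj₂ (k (z ∷ []) (vc-refl δ>0)))) δ δ>0) of λ (u , c , nu) →
        nu (proj₁ (k (u ∷ []) (vc-∷ c vc-[]))))
    (λ ni → case nd 1 (Σ-∩ D₁ (Σ-box (y ∷ []) ε>0)) ni (y ∷ []) ε ε>0 of λ where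
      (z ∷ [] , δ , δ>0 , k) → case proj₁ (h z (vc-hd (proj₁ (k (z ∷ []) (vc-refl δ>0)))) δ δ>0) of λ (u , c , au) →
        case k (u ∷ []) (vc-∷ c vc-[]) of λ (c′ , nu) → nu (au , c′))
    where
    B : Vec C 1 → Set ℓ
    B w = A (lookup w zero ∷ x)
    D₁ : DΣ B
    D₁ = Σ-pre D (dm-∷ (dt-lookup zero) dm-const) (λ ε>0 v → vc-∷ (at v zero) (vc-refl ε>0))

  fibre-dfn : {A : Vec C (suc n) → Set ℓ} → DΣ A → ∀ x → Dfn {1} (λ w → fib A x (hd w))
  fibre-dfn D x = dfn-∘ (set-dfn D) {λ w → hd w ∷ x} (dm-∷ dt-hd dm-const)

  -- Cutting a set at its boundary points

  module _ {S : C → Set ℓ} (d : Dfn {1} (λ w → S (hd w))) where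
    private
      instance
        dS : {f : Vec C m → C} → ⦃ DfnFun f ⦄ → Dfn (λ w → S (f w))
        dS ⦃ δ ⦄ = dfn-≐ (subst S (hd-∷ _ _)) (subst S (sym (hd-∷ _ _))) (dfn-∘ {P = λ w → S (hd w)} d (dm-∷ δ (dm-const {c = []})))

    -- The witness is the infimum of the points of the complement above `p`.
    boundary-between : ∀ {p q} → p < q → S p → ¬ S q → ∃ λ b → p ≤ b × b ≤ q ×
      (∀ ε → 𝟘 < ε → (∃ λ z → close ε b z × S z) × (∃ λ z → close ε b z × ¬ S z))
    boundary-between {p} {q} p<q Sp nSq =
      case cut dP up ¬Plo Pq of λ (a , ¬P , Pt) → a , p≤ a Pt , ≮⇒≥ (λ q<a → ¬P q q<a Pq) , λ ε ε>0 →
        inside a ¬P (p≤ a Pt) ε ε>0 , outside a ¬P Pt ε ε>0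
      where
      P : C → Set ℓ
      P t = ∃ λ z → p ≤ z × z ≤ t × ¬ S z
      abstract
        dP : Dfn {1} (λ w → P (hd w))
        dP = it
      up : ∀ {t t′} → t ≤ t′ → P t → P t′
      up l (z , p≤z , z≤t , nz) = z , p≤z , ≤-trans z≤t l , nz
      ¬Plo : ¬ P p
      ¬Plo (z , inj₁ p<z , z≤p , nz) = ≤⇒≯ z≤p p<z
      ¬Plo (z , inj₂ refl , _ , nz)  = nz Sp
      Pq : P q
      Pq = q , <⇒≤ p<q , ≤-refl , nSq
      p≤ : ∀ a → (∀ t → a < t → P t) → p ≤ a
      p≤ a Pt = ≮⇒≥ λ a<p → ¬Plo (Pt p a<p)
      inside : ∀ a → (∀ t → t < a → ¬ P t) → p ≤ a → ∀ ε → 𝟘 < ε → ∃ λ z → close ε a z × S z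
      inside a ¬P (inj₂ refl) ε ε>0 = p , close-refl ε>0 , Sp
      inside a ¬P (inj₁ p<a)  ε ε>0 = case between of λ (z , p≤z , <z , z<a) →
        z , mkC (subst (_< z ⊕ ε) (⊖-cancel a ε) (<-translation ε <z)) (<-trans z<a (<⊕ ε>0)) ,
        dne λ nz → ¬P z z<a (z , p≤z , ≤-refl , nz)
        where
        between : ∃ λ z → p ≤ z × a ⊖' ε < z × z < a
        between = case <⊎≥ p (a ⊖' ε) of λ where
          (inj₁ l) → case dense (⊖'< {a} ε>0) of λ (z , l′ , z<a) → z , <⇒≤ (<-trans l l′) , l′ , z<a
          (inj₂ l) → case dense p<a of λ (z , p<z , z<a) → z , <⇒≤ p<z , ≤-<-trans l p<z , z<a
      outside : ∀ a → (∀ t → t < a → ¬ P t) → (∀ t → a < t → P t) → ∀ ε → 𝟘 < ε → ∃ λ z → close ε a z × ¬ S z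
      outside a ¬P Pt ε ε>0 =
        case dense (<⊕ {a} ε>0) of λ (t , a<t , t<a+ε) →
        case Pt t a<t of λ (z , p≤z , z≤t , nz) →
        z , mkC (≤-<-trans (≮⇒≥ λ z<a → ¬P z z<a (z , p≤z , ≤-refl , nz)) (<⊕ ε>0)) (≤-<-trans z≤t t<a+ε) , nz

  chain-snoc : {S : C → Set ℓ} → ∀ k {y p} → (y < p → Chain _<_ (λ z → S z × z < p) k y → S p → Chain _<_ S (suc k) y)
  chain-snoc zero    {p = p} y<p _ s = p , y<p , s , tt
  chain-snoc (suc k) y<p (z , y<z , (s , z<p) , c) s′ = z , y<z , s , chain-snoc k z<p c s′

  -- Cutting at a point `p` of `B` leaves one point fewer on each side, since `p` would extend a
  -- chain from either. Without such a point, `S` or its complement fills the interval.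
  finite-union : {S B : C → Set ℓ} → Dfn {1} (λ w → S (hd w)) →
    (∀ {y} → (∀ ε → 𝟘 < ε → (∃ λ z → close ε y z × S z) × (∃ λ z → close ε y z × ¬ S z)) → B y) →
    ∀ k {u v} → ¬ Many _<_ (λ y → B y × u < y × y < v) k → IsFiniteUnion (openCore R) (S ∩ᵘ Open (openCore R) (u , v))
  finite-union {S} {B} d bd⇒B k {u} {v} few = by-cases (∃ λ p → B p × u < p × p < v)
    (λ (p , Bp , u<p , p<v) → split k few Bp u<p p<v)
    (λ none → by-cases (∃ λ p → S p × u < p × p < v)
      (λ (p , Sp , u<p , p<v) → inj₂ (u , v) ∷ [] ,
        (λ {q} (_ , i) → here i) ,
        λ {q} → λ where
          (here (u<q , q<v)) → dne (λ nq → none (separated p q Sp nq u<p p<v u<q q<v)) , u<q , q<v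
          (there ()))
      (λ no → [] , (λ {q} (s , u<q , q<v) → ⊥-elim (no (_ , s , u<q , q<v))) , λ {q} ()))
    where
    separated : ∀ p q → S p → ¬ S q → u < p → p < v → u < q → q < v → ∃ λ b → B b × u < b × b < v
    separated p q Sp nq u<p p<v u<q q<v = case compare p q of λ where
      (tri< p<q _ _)  → case boundary-between d p<q Sp nq of λ (b , p≤b , b≤q , bd) →
        b , bd⇒B bd , <-≤-trans u<p p≤b , ≤-<-trans b≤q q<v
      (tri≈ _ refl _) → ⊥-elim (nq Sp)
      -- A set and its complement have the same boundary, so the roles of `p` and `q` can be
      -- exchanged.
      (tri> _ _ q<p)  → case boundary-between {S = λ y → ¬ S y} (dfn-¬ ⦃ d ⦄) q<p nq (λ n → n Sp) of λ (b , q≤b , b≤p , bd) →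
        b , bd⇒B (λ ε ε>0 → case bd ε ε>0 of λ (i , o) → map₂ (map₂ dne) o , i) , <-≤-trans u<q q≤b , ≤-<-trans b≤p p<v
    split : ∀ k → ¬ Many _<_ (λ y → B y × u < y × y < v) k → ∀ {p} → B p → u < p → p < v → IsFiniteUnion (openCore R) (S ∩ᵘ Open (openCore R) (u , v))
    split zero    few Bp u<p p<v = ⊥-elim (few (_ , (Bp , u<p , p<v) , tt))
    split (suc k) few {p} Bp u<p p<v =
      case finite-union d bd⇒B k {u} {p} (λ (y , (b , u<y , y<p) , c) → few (y , (b , u<y , <-trans y<p p<v) ,
        chain-snoc k y<p (chain-map id (λ (b , u<z , z<p) → (b , u<z , <-trans z<p p<v) , z<p) k c) (Bp , u<p , p<v))) of
        λ (ps , f , f′) →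
      case finite-union d bd⇒B k {p} {v} (λ (y , (b , p<y , y<v) , c) → few (p , (Bp , u<p , p<v) , y , p<y ,
        (b , <-trans u<p p<y , y<v) , chain-map id (λ (b , p<z , z<v) → b , <-trans u<p p<z , z<v) k c)) of
        λ (qs , g , g′) →
      ps List.++ mid (em {P = S p}) List.++ qs ,
      (λ {y} (s , u<y , y<v) → case compare y p of λ where
        (tri< y<p _ _)  → Anyₚ.++⁺ˡ (f (s , u<y , y<p))
        (tri≈ _ refl _) → Anyₚ.++⁺ʳ ps (Anyₚ.++⁺ˡ (mid-∈ (em {P = S p}) s))
        (tri> _ _ p<y)  → Anyₚ.++⁺ʳ ps (Anyₚ.++⁺ʳ (mid (em {P = S p})) (g (s , p<y , y<v)))) ,
      λ {y} i → case Anyₚ.++⁻ ps i of λ where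
        (inj₁ j) → case f′ j of λ (s , u<y , y<p) → s , u<y , <-trans y<p p<v
        (inj₂ j) → case Anyₚ.++⁻ (mid (em {P = S p})) j of λ where
          (inj₁ l) → case ∈-mid (em {P = S p}) l of λ (s , e) → s , subst (u <_) (sym e) u<p , subst (_< v) (sym e) p<v
          (inj₂ l) → case g′ l of λ (s , p<y , y<v) → s , <-trans u<p p<y , y<v
      where
      mid : Dec (S p) → List (C ⊎ Interval R)
      mid (yes _) = inj₁ p ∷ []
      mid (no  _) = []
      mid-∈ : ∀ s? → S p → Any (λ i → PointOrInterval (openCore R) i p) (mid s?)
      mid-∈ (yes _) s = here refl
      mid-∈ (no ns) s = ⊥-elim (ns s)
      ∈-mid : ∀ s? {y} → Any (λ i → PointOrInterval (openCore R) i y) (mid s?) → S y × y ≡ p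
      ∈-mid (yes s) (here refl) = s , refl

  -- Local o-minimality of the open core

  module _ (X : Definable (openCore R) (n + 1)) where
    A : Vec C (suc n) → Set ℓ
    A = un₁ λ y x → fibre (openCore R) X x y

    Σ-boundary : DΣ (un₁ λ y x → Bd (fib A x) y)
    Σ-boundary = Σ-bd (Σ-core X)

    tame : ∀ a e x N → ¬ Many _<_ (λ y → Bd (fib A x) y × close e a y) N →
      IsFiniteUnion (openCore R) (fibre (openCore R) X x ∩ᵘ Open (openCore R) (a ⊖' e , a ⊕ e))
    tame a e x N few = finite-union {S = fib A x} {B = Bd (fib A x)} (fibre-dfn (Σ-core X) x) (λ h → h) N
      (λ m → few (many-map id (λ {y} (b , p , q) → b , mkC (subst (_< y ⊕ e) (⊖-cancel a e) (<-translation e p)) q) m))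

    no-int : ∀ x r {s} → 𝟘 < s → ¬ HasInt₁ (λ y → fam Σ-boundary r s (y ∷ x))
    no-int x r s>0 i = bd-thin (Σ-core X) x (int₁-map (fam⇒∈ Σ-boundary s>0) i)

    tame-near : ∀ a b → ∃ λ I → Σ[ B ∈ Vec (Interval R) n ] Open R I a × OpenBox R B b ×
      (∀ x → OpenBox R B x → IsFiniteUnion (openCore R) (fibre (openCore R) X x ∩ᵘ Open (openCore R) I))
    tame-near a b = case local-bound Σ-boundary a b of λ (N , e , δ , e>0 , δ>0 , bound) →
      (a ⊖' e , a ⊕ e) , map (λ c → c ⊖' δ , c ⊕ δ) b , (⊖'< e>0 , <⊕ e>0) , centre δ>0 b ,
      λ x x∈B → tame a e x N (bound x (box-close δ b x x∈B) (no-int x))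
      where
      centre : ∀ {δ n} → 𝟘 < δ → (b : Vec C n) → OpenBox R (map (λ c → c ⊖' δ , c ⊕ δ) b) b
      centre δ>0 []      = []
      centre δ>0 (c ∷ b) = (⊖'< δ>0 , <⊕ δ>0) ∷ centre δ>0 b
      box-close : ∀ {n} δ (b x : Vec C n) → OpenBox R (map (λ c → c ⊖' δ , c ⊕ δ) b) x → Closeⁿ δ b x
      box-close δ []      []      []             = mkCloseⁿ λ ()
      box-close δ (c ∷ b) (y ∷ x) ((p , q) ∷ ps) =
        vc-∷ (mkC (subst (_< y ⊕ δ) (⊖-cancel c δ) (<-translation δ p)) q) (box-close δ b x ps)

    testSet : C → Definable R ((3 + n) + 1)
    testSet a = FibreBound.gapSet Σ-boundary a

    tame-uniform : ∀ {a e I N} → 𝟘 < e → e ≤ c₀ → (∀ {y} → a ≤ y ⊕ e → y ≤ a ⊕ e → Closed R I y) →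
      (∀ w → UniformlyFiniteNear R a I N (fibre R {m = 3 + n} (testSet a) w)) →
      ∀ x → IsFiniteUnion (openCore R) (fibre (openCore R) X x ∩ᵘ Open (openCore R) (a ⊖' e , a ⊕ e))
    tame-uniform {a} {e} {I} {N} e>0 e≤c₀ e⊆I ufn x = tame a e x N
      -- The bound holds for all parameters here, so any positive limit on the scales is allowed,
      -- and `c₀` is taken.
      (FibreBound.fibre-bound Σ-boundary a x (no-int x) {I = I} e>0 e≤c₀ e⊆I c₀>0 (λ {η} {s} {ζ} _ _ _ _ _ _ → ufn (η ∷ s ∷ ζ ∷ x)))

  -- The interval is fixed before `X` is named. Even a single subset of the line leads to a test set
  -- with the three parameters `η`, `s` and `ζ`, which is why uniformity in parameters is needed.
  sluf⇒strong : SLUF R → StronglyLocallyOMinimal (openCore R)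
  sluf⇒strong (_ , sluf) a =
    case sluf a of λ (I , a∈I , uf) →
    case int-nbhd {I} a∈I of λ (e , e>0 , e≤c₀ , e⊆I) →
    (a ⊖' e , a ⊕ e) , (⊖'< e>0 , <⊕ e>0) , λ X →
      case uf 3 (testSet {0} X a) of λ (N , _ , ufn) → tame-uniform {0} X {I = I} e>0 e≤c₀ e⊆I ufn []

  luf₁⇒uniform₁ : LUF₁ R → UniformlyLocallyOMinimal₁ (openCore R)
  luf₁⇒uniform₁ (_ , luf₁) n _ X a =
    case luf₁ (3 + n) (testSet X a) a of λ (N , I , _ , a∈I , ufn) →
    case int-nbhd {I} a∈I of λ (e , e>0 , e≤c₀ , e⊆I) →
    (a ⊖' e , a ⊕ e) , (⊖'< e>0 , <⊕ e>0) , tame-uniform X {I = I} e>0 e≤c₀ e⊆I ufn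

  luf₂⇒uniform₂ : UniformlyLocallyOMinimal₂ (openCore R)
  luf₂⇒uniform₂ n _ X a b = tame-near X a b

theorem1p1 :
  (∀ {p : Level} → ExcludedMiddle p) →
  ∀ {ℓ : Level} (𝓡 : OrderedGroupExpansion ℓ) →
  let R = OrderedGroupExpansion.orderedStructure 𝓡 in
  DefinablyComplete R →
    (SLUF R → StronglyLocallyOMinimal (openCore R))
  × (LUF₁ R → UniformlyLocallyOMinimal₁ (openCore R))
  × (LUF₂ R → UniformlyLocallyOMinimal₂ (openCore R))
theorem1p1 em 𝓡 dc =
  (λ h@((luf , _) , _) → Tameness.sluf⇒strong em 𝓡 dc luf h) ,
  (λ h@(luf , _) → Tameness.luf₁⇒uniform₁ em 𝓡 dc luf h) ,
  Tameness.luf₂⇒uniform₂ em 𝓡 dc
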